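{- For any positive integer $n$, $$\sum_{\pi\in\mathcal S_n}s^{\mathrm{rmin}(\pi)}x^{p_{\rm silly}(\pi)}w^{\mathrm{des}(\pi)}=\sum_{M\in\mathcal N_n}s^{\min(M)}x^{\mathrm{rne}(M)}w^{\mathrm{int}(M)-1}.$$
   Context: **Permutations.** $\mathcal S_n$ is the set of permutations $\pi=\pi(1)\cdots\pi(n)$ of $[n]=\{1,\dots,n\}$. $\mathrm{rmin}(\pi)$ is the number of values $\pi(j)$ with $\pi(j)<\pi(k)$ for all $k>j$. $p_{\rm silly}(\pi)$ is the number of indices $j$ such that $j=1$ or $\pi(j-1)<\pi(j)$, $\pi(j)<n$, and the value $\pi(j)+1$ occurs to the left of $\pi(j)$ in $\pi(1)\cdots\pi(n)$. $\mathrm{des}(\pi)$ is the number of $j\in\{2,\dots,n\}$ with $\pi(j-1)>\pi(j)$. **Matchings.** A matching $M$ of size $n$ is a partition of $[2n]$ into 2-element arcs; an arc $A$ has opener $\mathrm{op}(A)=\min A$ and closer $\mathrm{cl}(A)=\max A$. Arcs are numbered $M_1,\dots,M_n$ by increasing closer. A left nesting is a pair of arcs $A,B$ with $\mathrm{op}(B)<\mathrm{op}(A)<\mathrm{cl}(A)<\mathrm{cl}(B)$ and $\mathrm{op}(A)=\mathrm{op}(B)+1$. $\mathcal N_n$ is the set of matchings of size $n$ with no left nesting. $\mathrm{rne}(M)$ is the number of $i$ with $\mathrm{op}(M_i)<\mathrm{op}(M_{i-1})<\mathrm{cl}(M_{i-1})=\mathrm{cl}(M_i)-1$. $\min(M)=\#\{i:\mathrm{op}(M_i)<\mathrm{cl}(M_1)\}$.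 $\mathrm{int}(M)=n-\#\{i\in\{2,\dots,n\}:\mathrm{cl}(M_{i-1})=\mathrm{cl}(M_i)-1\}$, i.e. the number of maximal runs of consecutive closers in $1,2,\dots,2n$. -}

module Defs where

open import Algebra.Bundles using (CommutativeSemiring)
open import Data.Fin.Base using (Fin; toℕ; _<_; _>_)
open import Data.Fin.Properties using (_≟_; _<?_; any?; all?)
open import Data.List.Base as List
  using (List; []; [_]; length; filter; allFin; foldr; cartesianProduct; cartesianProductWith)
open import Data.Nat.Base as ℕ using (ℕ; zero; suc; NonZero; _∸_)
import Data.Nat.Properties as ℕ
open import Data.Product using (∃!; ∃-syntax; _×_; _,_; proj₁; proj₂)
open import Data.Sum.Base using (_⊎_)
open import Data.Vec.Base using (Vec; []; _∷_; lookup; head)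
open import Function.Definitions using (Bijective)
open import Level using (Level)
open import Relation.Binary.PropositionalEquality.Core using (_≡_; refl)
open import Relation.Nullary.Decidable
  using (Dec; map′; ¬?; _×-dec_; _⊎-dec_; _→-dec_)
open import Relation.Unary using (Pred; Decidable)

private
  variable
    a p : Level
    A : Set a
    n : ℕ

-- Fin n stands for [n] = {1,…,n}, shifted down by one: the element i of Fin n
-- represents toℕ i + 1.

infix 4 _⋖_ _⋖?_

_⋖_ : Fin n → Fin n → Set
i ⋖ j = toℕ j ≡ suc (toℕ i)

_⋖?_ : (i j : Fin n) → Dec (i ⋖ j)
i ⋖? j = toℕ j ℕ.≟ suc (toℕ i)

# : {P : Pred (Fin n) p} → Decidable P → ℕ
# {n = n} P? = length (filter P? (allFin n))

-- All words of length n over an alphabet; repetition-free if the alphabet is.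
words : List A → ∀ n → List (Vec A n)
words xs zero    = [ [] ]
words xs (suc n) = cartesianProductWith _∷_ xs (words xs n)

∃!? : {P : Pred (Fin n) p} → Decidable P → Dec (∃! _≡_ P)
∃!? P? = map′
  (λ (x , px , u) → x , px , λ {y} → u y)
  (λ (x , px , u) → x , px , λ y → u {y})
  (any? λ x → P? x ×-dec all? λ y → P? y →-dec x ≟ y)

-- One-line notation: π(j) is lookup π j.
Word : ℕ → Set
Word n = Vec (Fin n) n

IsPermutation : Word n → Set
IsPermutation π = Bijective _≡_ _≡_ (lookup π)

isPermutation? : Decidable (IsPermutation {n})
isPermutation? π = map′
  (λ (inj , surj) →
    (λ {i} {j} → inj i j) , λ v → proj₁ (surj v) , λ { refl → proj₂ (surj v) })
  (λ (inj , surj) →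
    (λ i j → inj {i} {j}) , λ v → proj₁ (surj v) , proj₂ (surj v) refl)
  ((all? λ i → all? λ j → (lookup π i ≟ lookup π j) →-dec (i ≟ j))
    ×-dec (all? λ v → any? λ j → lookup π j ≟ v))

𝓢 : ∀ n → List (Word n)
𝓢 n = filter isPermutation? (words (allFin n) n)

module _ (π : Word n) where

  private
    π⟨_⟩ : Fin n → Fin n
    π⟨ j ⟩ = lookup π j

  -- The values of a permutation are distinct, so right-to-left minima may be
  -- counted by their positions.
  IsRLMin : Fin n → Set
  IsRLMin j = ∀ k → k > j → π⟨ j ⟩ < π⟨ k ⟩

  isRLMin? : Decidable IsRLMin
  isRLMin? j = all? λ k → (j <? k) →-dec (π⟨ j ⟩ <? π⟨ k ⟩)

  rmin : ℕ
  rmin = # isRLMin?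

  -- The middle condition is π(j) < n: the 0-based value lies below n ∸ 1.
  IsSilly : Fin n → Set
  IsSilly j =
      (toℕ j ≡ 0 ⊎ ∃[ i ] (i ⋖ j × π⟨ i ⟩ < π⟨ j ⟩))
    × suc (toℕ π⟨ j ⟩) ℕ.< n
    × ∃[ k ] (k < j × π⟨ j ⟩ ⋖ π⟨ k ⟩)

  isSilly? : Decidable IsSilly
  isSilly? j =
          ((toℕ j ℕ.≟ 0) ⊎-dec any? λ i → (i ⋖? j) ×-dec (π⟨ i ⟩ <? π⟨ j ⟩))
    ×-dec (suc (toℕ π⟨ j ⟩) ℕ.<? n)
    ×-dec any? λ k → (k <? j) ×-dec (π⟨ j ⟩ ⋖? π⟨ k ⟩)

  pSilly : ℕ
  pSilly = # isSilly?

  IsDescent : Fin n → Set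
  IsDescent j = ∃[ i ] (i ⋖ j × π⟨ i ⟩ > π⟨ j ⟩)

  isDescent? : Decidable IsDescent
  isDescent? j = any? λ i → (i ⋖? j) ×-dec (π⟨ j ⟩ <? π⟨ i ⟩)

  des : ℕ
  des = # isDescent?

Arc : ℕ → Set
Arc N = Fin N × Fin N

op cl : Arc n → Fin n
op = proj₁
cl = proj₂

-- A matching of size n is stored as the list M₁,…,Mₙ of its arcs.
Arcs : ℕ → Set
Arcs n = Vec (Arc (2 ℕ.* n)) n

module _ (M : Arcs n) where

  private
    op⟨_⟩ cl⟨_⟩ : Fin n → Fin (2 ℕ.* n)
    op⟨ i ⟩ = op (lookup M i)
    cl⟨ i ⟩ = cl (lookup M i)

  -- In order: the opener is the minimum of its arc; every point of [2n] lies
  -- in exactly one arc; arcs are numbered by increasing closer, so that each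
  -- set partition of [2n] into pairs is represented once.
  IsMatching : Set
  IsMatching =
      (∀ i → op⟨ i ⟩ < cl⟨ i ⟩)
    × (∀ x → ∃! _≡_ λ i → x ≡ op⟨ i ⟩ ⊎ x ≡ cl⟨ i ⟩)
    × (∀ i j → i < j → cl⟨ i ⟩ < cl⟨ j ⟩)

  isMatching? : Dec IsMatching
  isMatching? =
          (all? λ i → op⟨ i ⟩ <? cl⟨ i ⟩)
    ×-dec (all? λ x → ∃!? λ i → (x ≟ op⟨ i ⟩) ⊎-dec (x ≟ cl⟨ i ⟩))
    ×-dec (all? λ i → all? λ j → (i <? j) →-dec (cl⟨ i ⟩ <? cl⟨ j ⟩))

  HasLeftNesting : Set
  HasLeftNesting = ∃[ i ] ∃[ j ]
    ( op⟨ j ⟩ < op⟨ i ⟩ × op⟨ i ⟩ < cl⟨ i ⟩ × cl⟨ i ⟩ < cl⟨ j ⟩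
    × op⟨ j ⟩ ⋖ op⟨ i ⟩)

  hasLeftNesting? : Dec HasLeftNesting
  hasLeftNesting? = any? λ i → any? λ j →
          (op⟨ j ⟩ <? op⟨ i ⟩) ×-dec (op⟨ i ⟩ <? cl⟨ i ⟩) ×-dec (cl⟨ i ⟩ <? cl⟨ j ⟩)
    ×-dec (op⟨ j ⟩ ⋖? op⟨ i ⟩)

  IsRightNesting : Fin n → Set
  IsRightNesting i = ∃[ h ]
    (h ⋖ i × op⟨ i ⟩ < op⟨ h ⟩ × op⟨ h ⟩ < cl⟨ h ⟩ × cl⟨ h ⟩ ⋖ cl⟨ i ⟩)

  isRightNesting? : Decidable IsRightNesting
  isRightNesting? i = any? λ h →
          (h ⋖? i) ×-dec (op⟨ i ⟩ <? op⟨ h ⟩) ×-dec (op⟨ h ⟩ <? cl⟨ h ⟩)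
    ×-dec (cl⟨ h ⟩ ⋖? cl⟨ i ⟩)

  rne : ℕ
  rne = # isRightNesting?

  IsCloserAfterCloser : Fin n → Set
  IsCloserAfterCloser i = ∃[ h ] (h ⋖ i × cl⟨ h ⟩ ⋖ cl⟨ i ⟩)

  isCloserAfterCloser? : Decidable IsCloserAfterCloser
  isCloserAfterCloser? i = any? λ h → (h ⋖? i) ×-dec (cl⟨ h ⟩ ⋖? cl⟨ i ⟩)

  -- At most n ∸ 1 indices are counted, so for n ≥ 1 there is no truncation
  -- and int is at least 1.
  int : ℕ
  int = n ∸ # isCloserAfterCloser?

min : .{{_ : NonZero n}} → Arcs n → ℕ
min {n = suc _} M = # λ i → op (lookup M i) <? cl (head M)

𝓝 : ∀ n → List (Arcs n)
𝓝 n = filter (λ M → isMatching? M ×-dec ¬? (hasLeftNesting? M))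
        (words (cartesianProduct (allFin (2 ℕ.* n)) (allFin (2 ℕ.* n))) n)

module Sums {c ℓ} (R : CommutativeSemiring c ℓ) where

  open CommutativeSemiring R using (Carrier; _+_; 0#; semiring)
  open import Algebra.Properties.Semiring.Exp semiring public using (_^_)

  sumOver : List A → (A → Carrier) → Carrier
  sumOver xs f = foldr _+_ 0# (List.map f xs)

  infix 5 sumOver
  syntax sumOver xs (λ x → e) = ∑[ x ∈ xs ] e

module Submission where

-- Both sums are the total weight of the histories of one process. A state is a
-- row of labels; one label is distinguished, and some labels are obliged, which
-- means that they have to be chosen again. At first there is only the
-- distinguished label. Each of the n steps chooses a label, which discharges
-- the obligation on it, and may then draw a bar, which adds one label and makes
-- one label obliged. A history counts if it ends with no obligation left. It
-- gets a factor s whenever the distinguished label is chosen, a factor w for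
-- every bar, and a factor x whenever the choice lies to the left of the
-- preceding choice and no bar was drawn in between. The polynomial F below is
-- this total weight.
--
-- Permutations. Insert the values 1, 2, ..., n one after another. The labels
-- are the ascending runs begun so far, the first of them empty in the
-- beginning. A value v either is appended to a run or, with a bar, begins a new
-- run immediately to the right of a run; the latter is then obliged, as it must
-- receive a value greater than v for v to become a descent bottom. Hence bars
-- count descents. The value v is a right-to-left minimum if and only if the
-- chosen run is the last one, so the last label is distinguished. The value v
-- is counted by pSilly if and only if it comes without a bar and v + 1 chooses
-- a run further left.
--
-- Matchings. Take the arcs by increasing closer. The labels are the maximal
-- runs of openers met so far, and the step of an arc chooses the run of its
-- opener. Without left nestings, the openers of one run are matched in the
-- order of their closers, so the run determines the opener. There is a bar
-- after an arc if its closer is followed by an opener; the run beginning there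
-- is a new last label, obliged because it is not empty. Hence bars count the
-- runs of closers but the last, the openers before the first closer are those
-- of the first label, which is distinguished, and a choice further left without
-- a bar in between is a right nesting.
--
-- The two processes differ only in where a bar puts the obliged label: next to
-- the chosen label, or at the end. The position is irrelevant, because F is
-- invariant under permutations of the row as long as no preceding choice is
-- recorded (F-sym). This is proved by induction on the number of steps, along
-- with an exchange identity: for adjacent labels p and q, choosing p plus
-- choosing q has the same weight in the orders pq and qp, although the choice
-- is remembered for the comparison in the next step.
--
-- The sum over permutations is computed by permutation-sum, through words that
-- record the state of the insertion process run backwards, and the sum over
-- matchings by matching-sum, through the sequences of choices; F-insertion
-- identifies the results.

open import Defs
open import Algebra.Bundles using (CommutativeSemiring)
open import Data.Nat.Base using (ℕ; NonZero; _∸_)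

open import Data.Bool.Base using (Bool; true; false; _∧_; _∨_; if_then_else_; T; not)
open import Data.Bool.Properties using (∧-comm; ∨-assoc; ∨-comm; T-∧; T-∨; T?)
open import Data.Empty using (⊥; ⊥-elim)
open import Data.Fin.Base as Fin using (Fin; zero; suc; toℕ; fromℕ<; splitAt; cast; punchOut)
open import Data.Fin.Properties as Finₚ
  using (toℕ-injective; toℕ<n; toℕ-fromℕ<; toℕ-cast; any?; injective⇒≤; punchOut-injective)
  renaming (_≟_ to _≟ᶠ_; <-cmp to <ᶠ-cmp)
open import Data.List.Base as List
  using (List; []; _∷_; [_]; _++_; length; map; replicate; filter; tabulate; allFin; cartesianProduct)
open import Data.List.Membership.Propositional using (_∈_)
open import Data.List.Membership.Propositional.Properties
  using (∈-map⁺; ∈-map⁻; ∈-++⁺ˡ; ∈-++⁺ʳ; ∈-++⁻; ∈-filter⁺; ∈-filter⁻; ∈-allFin;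
         ∈-cartesianProduct⁺; ∈-cartesianProductWith⁺)
open import Data.List.Membership.Propositional.Properties.WithK using (unique∧set⇒bag)
open import Data.List.Properties
  using (++-assoc; ++-identityʳ; length-++; length-map; length-replicate; ∷-injectiveˡ; ∷-injectiveʳ)
open import Data.List.Relation.Binary.BagAndSetEquality using (∼bag⇒↭)
open import Data.List.Relation.Binary.Permutation.Propositional as ↭
  using (_↭_; refl; prep; swap; ↭-refl; ↭-sym; ↭-trans; ↭-reflexive)
open import Data.List.Relation.Binary.Permutation.Propositional.Properties
  using (++⁺; ++⁺ˡ; ++⁺ʳ; shift; ∷↭∷ʳ)
open import Data.List.Relation.Unary.All as All using (All; []; _∷_)
import Data.List.Relation.Unary.All.Properties as Allₚ
open import Data.List.Relation.Unary.AllPairs using ([]; _∷_)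
open import Data.List.Relation.Unary.Any using (here; there)
open import Data.List.Relation.Unary.Unique.Propositional using (Unique)
import Data.List.Relation.Unary.Unique.Propositional.Properties as Unique
open import Data.Nat.Base as ℕ
  using (zero; suc; _<ᵇ_; _≡ᵇ_; _≤_; _<_; z≤n; s≤s)
open import Data.Nat.Properties as ℕₚ
  using (suc-injective; <ᵇ⇒<; <⇒<ᵇ; ≡ᵇ⇒≡; ≡⇒≡ᵇ; <-cmp)
open import Data.Product using (∃!; ∃-syntax; _×_; _,_; proj₁; proj₂)
open import Data.Sum.Base as Sum using (_⊎_; inj₁; inj₂; [_,_]′)
open import Data.Unit.Base using (⊤; tt)
open import Data.Vec.Base as Vec using (Vec; []; _∷_; lookup; toList; head)
open import Data.Vec.Properties as Vecₚ
  using (∷-injective; lookup-map; lookup∘tabulate; tabulate∘lookup; tabulate-cong)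
open import Function.Base using (_∘_)
open import Function.Bundles using (mk⇔; _⇔_; Equivalence)
open import Function.Definitions using (Injective)
open import Relation.Binary.Definitions using (tri<; tri≈; tri>)
open import Relation.Binary.PropositionalEquality
  using (_≡_; _≢_; refl; sym; trans; cong; cong₂; subst; subst₂; module ≡-Reasoning)
open import Relation.Nullary.Decidable using (Dec; yes; no; does; does-⇔; ¬?; _×-dec_)
open import Relation.Nullary.Negation using (¬_)
open import Relation.Unary using (Pred; Decidable)

-- Finite lists and sums over them

-- A map that is injective on the members of a list keeps it free of repetitions.
Unique-map-on : ∀ {a b} {A : Set a} {B : Set b} (f : A → B) {xs} →
  (∀ {y z} → y ∈ xs → z ∈ xs → f y ≡ f z → y ≡ z) → Unique xs → Unique (map f xs)
Unique-map-on f {[]}     inj []       = []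
Unique-map-on f {x ∷ xs} inj (px ∷ u) =
  All.tabulate (λ {y} y∈ fx≡y → let z , z∈ , y≡ = ∈-map⁻ f y∈ in
    All.lookup px z∈ (inj (here refl) (there z∈) (trans fx≡y y≡)))
  ∷ Unique-map-on f (λ y∈ z∈ → inj (there y∈) (there z∈)) u

bijection⇒↭ : ∀ {a b} {A : Set a} {B : Set b} (f : A → B) {xs ys} →
  Unique xs → Unique ys →
  (∀ {y z} → y ∈ xs → z ∈ xs → f y ≡ f z → y ≡ z) →
  (∀ {y} → y ∈ xs → f y ∈ ys) →
  (∀ {z} → z ∈ ys → ∃[ y ] (y ∈ xs × f y ≡ z)) →
  map f xs ↭ ys
bijection⇒↭ f uxs uys inj to onto =
  ∼bag⇒↭ (unique∧set⇒bag (Unique-map-on f inj uxs) uys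
    (mk⇔ (λ z∈ → let y , y∈ , z≡ = ∈-map⁻ f z∈ in subst (_∈ _) (sym z≡) (to y∈))
         (λ z∈ → let y , y∈ , fy≡z = onto z∈ in subst (_∈ _) fy≡z (∈-map⁺ f y∈))))

module SumLemmas {c ℓ} (R : CommutativeSemiring c ℓ) where

  open CommutativeSemiring R hiding (zero) renaming (refl to ≈-refl; sym to ≈-sym; trans to ≈-trans)
  open Sums R
  open import Relation.Binary.Reasoning.Setoid setoid

  module _ {a} {A : Set a} where

    sum-cong : ∀ {xs} {f g : A → Carrier} → (∀ {y} → y ∈ xs → f y ≈ g y) →
      sumOver xs f ≈ sumOver xs g
    sum-cong {[]}     h = ≈-refl
    sum-cong {x ∷ xs} h = +-cong (h (here refl)) (sum-cong (h ∘ there))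

    sum-++ : ∀ xs ys (f : A → Carrier) → sumOver (xs ++ ys) f ≈ sumOver xs f + sumOver ys f
    sum-++ []       ys f = ≈-sym (+-identityˡ _)
    sum-++ (x ∷ xs) ys f = ≈-trans (+-congˡ (sum-++ xs ys f)) (≈-sym (+-assoc _ _ _))

    sum-* : ∀ c xs (f : A → Carrier) → sumOver xs (λ y → c * f y) ≈ c * sumOver xs f
    sum-* c []       f = ≈-sym (zeroʳ c)
    sum-* c (x ∷ xs) f = ≈-trans (+-congˡ (sum-* c xs f)) (≈-sym (distribˡ c _ _))

    sum-map : ∀ {b} {B : Set b} (h : B → A) xs (f : A → Carrier) →
      sumOver (map h xs) f ≈ sumOver xs (f ∘ h)
    sum-map h []       f = ≈-refl
    sum-map h (x ∷ xs) f = +-congˡ (sum-map h xs f)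

    sum-↭ : ∀ {xs ys} (f : A → Carrier) → xs ↭ ys → sumOver xs f ≈ sumOver ys f
    sum-↭ f refl = ≈-refl
    sum-↭ f (prep x p) = +-congˡ (sum-↭ f p)
    sum-↭ f (swap x y p) = ≈-trans (≈-sym (+-assoc _ _ _))
      (≈-trans (+-cong (+-comm _ _) (sum-↭ f p)) (+-assoc _ _ _))
    sum-↭ f (↭.trans p q) = ≈-trans (sum-↭ f p) (sum-↭ f q)

-- The state polynomial

-- The status of a label: obliged, free, or distinguished.  The distinguished
-- label never carries an obligation.
data Status : Set where
  obl fre dis : Status

-- The status of a label after it has been chosen.
use : Status → Status
use obl = fre
use fre = fre
use dis = dis

isObl : Status → Bool
isObl obl = true
isObl _   = false

hasObl : List Status → Bool
hasObl []      = false
hasObl (t ∷ τ) = isObl t ∨ hasObl τ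

hasObl-↭ : ∀ {σ τ} → σ ↭ τ → hasObl σ ≡ hasObl τ
hasObl-↭ refl = refl
hasObl-↭ (prep t p) = cong (isObl t ∨_) (hasObl-↭ p)
hasObl-↭ (swap {σ} {τ} t u p) rewrite hasObl-↭ p
  | sym (∨-assoc (isObl t) (isObl u) (hasObl τ)) | ∨-comm (isObl t) (isObl u)
  = ∨-assoc (isObl u) (isObl t) (hasObl τ)
hasObl-↭ (↭.trans p q) = trans (hasObl-↭ p) (hasObl-↭ q)

-- An insertion maps a row, split as the labels to the left of the chosen one,
-- the chosen one, and the labels to its right, to the row after a choice with a
-- bar.
Insertion : Set
Insertion = List Status → Status → List Status → List Status

-- Up to order, the chosen label is used and an obliged label is added.
Admissible : Insertion → Set
Admissible ins = ∀ α y β → ins α y β ↭ obl ∷ α ++ use y ∷ β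

module StatePolynomial {c ℓ} (R : CommutativeSemiring c ℓ)
  (s x w : CommutativeSemiring.Carrier R) where

  open CommutativeSemiring R hiding (zero) renaming (refl to ≈-refl; sym to ≈-sym; trans to ≈-trans)
  open import Algebra.Solver.Ring.NaturalCoefficients.Default R
    using (solve; _:=_; _:+_; _:*_)
  open import Relation.Binary.Reasoning.Setoid setoid

  -- The weight of choosing a label.
  wt : Status → Carrier
  wt dis = s
  wt _   = 1#

  -- The sum over all ways to choose a label of a row.
  pickSum : (List Status → Status → List Status → Carrier) → List Status → Carrier
  pickSum k []       = 0#
  pickSum k (y ∷ τ) = k [] y τ + pickSum (λ α → k (y ∷ α)) τ

  -- The choices summed over are exactly the splittings of the row.
  pickSum-cong-at : ∀ {k k′} τ → (∀ α y β → τ ≡ α ++ y ∷ β → k α y β ≈ k′ α y β) →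
    pickSum k τ ≈ pickSum k′ τ
  pickSum-cong-at []      h = ≈-refl
  pickSum-cong-at (y ∷ τ) h = +-cong (h [] y τ refl)
    (pickSum-cong-at τ (λ α z β eq → h (y ∷ α) z β (cong (y ∷_) eq)))

  pickSum-cong : ∀ {k k′} → (∀ α y β → k α y β ≈ k′ α y β) → ∀ τ → pickSum k τ ≈ pickSum k′ τ
  pickSum-cong h τ = pickSum-cong-at τ (λ α y β _ → h α y β)

  pickSum-* : ∀ c k τ → pickSum (λ α y β → c * k α y β) τ ≈ c * pickSum k τ
  pickSum-* c k []      = ≈-sym (zeroʳ c)
  pickSum-* c k (y ∷ τ) = ≈-trans (+-congˡ (pickSum-* c (λ α → k (y ∷ α)) τ)) (≈-sym (distribˡ c _ _))

  pickSum-++ : ∀ k σ τ → pickSum k (σ ++ τ) ≈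
    pickSum (λ α y β → k α y (β ++ τ)) σ + pickSum (λ α → k (σ ++ α)) τ
  pickSum-++ k []      τ = ≈-sym (+-identityˡ _)
  pickSum-++ k (y ∷ σ) τ = ≈-trans (+-congˡ (pickSum-++ (λ α → k (y ∷ α)) σ τ))
    (≈-sym (+-assoc _ _ _))

  -- Exchanging adjacent labels does not alter the sum of the two terms in which
  -- one of them is chosen.
  Exchange : (List Status → Status → List Status → Carrier) → Set ℓ
  Exchange k = ∀ α p q β →
    k α p (q ∷ β) + k (α ++ [ p ]) q β ≈ k α q (p ∷ β) + k (α ++ [ q ]) p β

  -- The order of the labels on either side of the chosen one is irrelevant.
  Symmetric₃ : (List Status → Status → List Status → Carrier) → Set ℓ
  Symmetric₃ k = ∀ {α α′ β β′} y → α ↭ α′ → β ↭ β′ → k α y β ≈ k α′ y β′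

  -- Symmetry away from the chosen label, together with the exchange identity,
  -- makes the sum over all choices symmetric.
  pickSum-↭ : ∀ {k} → Symmetric₃ k → Exchange k → ∀ {σ τ} → σ ↭ τ → pickSum k σ ≈ pickSum k τ
  pickSum-↭ k-sym k-ex refl = ≈-refl
  pickSum-↭ k-sym k-ex (prep y p) = +-cong (k-sym y ↭-refl p)
    (pickSum-↭ (λ z p q → k-sym z (prep y p) q) (λ α → k-ex (y ∷ α)) p)
  pickSum-↭ {k} k-sym k-ex (swap {σ} {τ} p q r) = begin
    k [] p (q ∷ σ) + (k [ p ] q σ + pickSum (λ α → k (p ∷ q ∷ α)) σ)
      ≈⟨ +-assoc _ _ _ ⟨
    k [] p (q ∷ σ) + k [ p ] q σ + pickSum (λ α → k (p ∷ q ∷ α)) σ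
      ≈⟨ +-cong (k-ex [] p q σ) (pickSum-cong (λ α y β → k-sym y (swap p q ↭-refl) ↭-refl) σ) ⟩
    k [] q (p ∷ σ) + k [ q ] p σ + pickSum (λ α → k (q ∷ p ∷ α)) σ
      ≈⟨ +-assoc _ _ _ ⟩
    k [] q (p ∷ σ) + (k [ q ] p σ + pickSum (λ α → k (q ∷ p ∷ α)) σ)
      ≈⟨ +-cong (k-sym q ↭-refl (prep p r)) (+-cong (k-sym p ↭-refl r)
           (pickSum-↭ (λ z p′ q′ → k-sym z (prep q (prep p p′)) q′) (λ α → k-ex (q ∷ p ∷ α)) r)) ⟩
    k [] q (p ∷ τ) + (k [ q ] p τ + pickSum (λ α → k (q ∷ p ∷ α)) τ) ∎
  pickSum-↭ k-sym k-ex (↭.trans p q) = ≈-trans (pickSum-↭ k-sym k-ex p) (pickSum-↭ k-sym k-ex q)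

  -- The weight of choosing y, without or with a bar, if G is the weight of the
  -- remaining steps.
  Kernel : Insertion → (List Status → List Status → Carrier) → List Status → Status → List Status → Carrier
  Kernel ins G α y β = wt y * (G α (use y ∷ β) + w * G [] (ins α y β))

  -- One step, for the row lo ++ hi.  The labels in lo are those to the left of the
  -- preceding choice; lo is empty if there is none to compare with.
  step : Insertion → (List Status → List Status → Carrier) → List Status → List Status → Carrier
  step ins G lo hi =
      x * pickSum (λ α y β → Kernel ins G α y (β ++ hi)) lo
    + pickSum (λ α → Kernel ins G (lo ++ α)) hi

  -- The total weight of all histories of N steps from the row lo ++ hi, where lo is as
  -- in step.
  F : Insertion → ℕ → List Status → List Status → Carrier
  F ins zero    lo hi = if hasObl (lo ++ hi) then 0# else 1#
  F ins (suc N) lo hi = step ins (F ins N) lo hi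

  -- The order of the labels on either side of the preceding choice is irrelevant.
  Symmetric₂ : (List Status → List Status → Carrier) → Set ℓ
  Symmetric₂ G = ∀ {lo lo′ hi hi′} → lo ↭ lo′ → hi ↭ hi′ → G lo hi ≈ G lo′ hi′

  module _ {ins : Insertion} (adm : Admissible ins) where

    ins-↭ : ∀ {α α′ β β′} y → α ↭ α′ → β ↭ β′ → ins α y β ↭ ins α′ y β′
    ins-↭ y p q = ↭-trans (adm _ _ _)
      (↭-trans (prep obl (++⁺ p (prep (use y) q))) (↭-sym (adm _ _ _)))

    Kernel-sym : ∀ {G} → Symmetric₂ G → Symmetric₃ (Kernel ins G)
    Kernel-sym G-sym y p q =
      *-congˡ (+-cong (G-sym p (prep (use y) q)) (*-congˡ (G-sym refl (ins-↭ y p q))))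

    step-sym : ∀ {G} → Symmetric₂ G → Exchange (Kernel ins G) → Symmetric₂ (step ins G)
    step-sym {G} G-sym ex {lo} {lo′} {hi} {hi′} p q = +-cong
      (*-congˡ (≈-trans
        (pickSum-cong (λ α y β → K-sym y ↭-refl (++⁺ˡ β q)) lo)
        (pickSum-↭ (λ y p q → K-sym y p (++⁺ʳ hi′ q)) (λ α p q β → ex α p q (β ++ hi′)) p)))
      (≈-trans
        (pickSum-cong (λ α y β → K-sym y (++⁺ʳ α p) ↭-refl) hi)
        (pickSum-↭ (λ y p q → K-sym y (++⁺ˡ lo′ p) q)
           (λ α p q β → subst₂ (λ σ τ → Kernel ins G (lo′ ++ α) p (q ∷ β) + Kernel ins G σ q β
                                     ≈ Kernel ins G (lo′ ++ α) q (p ∷ β) + Kernel ins G τ p β)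
              (++-assoc lo′ α [ p ]) (++-assoc lo′ α [ q ]) (ex (lo′ ++ α) p q β)) q))
      where K-sym = Kernel-sym {G} G-sym

    -- Choosing p and then q, and choosing q and then p, lead to the same row up to
    -- order.
    double-use : ∀ {G} → Symmetric₂ G → ∀ α p q β →
      wt p * Kernel ins G α q (use p ∷ β) ≈ wt q * Kernel ins G α p (use q ∷ β)
    double-use {G} G-sym α p q β = begin
      wt p * (wt q * X) ≈⟨ solve 3 (λ p q X → p :* (q :* X) := q :* (p :* X)) ≈-refl _ _ _ ⟩
      wt q * (wt p * X) ≈⟨ *-congˡ (*-congˡ (+-cong (G-sym ↭-refl (swap _ _ ↭-refl))
                             (*-congˡ (G-sym refl perm)))) ⟩
      wt q * (wt p * Y) ∎
      where
      X = G α (use q ∷ use p ∷ β) + w * G [] (ins α q (use p ∷ β))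
      Y = G α (use p ∷ use q ∷ β) + w * G [] (ins α p (use q ∷ β))
      perm : ins α q (use p ∷ β) ↭ ins α p (use q ∷ β)
      perm = ↭-trans (adm _ _ _) (↭-trans (prep obl (++⁺ˡ α (swap _ _ ↭-refl))) (↭-sym (adm _ _ _)))

    -- The two choices p and q singled out, where p is the preceding choice.
    step-split : ∀ G α p q β →
      step ins G α (p ∷ q ∷ β) ≈
        x * pickSum (λ γ y δ → Kernel ins G γ y (δ ++ p ∷ q ∷ β)) α
        + (Kernel ins G α p (q ∷ β) + Kernel ins G (α ++ [ p ]) q β
        + pickSum (λ γ → Kernel ins G (α ++ p ∷ q ∷ γ)) β)
    step-split G α p q β = +-congˡ (≈-trans
      (+-congʳ (reflexive (cong (λ σ → Kernel ins G σ p (q ∷ β)) (++-identityʳ α))))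
      (≈-sym (+-assoc _ _ _)))

    -- The same for the preceding choice q; now p lies to the left of it, whence the
    -- factor x.
    step-split′ : ∀ G α p q β →
      step ins G (α ++ [ p ]) (q ∷ β) ≈
        x * (pickSum (λ γ y δ → Kernel ins G γ y (δ ++ p ∷ q ∷ β)) α + Kernel ins G α p (q ∷ β))
        + (Kernel ins G (α ++ [ p ]) q β
        + pickSum (λ γ → Kernel ins G (α ++ p ∷ q ∷ γ)) β)
    step-split′ G α p q β = +-cong
      (*-congˡ (≈-trans (pickSum-++ _ α [ p ]) (+-cong
        (pickSum-cong (λ γ y δ → reflexive (cong (Kernel ins G γ y) (++-assoc δ [ p ] (q ∷ β)))) α)
        (≈-trans (+-identityʳ _)
          (reflexive (cong (λ σ → Kernel ins G σ p (q ∷ β)) (++-identityʳ α)))))))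
      (+-cong (reflexive (cong (λ σ → Kernel ins G σ q β) (++-identityʳ (α ++ [ p ]))))
        (pickSum-cong (λ γ y δ → reflexive (cong (λ σ → Kernel ins G σ y δ) (++-assoc α [ p ] (q ∷ γ)))) β))

    -- The terms with a bar match up by symmetry.  In the others, the next choice is
    -- singled out.  Exchange for G with p replaced by use p, and with q replaced by
    -- use q, turns the choices of p and q on one side into those on the other side;
    -- the coefficients x and 1 that remain are interchanged by double-use.
    step-exchange : ∀ {G} → Symmetric₂ G → Exchange (Kernel ins G) →
      Exchange (Kernel ins (step ins G))
    step-exchange {G} G-sym ex α p q β = begin
      wt p * (H α (use p ∷ q ∷ β) + w * H [] (ins α p (q ∷ β)))
        + wt q * (H (α ++ [ p ]) (use q ∷ β) + w * H [] (ins (α ++ [ p ]) q β))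
        ≈⟨ regroup _ _ _ _ _ _ ⟩
      wt p * H α (use p ∷ q ∷ β) + wt q * H (α ++ [ p ]) (use q ∷ β)
        + (wt p * (w * H [] (ins α p (q ∷ β))) + wt q * (w * H [] (ins (α ++ [ p ]) q β)))
        ≈⟨ +-cong main (≈-trans (+-comm _ _) (+-cong (*-congˡ (*-congˡ (H-sym refl perm₁)))
             (*-congˡ (*-congˡ (H-sym refl perm₂))))) ⟩
      wt q * H α (use q ∷ p ∷ β) + wt p * H (α ++ [ q ]) (use p ∷ β)
        + (wt q * (w * H [] (ins α q (p ∷ β))) + wt p * (w * H [] (ins (α ++ [ q ]) p β)))
        ≈⟨ regroup _ _ _ _ _ _ ⟨
      wt q * (H α (use q ∷ p ∷ β) + w * H [] (ins α q (p ∷ β)))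
        + wt p * (H (α ++ [ q ]) (use p ∷ β) + w * H [] (ins (α ++ [ q ]) p β)) ∎
      where
      H = step ins G
      K = Kernel ins G
      K-sym = Kernel-sym {G} G-sym
      H-sym = step-sym {G} G-sym ex
      regroup : ∀ P Q a b c d → P * (a + b) + Q * (c + d) ≈ P * a + Q * c + (P * b + Q * d)
      regroup = solve 6 (λ P Q a b c d → P :* (a :+ b) :+ Q :* (c :+ d)
        := P :* a :+ Q :* c :+ (P :* b :+ Q :* d)) ≈-refl
      perm₁ : ins (α ++ [ p ]) q β ↭ ins α q (p ∷ β)
      perm₁ = ↭-trans (adm _ _ _) (↭-trans (prep obl
        (↭-trans (↭-reflexive (++-assoc α [ p ] (use q ∷ β))) (++⁺ˡ α (swap _ _ ↭-refl))))
        (↭-sym (adm _ _ _)))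
      perm₂ : ins α p (q ∷ β) ↭ ins (α ++ [ q ]) p β
      perm₂ = ↭-trans (adm _ _ _) (↭-trans (prep obl
        (↭-trans (++⁺ˡ α (swap _ _ ↭-refl)) (↭-reflexive (sym (++-assoc α [ q ] (use p ∷ β))))))
        (↭-sym (adm _ _ _)))
      L : Status → Status → Carrier
      L t u = pickSum (λ γ y δ → K γ y (δ ++ t ∷ u ∷ β)) α
      B : Status → Status → Carrier
      B t u = pickSum (λ γ → K (α ++ t ∷ u ∷ γ)) β
      L-swap : ∀ t u → L t u ≈ L u t
      L-swap t u = pickSum-cong (λ γ y δ → K-sym y ↭-refl (++⁺ˡ δ (swap t u ↭-refl))) α
      B-swap : ∀ t u → B t u ≈ B u t
      B-swap t u = pickSum-cong (λ γ y δ → K-sym y (++⁺ˡ α (swap t u ↭-refl)) ↭-refl) β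
      P Q c₁ c₂ c₃ c₄ d₁ d₂ d₃ d₄ : Carrier
      P = wt p
      Q = wt q
      c₁ = K α (use p) (q ∷ β)
      c₂ = K (α ++ [ use p ]) q β
      c₃ = K α p (use q ∷ β)
      c₄ = K (α ++ [ p ]) (use q) β
      d₁ = K α (use q) (p ∷ β)
      d₂ = K (α ++ [ use q ]) p β
      d₃ = K α q (use p ∷ β)
      d₄ = K (α ++ [ q ]) (use p) β
      main : P * H α (use p ∷ q ∷ β) + Q * H (α ++ [ p ]) (use q ∷ β)
           ≈ Q * H α (use q ∷ p ∷ β) + P * H (α ++ [ q ]) (use p ∷ β)
      main = begin
        P * H α (use p ∷ q ∷ β) + Q * H (α ++ [ p ]) (use q ∷ β)
          ≈⟨ +-cong (*-congˡ (step-split G α (use p) q β))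
                    (*-congˡ (step-split′ G α p (use q) β)) ⟩
        P * (x * L₁ + (c₁ + c₂ + B₁)) + Q * (x * (L₂ + c₃) + (c₄ + B₂))
          ≈⟨ +-congʳ (*-congˡ (+-congˡ (+-congʳ (ex α (use p) q β)))) ⟩
        P * (x * L₁ + (d₃ + d₄ + B₁)) + Q * (x * (L₂ + c₃) + (c₄ + B₂))
          ≈⟨ solve 11 (λ P Q x L₁ L₂ B₁ B₂ d₃ d₄ c₃ c₄ →
               P :* (x :* L₁ :+ (d₃ :+ d₄ :+ B₁)) :+ Q :* (x :* (L₂ :+ c₃) :+ (c₄ :+ B₂))
               := (P :* d₃ :+ x :* (Q :* c₃)) :+
                  (P :* (x :* L₁ :+ (d₄ :+ B₁)) :+ Q :* (x :* L₂ :+ (c₄ :+ B₂))))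
               ≈-refl P Q x L₁ L₂ B₁ B₂ d₃ d₄ c₃ c₄ ⟩
        (P * d₃ + x * (Q * c₃)) + (P * (x * L₁ + (d₄ + B₁)) + Q * (x * L₂ + (c₄ + B₂)))
          ≈⟨ +-congʳ (+-cong du (*-congˡ (≈-sym du))) ⟩
        (Q * c₃ + x * (P * d₃)) + (P * (x * L₁ + (d₄ + B₁)) + Q * (x * L₂ + (c₄ + B₂)))
          ≈⟨ solve 11 (λ P Q x L₁ L₂ B₁ B₂ d₃ d₄ c₃ c₄ →
               Q :* (x :* L₂ :+ (c₃ :+ c₄ :+ B₂)) :+ P :* (x :* (L₁ :+ d₃) :+ (d₄ :+ B₁))
               := (Q :* c₃ :+ x :* (P :* d₃)) :+
                  (P :* (x :* L₁ :+ (d₄ :+ B₁)) :+ Q :* (x :* L₂ :+ (c₄ :+ B₂))))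
               ≈-refl P Q x L₁ L₂ B₁ B₂ d₃ d₄ c₃ c₄ ⟨
        Q * (x * L₂ + (c₃ + c₄ + B₂)) + P * (x * (L₁ + d₃) + (d₄ + B₁))
          ≈⟨ +-congʳ (*-congˡ (+-congˡ (+-congʳ (ex α p (use q) β)))) ⟩
        Q * (x * L₂ + (d₁ + d₂ + B₂)) + P * (x * (L₁ + d₃) + (d₄ + B₁))
          ≈⟨ +-cong (*-congˡ (+-cong (*-congˡ (L-swap p (use q))) (+-congˡ (B-swap p (use q)))))
                    (*-congˡ (+-cong (*-congˡ (+-congʳ (L-swap (use p) q)))
                                     (+-congˡ (B-swap (use p) q)))) ⟩
        Q * (x * L (use q) p + (d₁ + d₂ + B (use q) p))
          + P * (x * (L q (use p) + d₃) + (d₄ + B q (use p)))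
          ≈⟨ +-cong (*-congˡ (step-split G α (use q) p β))
                    (*-congˡ (step-split′ G α q (use p) β)) ⟨
        Q * H α (use q ∷ p ∷ β) + P * H (α ++ [ q ]) (use p ∷ β) ∎
        where
        L₁ = L (use p) q
        L₂ = L p (use q)
        B₁ = B (use p) q
        B₂ = B p (use q)
        du : P * d₃ ≈ Q * c₃
        du = double-use G-sym α p q β

    F-zero-sym : Symmetric₂ (F ins zero)
    F-zero-sym p q =
      reflexive (cong (λ b → if b then 0# else 1#) (hasObl-↭ (++⁺ p q)))

    F-zero-obl : ∀ {τ σ} → τ ↭ obl ∷ σ → F ins zero [] τ ≈ 0#
    F-zero-obl p = reflexive (cong (λ b → if b then 0# else 1#) (hasObl-↭ p))

    -- After a bar in the last step an obligation is left, so these terms vanish.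
    F-zero-exchange : Exchange (Kernel ins (F ins zero))
    F-zero-exchange α p q β = ≈-trans (+-comm _ _) (+-cong
      (*-congˡ (+-cong (fin (↭-trans (↭-reflexive (++-assoc α [ p ] _)) (++⁺ˡ α (swap _ _ ↭-refl))))
        (*-congˡ (≈-trans (F-zero-obl (adm _ _ _)) (≈-sym (F-zero-obl (adm _ _ _)))))))
      (*-congˡ (+-cong (fin (↭-trans (++⁺ˡ α (swap _ _ ↭-refl)) (↭-reflexive (sym (++-assoc α [ q ] _)))))
        (*-congˡ (≈-trans (F-zero-obl (adm _ _ _)) (≈-sym (F-zero-obl (adm _ _ _))))))))
      where
      fin : ∀ {σ τ} → σ ↭ τ → (if hasObl σ then 0# else 1#) ≈ (if hasObl τ then 0# else 1#)
      fin p = reflexive (cong (λ b → if b then 0# else 1#) (hasObl-↭ p))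

    F-sym×exchange : ∀ N → Symmetric₂ (F ins N) × Exchange (Kernel ins (F ins N))
    F-sym×exchange zero    = F-zero-sym , F-zero-exchange
    F-sym×exchange (suc N) with F-sym×exchange N
    ... | sym , ex = step-sym sym ex , step-exchange sym ex

    F-sym : ∀ N → Symmetric₂ (F ins N)
    F-sym N = proj₁ (F-sym×exchange N)

  -- The place of the label added by a bar does not matter.
  F-insertion : ∀ {ins ins′} → Admissible ins → Admissible ins′ →
    ∀ N lo hi → F ins N lo hi ≈ F ins′ N lo hi
  F-insertion adm adm′ zero    lo hi = ≈-refl
  F-insertion {ins} {ins′} adm adm′ (suc N) lo hi = +-cong
    (*-congˡ (pickSum-cong (λ α y β → kernel α y (β ++ hi)) lo))
    (pickSum-cong (λ α → kernel (lo ++ α)) hi)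
    where
    kernel : ∀ α y β → Kernel ins (F ins N) α y β ≈ Kernel ins′ (F ins′ N) α y β
    kernel α y β = *-congˡ (+-cong (F-insertion adm adm′ N _ _) (*-congˡ (≈-trans
      (F-insertion adm adm′ N _ _)
      (F-sym adm′ N refl (↭-trans (adm α y β) (↭-sym (adm′ α y β)))))))

-- Concatenation over the choices of a label

-- The lists of all choices of a label of a row, concatenated.
pickConcat : ∀ {a} {A : Set a} → (List Status → Status → List Status → List A) → List Status → List A
pickConcat k []      = []
pickConcat k (y ∷ τ) = k [] y τ ++ pickConcat (λ α → k (y ∷ α)) τ

module _ {c ℓ} (R : CommutativeSemiring c ℓ) (s x w : CommutativeSemiring.Carrier R) where
  open CommutativeSemiring R hiding (zero) renaming (refl to ≈-refl; sym to ≈-sym; trans to ≈-trans)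
  open Sums R
  open SumLemmas R
  open StatePolynomial R s x w

  sum-pickConcat : ∀ {a} {A : Set a} k τ (f : A → Carrier) →
    sumOver (pickConcat k τ) f ≈ pickSum (λ α y β → sumOver (k α y β) f) τ
  sum-pickConcat k []      f = ≈-refl
  sum-pickConcat k (y ∷ τ) f = ≈-trans (sum-++ (k [] y τ) _ f) (+-congˡ (sum-pickConcat (λ α → k (y ∷ α)) τ f))

-- Statistics of words with separators

-- The indicator of a truth value.
ind : Bool → ℕ
ind b = if b then 1 else 0

-- In a word, positive numbers are the values yet to be placed, renumbered from 1,
-- and zeros are separators, which stand for values placed already.  The gaps
-- between separators are the labels.  Words are scanned from left to right; the prefix
-- read so far is kept in reverse order.  The next two functions compare its last
-- letter with y; an empty prefix counts as a separator.
lastBelow : List ℕ → ℕ → Bool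
lastBelow []      y = true
lastBelow (z ∷ _) y = z <ᵇ y

lastAbove : List ℕ → ℕ → Bool
lastAbove []      y = false
lastAbove (z ∷ _) y = y <ᵇ z

mem : ℕ → List ℕ → Bool
mem y []      = false
mem y (z ∷ u) = (y ≡ᵇ z) ∨ mem y u

allAbove : ℕ → List ℕ → Bool
allAbove y []      = true
allAbove y (z ∷ u) = (y <ᵇ z) ∧ allAbove y u

-- Descents whose bottom is not a separator.
desW : List ℕ → List ℕ → ℕ
desW p []          = 0
desW p (zero ∷ u)  = desW (zero ∷ p) u
desW p (suc y ∷ u) = ind (lastAbove p (suc y)) ℕ.+ desW (suc y ∷ p) u

-- Positive letters y that are no descent bottom and have y + 1 to their left.
sillyW : List ℕ → List ℕ → ℕ
sillyW p []          = 0
sillyW p (zero ∷ u)  = sillyW (zero ∷ p) u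
sillyW p (suc y ∷ u) = ind (lastBelow p (suc y) ∧ mem (suc (suc y)) p) ℕ.+ sillyW (suc y ∷ p) u

-- Positive letters with only greater letters to their right.
rminW : List ℕ → ℕ
rminW []          = 0
rminW (zero ∷ u)  = rminW u
rminW (suc y ∷ u) = ind (allAbove (suc y) u) ℕ.+ rminW u

-- Makes room for a new letter 1.
lift : ℕ → ℕ
lift zero    = zero
lift (suc y) = suc (suc y)

raise : List ℕ → List ℕ
raise = map lift

-- Undoes a step without a bar that chose label c: the value placed by it is put
-- back, as a new least value, at the start of gap c.
placeFirst : ℕ → List ℕ → List ℕ
placeFirst zero    u           = 1 ∷ raise u
placeFirst (suc c) []          = []
placeFirst (suc c) (zero ∷ u)  = zero ∷ placeFirst c u
placeFirst (suc c) (suc y ∷ u) = suc (suc y) ∷ placeFirst (suc c) u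

-- Undoes a step with a bar that chose label c: the value placed by it is put
-- back, as a new least value, in place of the separator after gap c.
placeOnBar : ℕ → List ℕ → List ℕ
placeOnBar c       []          = []
placeOnBar zero    (zero ∷ u)  = 1 ∷ raise u
placeOnBar (suc c) (zero ∷ u)  = zero ∷ placeOnBar c u
placeOnBar c       (suc y ∷ u) = suc (suc y) ∷ placeOnBar c u

zeros : List ℕ → ℕ
zeros []          = 0
zeros (zero ∷ u)  = suc (zeros u)
zeros (suc _ ∷ u) = zeros u

-- Whether the letter 1 occurs in one of the first c gaps.
left1 : ℕ → List ℕ → Bool
left1 zero    u           = false
left1 (suc c) []          = false
left1 (suc c) (zero ∷ u)  = left1 c u
left1 (suc c) (suc y ∷ u) = (0 ≡ᵇ y) ∨ left1 (suc c) u

-- The prefix p′ looks to the letters greater than 1 the way p looks to these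
-- letters lowered by 1.
record Raised (p p′ : List ℕ) : Set where
  constructor raised
  field
    below : ∀ y → lastBelow p′ (suc (suc y)) ≡ lastBelow p (suc y)
    above : ∀ y → lastAbove p′ (suc (suc y)) ≡ lastAbove p (suc y)
    mems  : ∀ y → mem (suc (suc y)) p′ ≡ mem (suc y) p
open Raised

Raised-[] : Raised [] []
Raised-[] = raised (λ _ → refl) (λ _ → refl) (λ _ → refl)

Raised-∷ : ∀ {p p′} z → Raised p p′ → Raised (z ∷ p) (lift z ∷ p′)
Raised-∷ zero    r = raised (λ _ → refl) (λ _ → refl) (λ y → mems r y)
Raised-∷ (suc z) r = raised (λ _ → refl) (λ _ → refl) (λ y → cong ((y ≡ᵇ z) ∨_) (mems r y))

desW-raise : ∀ {p p′} → Raised p p′ → ∀ u → desW p′ (raise u) ≡ desW p u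
desW-raise r []          = refl
desW-raise r (zero ∷ u)  = desW-raise (Raised-∷ zero r) u
desW-raise r (suc y ∷ u) = cong₂ (λ b m → ind b ℕ.+ m) (above r y) (desW-raise (Raised-∷ (suc y) r) u)

sillyW-raise : ∀ {p p′} → Raised p p′ → ∀ u → sillyW p′ (raise u) ≡ sillyW p u
sillyW-raise r []          = refl
sillyW-raise r (zero ∷ u)  = sillyW-raise (Raised-∷ zero r) u
sillyW-raise r (suc y ∷ u) = cong₂ (λ b m → ind b ℕ.+ m)
  (cong₂ _∧_ (below r y) (mems r (suc y))) (sillyW-raise (Raised-∷ (suc y) r) u)

allAbove-raise : ∀ y u → allAbove (suc (suc y)) (raise u) ≡ allAbove (suc y) u
allAbove-raise y []          = refl
allAbove-raise y (zero ∷ u)  = refl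
allAbove-raise y (suc z ∷ u) = cong ((y <ᵇ z) ∧_) (allAbove-raise y u)

rminW-raise : ∀ u → rminW (raise u) ≡ rminW u
rminW-raise []          = refl
rminW-raise (zero ∷ u)  = rminW-raise u
rminW-raise (suc y ∷ u) = cong₂ (λ b m → ind b ℕ.+ m) (allAbove-raise y u) (rminW-raise u)

∧-falseʳ : ∀ b → b ∧ false ≡ false
∧-falseʳ b = ∧-comm b false

+-swap : ∀ a b c → a ℕ.+ (b ℕ.+ c) ≡ b ℕ.+ (a ℕ.+ c)
+-swap a b c = trans (sym (ℕₚ.+-assoc a b c)) (trans (cong (ℕ._+ c) (ℕₚ.+-comm a b)) (ℕₚ.+-assoc b a c))

-- A letter with a separator to its right is no right-to-left minimum.
allAbove-zero : ∀ y u {c} → suc c ≤ zeros u → allAbove (suc y) u ≡ false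
allAbove-zero y (zero ∷ u)  le = refl
allAbove-zero y (suc z ∷ u) le = trans (cong ((y <ᵇ z) ∧_) (allAbove-zero y u le)) (∧-falseʳ _)

allAbove-placeFirst : ∀ y u {c} → c ≤ zeros u → allAbove (suc (suc y)) (placeFirst c u) ≡ false
allAbove-placeFirst y u           {zero}  le = refl
allAbove-placeFirst y (zero ∷ u)  {suc c} le = refl
allAbove-placeFirst y (suc z ∷ u) {suc c} le =
  trans (cong ((y <ᵇ z) ∧_) (allAbove-placeFirst y u le)) (∧-falseʳ _)

allAbove-placeOnBar : ∀ y u {c} → suc c ≤ zeros u → allAbove (suc (suc y)) (placeOnBar c u) ≡ false
allAbove-placeOnBar y (zero ∷ u)  {zero}  le = refl
allAbove-placeOnBar y (zero ∷ u)  {suc c} le = refl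
allAbove-placeOnBar y (suc z ∷ u) {zero} le =
  trans (cong ((y <ᵇ z) ∧_) (allAbove-placeOnBar y u le)) (∧-falseʳ _)
allAbove-placeOnBar y (suc z ∷ u) {suc c} le =
  trans (cong ((y <ᵇ z) ∧_) (allAbove-placeOnBar y u le)) (∧-falseʳ _)

allAbove-1-raise : ∀ u → allAbove 1 (raise u) ≡ (zeros u ≡ᵇ 0)
allAbove-1-raise []          = refl
allAbove-1-raise (zero ∷ u)  = refl
allAbove-1-raise (suc y ∷ u) = allAbove-1-raise u

-- The new letter is a right-to-left minimum if and only if it is placed in the
-- last gap.
rminW-placeFirst : ∀ c u → c ≤ zeros u → rminW (placeFirst c u) ≡ ind (zeros u ≡ᵇ c) ℕ.+ rminW u
rminW-placeFirst zero    u           le = cong₂ (λ b m → ind b ℕ.+ m) (allAbove-1-raise u) (rminW-raise u)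
rminW-placeFirst (suc c) (zero ∷ u)  (s≤s le) = rminW-placeFirst c u le
rminW-placeFirst (suc c) (suc y ∷ u) le
  rewrite allAbove-placeFirst y u {suc c} le | allAbove-zero y u le = rminW-placeFirst (suc c) u le

rminW-placeOnBar : ∀ c u → suc c ≤ zeros u → rminW (placeOnBar c u) ≡ ind (zeros u ≡ᵇ suc c) ℕ.+ rminW u
rminW-placeOnBar zero    (zero ∷ u)  le = cong₂ (λ b m → ind b ℕ.+ m) (allAbove-1-raise u) (rminW-raise u)
rminW-placeOnBar (suc c) (zero ∷ u)  (s≤s le) = rminW-placeOnBar c u le
rminW-placeOnBar zero (suc y ∷ u) le
  rewrite allAbove-placeOnBar y u {zero} le | allAbove-zero y u le = rminW-placeOnBar zero u le
rminW-placeOnBar (suc c) (suc y ∷ u) le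
  rewrite allAbove-placeOnBar y u {suc c} le | allAbove-zero y u le = rminW-placeOnBar (suc c) u le

left1-placeFirst : ∀ l c u → c ≤ zeros u → left1 l (placeFirst c u) ≡ (c <ᵇ l)
left1-placeFirst zero    zero    u           le = refl
left1-placeFirst (suc l) zero    u           le = refl
left1-placeFirst zero    (suc c) u           le = refl
left1-placeFirst (suc l) (suc c) (zero ∷ u)  (s≤s le) = left1-placeFirst l c u le
left1-placeFirst (suc l) (suc c) (suc y ∷ u) le = left1-placeFirst (suc l) (suc c) u le

left1-placeOnBar : ∀ l c u → suc c ≤ zeros u → left1 l (placeOnBar c u) ≡ (c <ᵇ l)
left1-placeOnBar zero    zero    u           le = refl
left1-placeOnBar zero    (suc c) u           le = refl
left1-placeOnBar (suc l) zero    (zero ∷ u)  le = refl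
left1-placeOnBar (suc l) zero    (suc y ∷ u) le = left1-placeOnBar (suc l) zero u le
left1-placeOnBar (suc l) (suc c) (zero ∷ u)  (s≤s le) = left1-placeOnBar l c u le
left1-placeOnBar (suc l) (suc c) (suc y ∷ u) le = left1-placeOnBar (suc l) (suc c) u le

-- The prefixes after which a gap begins.
data Start : List ℕ → Set where
  empty     : Start []
  separator : ∀ {p} → Start (zero ∷ p)

-- If gap c is the current one then it begins here.
StartAt : ℕ → List ℕ → Set
StartAt zero    p = Start p
StartAt (suc _) p = ⊤

StartAt-zero : ∀ c p → StartAt c (zero ∷ p)
StartAt-zero zero    p = separator
StartAt-zero (suc c) p = tt

Start-below : ∀ {p} → Start p → ∀ y → lastBelow p (suc y) ≡ true
Start-below empty     y = refl
Start-below separator y = refl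

Start-above : ∀ {p} → Start p → ∀ y → lastAbove p (suc y) ≡ false
Start-above empty     y = refl
Start-above separator y = refl

-- At the start of a gap, the letters to come do not see the letter 1 that has
-- just been placed.
Raised-start : ∀ {p p′} → Start p → Raised p p′ → Raised p (1 ∷ p′)
Raised-start st r = raised (λ y → sym (Start-below st y)) (λ y → sym (Start-above st y)) (mems r)

Raised-bar : ∀ {p p′} → Raised p p′ → Raised (zero ∷ p) (1 ∷ p′)
Raised-bar r = raised (λ y → refl) (λ y → refl) (mems r)

desW-placeFirst : ∀ {p p′} → Raised p p′ → ∀ c u → StartAt c p → StartAt c p′ →
  desW p′ (placeFirst c u) ≡ desW p u
desW-placeFirst r zero    u           st st′ =
  cong₂ (λ b m → ind b ℕ.+ m) (Start-above st′ 0) (desW-raise (Raised-start st r) u)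
desW-placeFirst r (suc c) []          st st′ = refl
desW-placeFirst r (suc c) (zero ∷ u)  st st′ =
  desW-placeFirst (Raised-∷ zero r) c u (StartAt-zero c _) (StartAt-zero c _)
desW-placeFirst r (suc c) (suc y ∷ u) st st′ =
  cong₂ (λ b m → ind b ℕ.+ m) (above r y) (desW-placeFirst (Raised-∷ (suc y) r) (suc c) u tt tt)

∨-swap-mem : ∀ y p {b} → ((0 ≡ᵇ y) ∨ mem 1 p) ∨ b ≡ mem 1 p ∨ ((0 ≡ᵇ y) ∨ b)
∨-swap-mem y p {b} with 0 ≡ᵇ y | mem 1 p
... | true  | true  = refl
... | true  | false = refl
... | false | _     = refl

-- The new letter 1 is counted if and only if the former letter 1, which is now
-- 2, lies to its left.
sillyW-placeFirst : ∀ {p p′} → Raised p p′ → ∀ c u → c ≤ zeros u → StartAt c p → StartAt c p′ →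
  sillyW p′ (placeFirst c u) ≡ ind (mem 1 p ∨ left1 c u) ℕ.+ sillyW p u
sillyW-placeFirst {p} {p′} r zero u le st st′ = cong₂ (λ b m → ind b ℕ.+ m) eq (sillyW-raise (Raised-start st r) u)
  where
  eq : lastBelow p′ 1 ∧ mem 2 p′ ≡ mem 1 p ∨ false
  eq rewrite Start-below st′ 0 | mems r 0 with mem 1 p
  ... | true  = refl
  ... | false = refl
sillyW-placeFirst r (suc c) (zero ∷ u) (s≤s le) st st′ =
  sillyW-placeFirst (Raised-∷ zero r) c u le (StartAt-zero c _) (StartAt-zero c _)
sillyW-placeFirst {p} {p′} r (suc c) (suc y ∷ u) le st st′ = begin
  ind (lastBelow p′ (2 ℕ.+ y) ∧ mem (3 ℕ.+ y) p′) ℕ.+ sillyW (2 ℕ.+ y ∷ p′) (placeFirst (suc c) u)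
    ≡⟨ cong₂ (λ b m → ind b ℕ.+ m) (cong₂ _∧_ (below r y) (mems r (suc y)))
         (sillyW-placeFirst (Raised-∷ (suc y) r) (suc c) u le tt tt) ⟩
  a ℕ.+ (ind (((0 ≡ᵇ y) ∨ mem 1 p) ∨ left1 (suc c) u) ℕ.+ m)
    ≡⟨ cong (λ b → a ℕ.+ (ind b ℕ.+ m)) (∨-swap-mem y p) ⟩
  a ℕ.+ (ind (mem 1 p ∨ ((0 ≡ᵇ y) ∨ left1 (suc c) u)) ℕ.+ m)
    ≡⟨ +-swap a (ind (mem 1 p ∨ ((0 ≡ᵇ y) ∨ left1 (suc c) u))) m ⟩
  ind (mem 1 p ∨ ((0 ≡ᵇ y) ∨ left1 (suc c) u)) ℕ.+ (a ℕ.+ m) ∎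
  where
  open ≡-Reasoning
  a m : ℕ
  a = ind (lastBelow p (suc y) ∧ mem (2 ℕ.+ y) p)
  m = sillyW (suc y ∷ p) u

-- The gaps of the word are the labels of the row, and the gaps of obliged labels
-- are not empty.
Fits : List Status → List ℕ → Set
Fits []          _           = ⊥
Fits (t ∷ τ)     (zero ∷ u)  = isObl t ≡ false × Fits τ u
Fits (t ∷ τ)     (suc _ ∷ u) = Fits (use t ∷ τ) u
Fits (t ∷ [])    []          = isObl t ≡ false
Fits (t ∷ _ ∷ _) []          = ⊥

Fits-zeros : ∀ τ u → Fits τ u → suc (zeros u) ≡ length τ
Fits-zeros (t ∷ [])    []          f = refl
Fits-zeros (t ∷ τ)     (zero ∷ u)  (_ , f) = cong suc (Fits-zeros τ u f)
Fits-zeros (t ∷ τ)     (suc _ ∷ u) f = Fits-zeros (use t ∷ τ) u f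

-- A value placed on the separator after a nonempty gap is a descent bottom.  The
-- gap in question is obliged, or it is the current one and the letter just read
-- shows that it is not empty.
placeOnBar-stats : ∀ {p p′} → Raised p p′ → ∀ α t t′ β u → Fits (α ++ t ∷ t′ ∷ β) u →
  t ≡ obl ⊎ (α ≡ [] × ∃[ z ] ∃[ q ] p′ ≡ suc (suc z) ∷ q) →
  desW p′ (placeOnBar (length α) u) ≡ suc (desW p u) × sillyW p′ (placeOnBar (length α) u) ≡ sillyW p u
placeOnBar-stats r [] .obl t′ β (zero ∷ u) (() , f) (inj₁ refl)
placeOnBar-stats r [] t t′ β (zero ∷ u) (_ , f) (inj₂ (_ , z , q , refl)) =
  cong suc (desW-raise (Raised-bar r) u) , sillyW-raise (Raised-bar r) u
placeOnBar-stats r [] t t′ β (suc y ∷ u) f _ =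
  let d , s = placeOnBar-stats (Raised-∷ (suc y) r) [] (use t) t′ β u f (inj₂ (refl , y , _ , refl))
  in trans (cong₂ (λ b m → ind b ℕ.+ m) (above r y) d) (ℕₚ.+-suc _ _)
   , cong₂ (λ b m → ind b ℕ.+ m) (cong₂ _∧_ (below r y) (mems r (suc y))) s
placeOnBar-stats r (a ∷ α) t t′ β (zero ∷ u) (_ , f) (inj₁ refl) =
  placeOnBar-stats (Raised-∷ zero r) α obl t′ β u f (inj₁ refl)
placeOnBar-stats r (a ∷ α) t t′ β (suc y ∷ u) f (inj₁ refl) =
  let d , s = placeOnBar-stats (Raised-∷ (suc y) r) (use a ∷ α) obl t′ β u f (inj₁ refl)
  in trans (cong₂ (λ b m → ind b ℕ.+ m) (above r y) d) (ℕₚ.+-suc _ _)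
   , cong₂ (λ b m → ind b ℕ.+ m) (cong₂ _∧_ (below r y) (mems r (suc y))) s
placeOnBar-stats r []          t t′ β [] () _
placeOnBar-stats r (a ∷ [])    t t′ β [] () _
placeOnBar-stats r (a ∷ _ ∷ α) t t′ β [] () _

-- Words that fit a row of labels

module _ {a} {A : Set a} where

  ∈-pickConcat⁻ : ∀ {z : A} k τ → z ∈ pickConcat k τ →
    ∃[ α ] ∃[ y ] ∃[ β ] (τ ≡ α ++ y ∷ β × z ∈ k α y β)
  ∈-pickConcat⁻ k (y ∷ τ) z∈ with ∈-++⁻ (k [] y τ) z∈
  ... | inj₁ here∈ = [] , y , τ , refl , here∈
  ... | inj₂ there∈ with α , t , β , eq , z∈ ← ∈-pickConcat⁻ (λ α → k (y ∷ α)) τ there∈ =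
    y ∷ α , t , β , cong (y ∷_) eq , z∈

  ∈-pickConcat⁺ : ∀ {z : A} k α {y β} → z ∈ k α y β → z ∈ pickConcat k (α ++ y ∷ β)
  ∈-pickConcat⁺ k []      z∈ = ∈-++⁺ˡ z∈
  ∈-pickConcat⁺ k (t ∷ α) z∈ = ∈-++⁺ʳ (k [] t _) (∈-pickConcat⁺ (λ α → k (t ∷ α)) α z∈)

  -- The lists for different choices are disjoint if a key tells the position of the
  -- chosen label.
  Unique-pickConcat : (key : A → ℕ) → ∀ k τ →
    (∀ α y β → τ ≡ α ++ y ∷ β → Unique (k α y β)) →
    ∀ m → (∀ {z} α y β → τ ≡ α ++ y ∷ β → z ∈ k α y β → key z ≡ m ℕ.+ length α) →
    Unique (pickConcat k τ)
  Unique-pickConcat key k []      uniq m keyed = []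
  Unique-pickConcat key k (y ∷ τ) uniq m keyed = Unique.++⁺ (uniq [] y τ refl)
    (Unique-pickConcat key (λ α → k (y ∷ α)) τ (λ α t β → uniq (y ∷ α) t β ∘ cong (y ∷_)) (suc m)
      (λ α t β eq z∈ → trans (keyed (y ∷ α) t β (cong (y ∷_) eq) z∈) (ℕₚ.+-suc m (length α))))
    λ (z∈ , z∈′) → let α , t , β , eq , z∈″ = ∈-pickConcat⁻ _ τ z∈′ in
      ℕₚ.0≢1+n (ℕₚ.+-cancelˡ-≡ m 0 (suc (length α))
        (trans (sym (keyed [] y τ refl z∈)) (keyed (y ∷ α) t β (cong (y ∷_) eq) z∈″)))

-- For permutations: the chosen run is obliged, and the new run to its right takes
-- over its former role.
besideBar : Insertion
besideBar α y β = α ++ obl ∷ use y ∷ β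

besideBar-admissible : Admissible besideBar
besideBar-admissible α y β = shift obl α (use y ∷ β)

-- The words with no value left to place.
base : List Status → List (List ℕ)
base []      = []
base (t ∷ τ) = if hasObl (t ∷ τ) then [] else replicate (length τ) 0 ∷ []

-- The words with N values to place that fit the row τ, built by undoing steps.
gapWords : ℕ → List Status → List (List ℕ)
-- The words whose next step chooses y, without or with a bar.
placements : ℕ → List Status → Status → List Status → List (List ℕ)

gapWords zero    τ = base τ
gapWords (suc N) τ = pickConcat (placements N) τ

placements N α y β = map (placeFirst (length α)) (gapWords N (α ++ use y ∷ β))
             ++ map (placeOnBar (length α)) (gapWords N (besideBar α y β))

use-idem : ∀ t → use (use t) ≡ use t
use-idem obl = refl
use-idem fre = refl
use-idem dis = refl

Fits-raise : ∀ τ u → Fits τ u → Fits τ (raise u)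
Fits-raise (t ∷ τ)     (zero ∷ u)  (o , f) = o , Fits-raise τ u f
Fits-raise (t ∷ τ)     (suc _ ∷ u) f = Fits-raise (use t ∷ τ) u f
Fits-raise (t ∷ [])    []          f = f

Fits-placeFirst : ∀ α y β u → Fits (α ++ use y ∷ β) u → Fits (α ++ y ∷ β) (placeFirst (length α) u)
Fits-placeFirst []      y β u           f = Fits-raise (use y ∷ β) u f
Fits-placeFirst (a ∷ α) y β (zero ∷ u)  (o , f) = o , Fits-placeFirst α y β u f
Fits-placeFirst (a ∷ α) y β (suc _ ∷ u) f = Fits-placeFirst (use a ∷ α) y β u f
Fits-placeFirst (a ∷ [])    y β [] ()
Fits-placeFirst (a ∷ _ ∷ _) y β [] ()

Fits-placeOnBar : ∀ α t y β u → Fits (α ++ t ∷ use y ∷ β) u → Fits (α ++ y ∷ β) (placeOnBar (length α) u)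
Fits-placeOnBar []      t y β (zero ∷ u)  (_ , f) = Fits-raise (use y ∷ β) u f
Fits-placeOnBar []      t y β (suc _ ∷ u) f =
  Fits-placeOnBar [] (use t) (use y) β u (subst (λ t′ → Fits (use t ∷ t′ ∷ β) u) (sym (use-idem y)) f)
Fits-placeOnBar (a ∷ α) t y β (zero ∷ u)  (o , f) = o , Fits-placeOnBar α t y β u f
Fits-placeOnBar (a ∷ α) t y β (suc _ ∷ u) f = Fits-placeOnBar (use a ∷ α) t y β u f
Fits-placeOnBar []          t y β [] ()
Fits-placeOnBar (a ∷ [])    t y β [] ()
Fits-placeOnBar (a ∷ _ ∷ _) t y β [] ()

Fits-replicate : ∀ t τ → hasObl (t ∷ τ) ≡ false → Fits (t ∷ τ) (replicate (length τ) 0)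
Fits-replicate fre []      o = refl
Fits-replicate dis []      o = refl
Fits-replicate fre (u ∷ τ) o = refl , Fits-replicate u τ o
Fits-replicate dis (u ∷ τ) o = refl , Fits-replicate u τ o

gapWords-fits : ∀ N τ {u} → u ∈ gapWords N τ → Fits τ u
gapWords-fits zero (t ∷ τ) u∈ with hasObl (t ∷ τ) in eq | u∈
... | false | here refl = Fits-replicate t τ eq
gapWords-fits (suc N) τ u∈ with ∈-pickConcat⁻ (placements N) τ u∈
... | α , y , β , refl , u∈′ with ∈-++⁻ (map (placeFirst (length α)) (gapWords N (α ++ use y ∷ β))) u∈′
... | inj₁ v∈ with u , u∈ , refl ← ∈-map⁻ (placeFirst (length α)) v∈ =
  Fits-placeFirst α y β u (gapWords-fits N _ u∈)
... | inj₂ v∈ with u , u∈ , refl ← ∈-map⁻ (placeOnBar (length α)) v∈ =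
  Fits-placeOnBar α obl y β u (gapWords-fits N _ u∈)

-- The last label, and no other, is distinguished.
DisLast : List Status → Set
DisLast []          = ⊥
DisLast (t ∷ [])    = t ≡ dis
DisLast (t ∷ u ∷ τ) = t ≢ dis × DisLast (u ∷ τ)

use-≢ : ∀ {t} → t ≢ dis → use t ≢ dis
use-≢ {obl} h ()
use-≢ {fre} h ()
use-≢ {dis} h e = h e

DisLast-use : ∀ α y β → DisLast (α ++ y ∷ β) → DisLast (α ++ use y ∷ β)
DisLast-use []          y []      refl = refl
DisLast-use []          y (t ∷ β) (h , d) = use-≢ h , d
DisLast-use (a ∷ [])    y β       (h , d) = h , DisLast-use [] y β d
DisLast-use (a ∷ b ∷ α) y β       (h , d) = h , DisLast-use (b ∷ α) y β d

DisLast-besideBar : ∀ α y β → DisLast (α ++ y ∷ β) → DisLast (besideBar α y β)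
DisLast-besideBar []          y β d = (λ ()) , DisLast-use [] y β d
DisLast-besideBar (a ∷ [])    y β (h , d) = h , DisLast-besideBar [] y β d
DisLast-besideBar (a ∷ b ∷ α) y β (h , d) = h , DisLast-besideBar (b ∷ α) y β d

isNil : List Status → Bool
isNil []      = true
isNil (_ ∷ _) = false

DisLast-tail : ∀ α {τ} → τ ≢ [] → DisLast (α ++ τ) → DisLast τ
DisLast-tail []          ne d = d
DisLast-tail (a ∷ [])    {[]}    ne d = ⊥-elim (ne refl)
DisLast-tail (a ∷ [])    {_ ∷ _} ne (_ , d) = d
DisLast-tail (a ∷ b ∷ α) ne (_ , d) = DisLast-tail (b ∷ α) ne d

zeros≡ᵇ : ∀ {z} (α : List Status) y β → suc z ≡ length (α ++ y ∷ β) → (z ≡ᵇ length α) ≡ isNil β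
zeros≡ᵇ []      y []      refl = refl
zeros≡ᵇ []      y (_ ∷ _) refl = refl
zeros≡ᵇ (a ∷ α) y β       refl
  rewrite trans (length-++ α {y ∷ β}) (ℕₚ.+-suc (length α) (length β)) =
  zeros≡ᵇ α y β (sym (trans (length-++ α) (ℕₚ.+-suc (length α) (length β))))

≤zeros : ∀ {z} (α : List Status) y β → suc z ≡ length (α ++ y ∷ β) → length α ≤ z
≤zeros []      y β eq = z≤n
≤zeros {suc z} (a ∷ α) y β eq = s≤s (≤zeros α y β (suc-injective eq))
≤zeros {zero}  (a ∷ []) y β ()
≤zeros {zero}  (a ∷ _ ∷ _) y β ()

<ᵇ-true : ∀ (α : List Status) y β → (length α <ᵇ length (α ++ y ∷ β)) ≡ true
<ᵇ-true []      y β = refl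
<ᵇ-true (_ ∷ α) y β = <ᵇ-true α y β

<ᵇ-false : ∀ (α β : List Status) → (length (α ++ β) <ᵇ length α) ≡ false
<ᵇ-false []      []      = refl
<ᵇ-false []      (_ ∷ _) = refl
<ᵇ-false (_ ∷ α) β       = <ᵇ-false α β

StartAt-[] : ∀ c → StartAt c []
StartAt-[] zero    = empty
StartAt-[] (suc c) = tt

gapWords-zerosN : ∀ N α y β {u} → u ∈ gapWords N (α ++ use y ∷ β) → length α ≤ zeros u
gapWords-zerosN N α y β {u} u∈ =
  ≤zeros α (use y) β (Fits-zeros (α ++ use y ∷ β) u (gapWords-fits N _ u∈))

gapWords-zerosB : ∀ N α y β {u} → u ∈ gapWords N (besideBar α y β) → suc (length α) ≤ zeros u
gapWords-zerosB N α y β {u} u∈ =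
  subst (_≤ zeros u) (trans (length-++ α) (ℕₚ.+-comm (length α) 1))
    (≤zeros (α ++ obl ∷ []) (use y) β (trans (Fits-zeros (besideBar α y β) u (gapWords-fits N _ u∈))
      (cong length (sym (++-assoc α (obl ∷ []) (use y ∷ β))))))

module GapWordSum {c ℓ} (R : CommutativeSemiring c ℓ) (s x w : CommutativeSemiring.Carrier R) where
  open CommutativeSemiring R hiding (zero) renaming (refl to ≈-refl; sym to ≈-sym; trans to ≈-trans)
  open Sums R
  open SumLemmas R
  open StatePolynomial R s x w
  open import Algebra.Properties.Semiring.Exp semiring using (^-homo-*)
  open import Algebra.Solver.Ring.NaturalCoefficients.Default R
    using (solve; _:=_; _:+_; _:*_)
  open import Relation.Binary.Reasoning.Setoid setoid

  -- The monomial of a word.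
  weightW : List ℕ → Carrier
  weightW u = s ^ rminW u * x ^ sillyW [] u * w ^ desW [] u

  wt-last : ∀ y β → DisLast (y ∷ β) → s ^ ind (isNil β) ≈ wt y
  wt-last .dis []      refl = *-identityʳ s
  wt-last obl  (_ ∷ _) d = ≈-refl
  wt-last fre  (_ ∷ _) d = ≈-refl
  wt-last dis  (_ ∷ _) (h , d) = ⊥-elim (h refl)

  -- Collects the factors contributed by the step that is undone.
  merge : ∀ a b c d e f → a * (s ^ (b ℕ.+ c) * x ^ (d ℕ.+ e) * w ^ f)
    ≈ (a * s ^ b) * (x ^ d * (s ^ c * x ^ e * w ^ f))
  merge a b c d e f = ≈-trans (*-congˡ (*-congʳ (*-cong (^-homo-* s b c) (^-homo-* x d e))))
    (solve 6 (λ a b c d e f → a :* ((b :* c) :* (d :* e) :* f) := (a :* b) :* (d :* (c :* e :* f)))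
      ≈-refl _ _ _ _ _ _)

  -- The letter 1 is the next choice; it is compared with the preceding choice by
  -- left1.
  gapWords-sum : ∀ N lo hi → DisLast (lo ++ hi) →
    sumOver (gapWords N (lo ++ hi)) (λ u → x ^ ind (left1 (length lo) u) * weightW u) ≈ F besideBar N lo hi

  placements-sum : ∀ N l α y β → DisLast (α ++ y ∷ β) →
    sumOver (placements N α y β) (λ u → x ^ ind (left1 l u) * weightW u)
      ≈ x ^ ind (length α <ᵇ l) * Kernel besideBar (F besideBar N) α y β
  placements-sum N l α y β d = begin
    sumOver (placements N α y β) f
      ≈⟨ sum-++ (map (placeFirst c′) X) (map (placeOnBar c′) Y) f ⟩
    sumOver (map (placeFirst c′) X) f + sumOver (map (placeOnBar c′) Y) f
      ≈⟨ +-cong (≈-trans (sum-map _ X f) (≈-trans (sum-cong caseN) (sum-* a X _)))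
                (≈-trans (sum-map _ Y f) (≈-trans (sum-cong caseB) (sum-* (a * w) Y _))) ⟩
    a * sumOver X (λ u → x ^ ind (left1 c′ u) * weightW u)
      + a * w * sumOver Y (λ u → x ^ ind (left1 0 u) * weightW u)
      ≈⟨ +-cong (*-congˡ (gapWords-sum N α (use y ∷ β) (DisLast-use α y β d)))
                (*-congˡ (gapWords-sum N [] (besideBar α y β) (DisLast-besideBar α y β d))) ⟩
    a * F besideBar N α (use y ∷ β) + a * w * F besideBar N [] (besideBar α y β)
      ≈⟨ solve 5 (λ e t w f g → (e :* t) :* f :+ (e :* t) :* w :* g := e :* (t :* (f :+ w :* g)))
           ≈-refl _ _ _ _ _ ⟩
    x ^ ind (c′ <ᵇ l) * Kernel besideBar (F besideBar N) α y β ∎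
    where
    c′ = length α
    f = λ u → x ^ ind (left1 l u) * weightW u
    X = gapWords N (α ++ use y ∷ β)
    Y = gapWords N (besideBar α y β)
    a = x ^ ind (c′ <ᵇ l) * wt y
    d-tail : DisLast (y ∷ β)
    d-tail = DisLast-tail α (λ ()) d
    caseN : ∀ {u} → u ∈ X → f (placeFirst c′ u) ≈ a * (x ^ ind (left1 c′ u) * weightW u)
    caseN {u} u∈ = begin
      f (placeFirst c′ u)
        ≡⟨ cong₂ (λ b m → x ^ ind b * m) (left1-placeFirst l c′ u le)
             (cong₂ _*_ (cong₂ (λ m n → s ^ m * x ^ n)
                 (trans (rminW-placeFirst c′ u le)
                   (cong (λ b → ind b ℕ.+ rminW u) (zeros≡ᵇ α (use y) β zs)))
                 (sillyW-placeFirst Raised-[] c′ u le (StartAt-[] c′) (StartAt-[] c′)))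
               (cong (w ^_) (desW-placeFirst Raised-[] c′ u (StartAt-[] c′) (StartAt-[] c′)))) ⟩
      x ^ ind (c′ <ᵇ l) * (s ^ (ind (isNil β) ℕ.+ rminW u)
        * x ^ (ind (left1 c′ u) ℕ.+ sillyW [] u) * w ^ desW [] u)
        ≈⟨ merge _ (ind (isNil β)) (rminW u) (ind (left1 c′ u)) (sillyW [] u) (desW [] u) ⟩
      x ^ ind (c′ <ᵇ l) * s ^ ind (isNil β) * (x ^ ind (left1 c′ u) * weightW u)
        ≈⟨ *-congʳ (*-congˡ (wt-last y β d-tail)) ⟩
      a * (x ^ ind (left1 c′ u) * weightW u) ∎
      where
      zs = Fits-zeros (α ++ use y ∷ β) u (gapWords-fits N (α ++ use y ∷ β) u∈)
      le = gapWords-zerosN N α y β u∈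
    caseB : ∀ {u} → u ∈ Y → f (placeOnBar c′ u) ≈ a * w * (x ^ ind (left1 0 u) * weightW u)
    caseB {u} u∈ = begin
      f (placeOnBar c′ u)
        ≡⟨ cong₂ (λ b m → x ^ ind b * m) (left1-placeOnBar l c′ u le)
             (cong₂ _*_ (cong₂ (λ m n → s ^ m * x ^ n)
                 (trans (rminW-placeOnBar c′ u le)
                   (cong (λ b → ind b ℕ.+ rminW u) zs≡))
                 (proj₂ st))
               (cong (w ^_) (proj₁ st))) ⟩
      x ^ ind (c′ <ᵇ l) * (s ^ (ind (isNil β) ℕ.+ rminW u)
        * x ^ (0 ℕ.+ sillyW [] u) * w ^ suc (desW [] u))
        ≈⟨ merge _ (ind (isNil β)) (rminW u) 0 (sillyW [] u) (suc (desW [] u)) ⟩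
      x ^ ind (c′ <ᵇ l) * s ^ ind (isNil β)
        * (x ^ 0 * (s ^ rminW u * x ^ sillyW [] u * w ^ suc (desW [] u)))
        ≈⟨ *-congʳ (*-congˡ (wt-last y β d-tail)) ⟩
      a * (x ^ 0 * (s ^ rminW u * x ^ sillyW [] u * w ^ suc (desW [] u)))
        ≈⟨ solve 6 (λ a w e p q r → a :* (e :* (p :* q :* (w :* r))) := a :* w :* (e :* (p :* q :* r)))
             ≈-refl _ _ _ _ _ _ ⟩
      a * w * (x ^ 0 * weightW u) ∎
      where
      fits = gapWords-fits N (besideBar α y β) u∈
      zs = Fits-zeros (besideBar α y β) u fits
      le = gapWords-zerosB N α y β u∈
      zs≡ = subst (λ m → (zeros u ≡ᵇ m) ≡ isNil β) (trans (length-++ α) (ℕₚ.+-comm c′ 1))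
        (zeros≡ᵇ (α ++ obl ∷ []) (use y) β
          (trans zs (cong length (sym (++-assoc α (obl ∷ []) (use y ∷ β))))))
      st = placeOnBar-stats Raised-[] α obl (use y) β u fits (inj₁ refl)

  gapWords-sum zero lo hi d = go (lo ++ hi) d
    where
    zero-words : ∀ n {p} → rminW (replicate n 0) ≡ 0 × sillyW p (replicate n 0) ≡ 0
      × desW p (replicate n 0) ≡ 0
    zero-words zero    = refl , refl , refl
    zero-words (suc n) = zero-words n
    left1-zeros : ∀ l n → left1 l (replicate n 0) ≡ false
    left1-zeros zero    n       = refl
    left1-zeros (suc l) zero    = refl
    left1-zeros (suc l) (suc n) = left1-zeros l n
    go : ∀ τ → DisLast τ → sumOver (base τ) (λ u → x ^ ind (left1 (length lo) u) * weightW u)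
      ≈ (if hasObl τ then 0# else 1#)
    go (t ∷ τ) d with hasObl (t ∷ τ)
    ... | true  = ≈-refl
    ... | false with zero-words (length τ) {[]}
    ... | r , q , e rewrite left1-zeros (length lo) (length τ) | r | q | e =
      ≈-trans (+-identityʳ _) (≈-trans (*-identityˡ _) (≈-trans (*-identityʳ _) (*-identityʳ _)))
  gapWords-sum (suc N) lo hi d = begin
    sumOver (pickConcat (placements N) (lo ++ hi)) f
      ≈⟨ sum-pickConcat R s x w (placements N) (lo ++ hi) f ⟩
    pickSum (λ α y β → sumOver (placements N α y β) f) (lo ++ hi)
      ≈⟨ pickSum-++ _ lo hi ⟩
    pickSum (λ α y β → sumOver (placements N α y (β ++ hi)) f) lo
      + pickSum (λ α y β → sumOver (placements N (lo ++ α) y β) f) hi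
      ≈⟨ +-cong
           (≈-trans (pickSum-cong-at lo λ { α y β refl → ≈-trans
               (placements-sum N l α y (β ++ hi) (subst DisLast (++-assoc α (y ∷ β) hi) d))
               (*-congʳ (≈-trans (reflexive (cong (λ b → x ^ ind b) (<ᵇ-true α y β)))
                 (*-identityʳ x))) })
             (pickSum-* x _ lo))
           (pickSum-cong-at hi λ { α y β refl → ≈-trans
               (placements-sum N l (lo ++ α) y β (subst DisLast (sym (++-assoc lo α (y ∷ β))) d))
               (≈-trans (*-congʳ (reflexive (cong (λ b → x ^ ind b) (<ᵇ-false lo α))))
                 (*-identityˡ _)) }) ⟩
    step besideBar (F besideBar N) lo hi ∎
    where
    l = length lo
    f = λ u → x ^ ind (left1 l u) * weightW u

-- Characterization of the words that fit

lower : ℕ → ℕ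
lower zero    = zero
lower (suc y) = y

lowerW : List ℕ → List ℕ
lowerW = map lower

lower-raise : ∀ u → lowerW (raise u) ≡ u
lower-raise []          = refl
lower-raise (zero ∷ u)  = cong (zero ∷_) (lower-raise u)
lower-raise (suc y ∷ u) = cong (suc y ∷_) (lower-raise u)

unplaceFirst : List ℕ → List ℕ
unplaceFirst []                = []
unplaceFirst (zero ∷ u)        = zero ∷ unplaceFirst u
unplaceFirst (suc zero ∷ u)    = lowerW u
unplaceFirst (suc (suc y) ∷ u) = suc y ∷ unplaceFirst u

unplaceOnBar : List ℕ → List ℕ
unplaceOnBar []                = []
unplaceOnBar (zero ∷ u)        = zero ∷ unplaceOnBar u
unplaceOnBar (suc zero ∷ u)    = zero ∷ lowerW u
unplaceOnBar (suc (suc y) ∷ u) = suc y ∷ unplaceOnBar u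

unplaceFirst-placeFirst : ∀ c u → unplaceFirst (placeFirst c u) ≡ u
unplaceFirst-placeFirst zero    u           = lower-raise u
unplaceFirst-placeFirst (suc c) []          = refl
unplaceFirst-placeFirst (suc c) (zero ∷ u)  = cong (zero ∷_) (unplaceFirst-placeFirst c u)
unplaceFirst-placeFirst (suc c) (suc y ∷ u) = cong (suc y ∷_) (unplaceFirst-placeFirst (suc c) u)

unplaceOnBar-placeOnBar : ∀ c u → unplaceOnBar (placeOnBar c u) ≡ u
unplaceOnBar-placeOnBar zero    []          = refl
unplaceOnBar-placeOnBar (suc c) []          = refl
unplaceOnBar-placeOnBar zero    (zero ∷ u)  = cong (zero ∷_) (lower-raise u)
unplaceOnBar-placeOnBar (suc c) (zero ∷ u)  = cong (zero ∷_) (unplaceOnBar-placeOnBar c u)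
unplaceOnBar-placeOnBar zero    (suc y ∷ u) = cong (suc y ∷_) (unplaceOnBar-placeOnBar zero u)
unplaceOnBar-placeOnBar (suc c) (suc y ∷ u) = cong (suc y ∷_) (unplaceOnBar-placeOnBar (suc c) u)

-- The number of separators before the first letter 1.
gapOf1 : List ℕ → ℕ
gapOf1 []                = 0
gapOf1 (zero ∷ u)        = suc (gapOf1 u)
gapOf1 (suc zero ∷ u)    = 0
gapOf1 (suc (suc y) ∷ u) = gapOf1 u

gapOf1-placeFirst : ∀ c u → c ≤ zeros u → gapOf1 (placeFirst c u) ≡ c
gapOf1-placeFirst zero    u           le = refl
gapOf1-placeFirst (suc c) (zero ∷ u)  (s≤s le) = cong suc (gapOf1-placeFirst c u le)
gapOf1-placeFirst (suc c) (suc y ∷ u) le = gapOf1-placeFirst (suc c) u le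

gapOf1-placeOnBar : ∀ c u → suc c ≤ zeros u → gapOf1 (placeOnBar c u) ≡ c
gapOf1-placeOnBar zero    (zero ∷ u)  le = refl
gapOf1-placeOnBar (suc c) (zero ∷ u)  (s≤s le) = cong suc (gapOf1-placeOnBar c u le)
gapOf1-placeOnBar zero    (suc y ∷ u) le = gapOf1-placeOnBar zero u le
gapOf1-placeOnBar (suc c) (suc y ∷ u) le = gapOf1-placeOnBar (suc c) u le

-- Whether the first letter 1 is a descent bottom.
bar1 : List ℕ → List ℕ → Bool
bar1 p []                = false
bar1 p (zero ∷ u)        = bar1 (zero ∷ p) u
bar1 p (suc zero ∷ u)    = lastAbove p 1
bar1 p (suc (suc y) ∷ u) = bar1 (suc (suc y) ∷ p) u

bar1-placeFirst : ∀ {p} c u → StartAt c p → bar1 p (placeFirst c u) ≡ false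
bar1-placeFirst zero    u           st = Start-above st 0
bar1-placeFirst (suc c) []          st = refl
bar1-placeFirst (suc c) (zero ∷ u)  st = bar1-placeFirst c u (StartAt-zero c _)
bar1-placeFirst (suc c) (suc y ∷ u) st = bar1-placeFirst (suc c) u tt

bar1-placeOnBar : ∀ {p} α t t′ β u → Fits (α ++ t ∷ t′ ∷ β) u →
  t ≡ obl ⊎ (α ≡ [] × ∃[ z ] ∃[ q ] p ≡ suc (suc z) ∷ q) → bar1 p (placeOnBar (length α) u) ≡ true
bar1-placeOnBar [] .obl t′ β (zero ∷ u) (() , f) (inj₁ refl)
bar1-placeOnBar [] t t′ β (zero ∷ u) f (inj₂ (_ , z , q , refl)) = refl
bar1-placeOnBar [] t t′ β (suc y ∷ u) f _ = bar1-placeOnBar [] (use t) t′ β u f (inj₂ (refl , y , _ , refl))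
bar1-placeOnBar (a ∷ α) t t′ β (zero ∷ u) (_ , f) (inj₁ refl) = bar1-placeOnBar α obl t′ β u f (inj₁ refl)
bar1-placeOnBar (a ∷ α) t t′ β (suc y ∷ u) f (inj₁ refl) = bar1-placeOnBar (use a ∷ α) obl t′ β u f (inj₁ refl)
bar1-placeOnBar []          t t′ β [] () _
bar1-placeOnBar (a ∷ [])    t t′ β [] () _
bar1-placeOnBar (a ∷ _ ∷ α) t t′ β [] () _

leftInverse⇒injective : ∀ {a b} {A : Set a} {B : Set b} {f : A → B} (g : B → A) →
  (∀ y → g (f y) ≡ y) → ∀ {y z} → f y ≡ f z → y ≡ z
leftInverse⇒injective g gf {y} {z} eq = trans (sym (gf y)) (trans (cong g eq) (gf z))

-- A word determines its next step: gapOf1 tells the chosen label and bar1 tells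
-- whether a bar is drawn.
gapWords-unique : ∀ N τ → Unique (gapWords N τ)
gapWords-unique zero []      = []
gapWords-unique zero (t ∷ τ) with hasObl (t ∷ τ)
... | true  = []
... | false = [] ∷ []
gapWords-unique (suc N) τ = Unique-pickConcat gapOf1 (placements N) τ
  (λ α y β _ → Unique.++⁺
    (Unique.map⁺ (leftInverse⇒injective unplaceFirst (unplaceFirst-placeFirst (length α))) (gapWords-unique N _))
    (Unique.map⁺ (leftInverse⇒injective unplaceOnBar (unplaceOnBar-placeOnBar (length α))) (gapWords-unique N _))
    (λ (v∈N , v∈B) → disjoint α y β v∈N v∈B))
  0 (λ α y β _ v∈ → gap α y β v∈)
  where
  disjoint : ∀ α y β {v} → v ∈ map (placeFirst (length α)) (gapWords N (α ++ use y ∷ β)) →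
    v ∈ map (placeOnBar (length α)) (gapWords N (besideBar α y β)) → ⊥
  disjoint α y β v∈N v∈B
    with u , u∈ , refl ← ∈-map⁻ (placeFirst (length α)) v∈N
       | u′ , u′∈ , eq ← ∈-map⁻ (placeOnBar (length α)) v∈B
    with () ← trans (sym (bar1-placeOnBar {[]} α obl (use y) β u′ (gapWords-fits N _ u′∈) (inj₁ refl)))
                (trans (cong (bar1 []) (sym eq)) (bar1-placeFirst (length α) u (StartAt-[] (length α))))
  gap : ∀ α y β {v} → v ∈ placements N α y β → gapOf1 v ≡ length α
  gap α y β v∈ with ∈-++⁻ (map (placeFirst (length α)) (gapWords N (α ++ use y ∷ β))) v∈
  ... | inj₁ v∈ with u , u∈ , refl ← ∈-map⁻ (placeFirst (length α)) v∈ =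
    gapOf1-placeFirst (length α) u (gapWords-zerosN N α y β u∈)
  ... | inj₂ v∈ with u , u∈ , refl ← ∈-map⁻ (placeOnBar (length α)) v∈ =
    gapOf1-placeOnBar (length α) u (gapWords-zerosB N α y β u∈)

count : ℕ → List ℕ → ℕ
count y []      = 0
count y (z ∷ u) = ind (y ≡ᵇ z) ℕ.+ count y u

-- Each of the values 1, ..., N occurs exactly once, and no greater value occurs.
Content : ℕ → List ℕ → Set
Content N u = ∀ v → count (suc v) u ≡ ind (v <ᵇ N)

count-raise : ∀ v u → count (2 ℕ.+ v) (raise u) ≡ count (1 ℕ.+ v) u
count-raise v []          = refl
count-raise v (zero ∷ u)  = count-raise v u
count-raise v (suc y ∷ u) = cong (ind (v ≡ᵇ y) ℕ.+_) (count-raise v u)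

count-1-raise : ∀ u → count 1 (raise u) ≡ 0
count-1-raise []          = refl
count-1-raise (zero ∷ u)  = count-1-raise u
count-1-raise (suc y ∷ u) = count-1-raise u

count-placeFirst : ∀ v c u → count (2 ℕ.+ v) (placeFirst c u) ≡ count (1 ℕ.+ v) u
count-placeFirst v zero    u           = count-raise v u
count-placeFirst v (suc c) []          = refl
count-placeFirst v (suc c) (zero ∷ u)  = count-placeFirst v c u
count-placeFirst v (suc c) (suc y ∷ u) = cong (ind (v ≡ᵇ y) ℕ.+_) (count-placeFirst v (suc c) u)

count-placeOnBar : ∀ v c u → count (2 ℕ.+ v) (placeOnBar c u) ≡ count (1 ℕ.+ v) u
count-placeOnBar v zero    []          = refl
count-placeOnBar v (suc c) []          = refl
count-placeOnBar v zero    (zero ∷ u)  = count-raise v u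
count-placeOnBar v (suc c) (zero ∷ u)  = count-placeOnBar v c u
count-placeOnBar v zero    (suc y ∷ u) = cong (ind (v ≡ᵇ y) ℕ.+_) (count-placeOnBar v zero u)
count-placeOnBar v (suc c) (suc y ∷ u) = cong (ind (v ≡ᵇ y) ℕ.+_) (count-placeOnBar v (suc c) u)

count-1-placeFirst : ∀ c u → c ≤ zeros u → count 1 (placeFirst c u) ≡ 1
count-1-placeFirst zero    u           le = cong suc (count-1-raise u)
count-1-placeFirst (suc c) (zero ∷ u)  (s≤s le) = count-1-placeFirst c u le
count-1-placeFirst (suc c) (suc y ∷ u) le = count-1-placeFirst (suc c) u le

count-1-placeOnBar : ∀ c u → suc c ≤ zeros u → count 1 (placeOnBar c u) ≡ 1
count-1-placeOnBar zero    (zero ∷ u)  le = cong suc (count-1-raise u)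
count-1-placeOnBar (suc c) (zero ∷ u)  (s≤s le) = count-1-placeOnBar c u le
count-1-placeOnBar zero    (suc y ∷ u) le = count-1-placeOnBar zero u le
count-1-placeOnBar (suc c) (suc y ∷ u) le = count-1-placeOnBar (suc c) u le

count-zeros : ∀ v n → count (suc v) (replicate n 0) ≡ 0
count-zeros v zero    = refl
count-zeros v (suc n) = count-zeros v n

gapWords-content : ∀ N τ {u} → u ∈ gapWords N τ → Content N u
gapWords-content zero (t ∷ τ) u∈ v with hasObl (t ∷ τ) | u∈
... | false | here refl = count-zeros v (length τ)
gapWords-content (suc N) τ u∈ v with ∈-pickConcat⁻ (placements N) τ u∈
... | α , y , β , refl , u∈′ with ∈-++⁻ (map (placeFirst (length α)) (gapWords N (α ++ use y ∷ β))) u∈′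
gapWords-content (suc N) τ u∈ zero | α , y , β , refl , u∈′ | inj₁ v∈
  with u , u∈ , refl ← ∈-map⁻ (placeFirst (length α)) v∈ =
  count-1-placeFirst (length α) u (gapWords-zerosN N α y β u∈)
gapWords-content (suc N) τ u∈ zero | α , y , β , refl , u∈′ | inj₂ v∈
  with u , u∈ , refl ← ∈-map⁻ (placeOnBar (length α)) v∈ =
  count-1-placeOnBar (length α) u (gapWords-zerosB N α y β u∈)
gapWords-content (suc N) τ u∈ (suc v) | α , y , β , refl , u∈′ | inj₁ v∈
  with u , u∈ , refl ← ∈-map⁻ (placeFirst (length α)) v∈ =
  trans (count-placeFirst v (length α) u) (gapWords-content N _ u∈ v)
gapWords-content (suc N) τ u∈ (suc v) | α , y , β , refl , u∈′ | inj₂ v∈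
  with u , u∈ , refl ← ∈-map⁻ (placeOnBar (length α)) v∈ =
  trans (count-placeOnBar v (length α) u) (gapWords-content N _ u∈ v)

length-placeFirst : ∀ c u → c ≤ zeros u → length (placeFirst c u) ≡ suc (length u)
length-placeFirst zero    u           le = cong suc (length-map lift u)
length-placeFirst (suc c) (zero ∷ u)  (s≤s le) = cong suc (length-placeFirst c u le)
length-placeFirst (suc c) (suc y ∷ u) le = cong suc (length-placeFirst (suc c) u le)

length-placeOnBar : ∀ c u → length (placeOnBar c u) ≡ length u
length-placeOnBar zero    []          = refl
length-placeOnBar (suc c) []          = refl
length-placeOnBar zero    (zero ∷ u)  = cong suc (length-map lift u)
length-placeOnBar (suc c) (zero ∷ u)  = cong suc (length-placeOnBar c u)
length-placeOnBar zero    (suc y ∷ u) = cong suc (length-placeOnBar zero u)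
length-placeOnBar (suc c) (suc y ∷ u) = cong suc (length-placeOnBar (suc c) u)

gapWords-length : ∀ N τ {u} → u ∈ gapWords N τ → suc (length u) ≡ N ℕ.+ length τ
gapWords-length zero (t ∷ τ) u∈ with hasObl (t ∷ τ) | u∈
... | false | here refl = cong suc (length-replicate (length τ))
gapWords-length (suc N) τ u∈ with ∈-pickConcat⁻ (placements N) τ u∈
... | α , y , β , refl , u∈′ with ∈-++⁻ (map (placeFirst (length α)) (gapWords N (α ++ use y ∷ β))) u∈′
... | inj₁ v∈ with u , u∈ , refl ← ∈-map⁻ (placeFirst (length α)) v∈ =
  cong suc (trans (length-placeFirst (length α) u (gapWords-zerosN N α y β u∈))
    (trans (gapWords-length N _ u∈) (cong (N ℕ.+_) (trans (length-++ α) (sym (length-++ α))))))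
... | inj₂ v∈ with u , u∈ , refl ← ∈-map⁻ (placeOnBar (length α)) v∈ =
  trans (cong suc (length-placeOnBar (length α) u)) (trans (gapWords-length N _ u∈)
    (trans (cong (N ℕ.+_) (trans (length-++ α) (trans (ℕₚ.+-suc (length α) (suc (length β)))
      (cong suc (sym (length-++ α)))))) (ℕₚ.+-suc N _)))

-- The word v arises by undoing a step, from a word with one value less.
data Placement (τ : List Status) (v : List ℕ) : Set where
  unbarred : ∀ α y β u → τ ≡ α ++ y ∷ β → v ≡ placeFirst (length α) u →
    Fits (α ++ use y ∷ β) u → Placement τ v
  barred : ∀ α y β u → τ ≡ α ++ y ∷ β → v ≡ placeOnBar (length α) u →
    Fits (α ++ obl ∷ use y ∷ β) u → Placement τ v

-- The same for v read from within the gap of the label t, if the new value lies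
-- in a later gap.
data Later (t : Status) (σ : List Status) (v : List ℕ) : Set where
  unbarred : ∀ α y β u → σ ≡ α ++ y ∷ β → v ≡ placeFirst (suc (length α)) u →
    Fits (t ∷ α ++ use y ∷ β) u → Later t σ v
  barred : ∀ α y β u → σ ≡ α ++ y ∷ β → v ≡ placeOnBar (suc (length α)) u →
    Fits (t ∷ α ++ obl ∷ use y ∷ β) u → Later t σ v

raise-lower : ∀ u → count 1 u ≡ 0 → raise (lowerW u) ≡ u
raise-lower []                eq = refl
raise-lower (zero ∷ u)        eq = cong (zero ∷_) (raise-lower u eq)
raise-lower (suc (suc y) ∷ u) eq = cong (suc (suc y) ∷_) (raise-lower u eq)

Fits-lower : ∀ τ u → count 1 u ≡ 0 → Fits τ u → Fits τ (lowerW u)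
Fits-lower (t ∷ τ)  (zero ∷ u)        eq (o , f) = o , Fits-lower τ u eq f
Fits-lower (t ∷ τ)  (suc (suc _) ∷ u) eq f = Fits-lower (use t ∷ τ) u eq f
Fits-lower (t ∷ []) []                eq f = f

-- Takes back the placement of the letter 1.  It was placed first in its gap if it
-- is read at the start of a gap, and on a separator otherwise.
findPlacement : ∀ t σ v → Fits (t ∷ σ) v → count 1 v ≡ 1 → Placement (t ∷ σ) v
findInGap : ∀ t σ v → use t ≡ t → Fits (t ∷ σ) v → count 1 v ≡ 1 →
  (∃[ u ] (v ≡ placeOnBar 0 u × Fits (fre ∷ t ∷ σ) u)) ⊎ Later t σ v
later : ∀ t σ v → isObl t ≡ false → Fits σ v → count 1 v ≡ 1 → Later t σ (zero ∷ v)

later t (t′ ∷ σ) v o f eq with findPlacement t′ σ v f eq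
... | unbarred α y β u e refl f′ = unbarred α y β (zero ∷ u) e refl (o , f′)
... | barred α y β u e refl f′ = barred α y β (zero ∷ u) e refl (o , f′)

findPlacement t σ (zero ∷ v) (o , f) eq with later t σ v o f eq
... | unbarred α y β u e e′ f′ = unbarred (t ∷ α) y β u (cong (t ∷_) e) e′ f′
... | barred α y β u e e′ f′ = barred (t ∷ α) y β u (cong (t ∷_) e) e′ f′
findPlacement t σ (suc zero ∷ v) f eq =
  unbarred [] t σ (lowerW v) refl (cong (1 ∷_) (sym (raise-lower v (suc-injective eq))))
    (Fits-lower (use t ∷ σ) v (suc-injective eq) f)
findPlacement t σ (suc (suc y) ∷ v) f eq with findInGap (use t) σ v (use-idem t) f eq
... | inj₁ (u , refl , f′) = barred [] t σ (suc y ∷ u) refl refl f′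
... | inj₂ (unbarred α z β u e refl f′) = unbarred (t ∷ α) z β (suc y ∷ u) (cong (t ∷_) e) refl f′
... | inj₂ (barred α z β u e refl f′) = barred (t ∷ α) z β (suc y ∷ u) (cong (t ∷_) e) refl f′
findPlacement t []      [] f ()
findPlacement t (_ ∷ _) [] () eq

findInGap t σ (zero ∷ v) used (o , f) eq = inj₂ (later t σ v o f eq)
findInGap t σ (suc zero ∷ v) used f eq =
  inj₁ (zero ∷ lowerW v , cong (1 ∷_) (sym (raise-lower v (suc-injective eq))) ,
    refl , Fits-lower (t ∷ σ) v (suc-injective eq) (subst (λ t → Fits (t ∷ σ) v) used f))
findInGap t σ (suc (suc y) ∷ v) used f eq
  with findInGap t σ v used (subst (λ t → Fits (t ∷ σ) v) used f) eq
... | inj₁ (u , refl , f′) = inj₁ (suc y ∷ u , refl , f′)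
... | inj₂ (unbarred α z β u e refl f′) = inj₂ (unbarred α z β (suc y ∷ u) e refl
  (subst (λ t → Fits (t ∷ α ++ use z ∷ β) u) (sym used) f′))
... | inj₂ (barred α z β u e refl f′) = inj₂ (barred α z β (suc y ∷ u) e refl
  (subst (λ t → Fits (t ∷ α ++ obl ∷ use z ∷ β) u) (sym used) f′))
findInGap t []      [] used f ()
findInGap t (_ ∷ _) [] used () eq

count-head : ∀ y u → count (suc y) (suc y ∷ u) ≡ suc (count (suc y) u)
count-head y u = cong (λ b → ind b ℕ.+ count (suc y) u) (≡ᵇ-refl y)
  where
  ≡ᵇ-refl : ∀ y → (y ≡ᵇ y) ≡ true
  ≡ᵇ-refl zero    = refl
  ≡ᵇ-refl (suc y) = ≡ᵇ-refl y

gapWords-complete-zero : ∀ t τ u → Fits (t ∷ τ) u → (∀ v → count (suc v) u ≡ 0) →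
  hasObl (t ∷ τ) ≡ false × u ≡ replicate (length τ) 0
gapWords-complete-zero t []       []          f c = trans (cong (_∨ false) f) refl , refl
gapWords-complete-zero t (t′ ∷ τ) (zero ∷ u)  (o , f) c
  with h , e ← gapWords-complete-zero t′ τ u f c = trans (cong (_∨ hasObl (t′ ∷ τ)) o) h , cong (zero ∷_) e
gapWords-complete-zero t τ        (suc y ∷ u) f c with () ← trans (sym (c y)) (count-head y u)
gapWords-complete-zero t (_ ∷ _)  [] () c

gapWords-complete : ∀ N τ {u} → Fits τ u → Content N u → u ∈ gapWords N τ
gapWords-complete zero (t ∷ τ) {u} f c with gapWords-complete-zero t τ u f c
... | o , refl rewrite o = here refl
gapWords-complete (suc N) (t ∷ τ) {v} f c with findPlacement t τ v f (c 0)
... | unbarred α y β u e refl f′ = subst (λ τ → _ ∈ gapWords (suc N) τ) (sym e)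
  (∈-pickConcat⁺ (placements N) α (∈-++⁺ˡ (∈-map⁺ (placeFirst (length α)) (gapWords-complete N _ f′
    (λ v → trans (sym (count-placeFirst v (length α) u)) (c (suc v)))))))
... | barred α y β u e refl f′ = subst (λ τ → _ ∈ gapWords (suc N) τ) (sym e)
  (∈-pickConcat⁺ (placements N) α (∈-++⁺ʳ _ (∈-map⁺ (placeOnBar (length α)) (gapWords-complete N _ f′
    (λ v → trans (sym (count-placeOnBar v (length α) u)) (c (suc v)))))))

-- Permutations as words

module _ {a} {A : Set a} where

  words-unique : ∀ {xs : List A} → Unique xs → ∀ n → Unique (words xs n)
  words-unique u zero    = [] ∷ []
  words-unique u (suc n) = Unique.cartesianProductWith⁺ _∷_ (λ eq → ∷-injective eq) u (words-unique u n)

  ∈-words : ∀ {xs : List A} → (∀ y → y ∈ xs) → ∀ {n} (v : Vec A n) → v ∈ words xs n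
  ∈-words all []      = here refl
  ∈-words all (y ∷ v) = ∈-cartesianProductWith⁺ _∷_ (all y) (∈-words all v)

-- The number of indices at which a Boolean predicate holds.
countFin : ∀ {n} → (Fin n → Bool) → ℕ
countFin {zero}  b = 0
countFin {suc n} b = ind (b zero) ℕ.+ countFin (b ∘ suc)

countFin-cong : ∀ {n} {b b′ : Fin n → Bool} → (∀ i → b i ≡ b′ i) → countFin b ≡ countFin b′
countFin-cong {zero}  h = refl
countFin-cong {suc n} h = cong₂ (λ b m → ind b ℕ.+ m) (h zero) (countFin-cong (h ∘ suc))

#-countFin : ∀ {n p} {P : Pred (Fin n) p} (P? : Decidable P) → # P? ≡ countFin (does ∘ P?)
#-countFin P? = go _ P? (λ i → i)
  where
  go : ∀ m {n p} {P : Pred (Fin n) p} (P? : Decidable P) (f : Fin m → Fin n) →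
    length (filter P? (tabulate f)) ≡ countFin (does ∘ P? ∘ f)
  go zero    P? f = refl
  go (suc m) P? f with does (P? (f zero))
  ... | true  = cong suc (go m P? (f ∘ suc))
  ... | false = go m P? (f ∘ suc)

#-Bool : ∀ {n p} {P : Pred (Fin n) p} (P? : Decidable P) (b : Fin n → Bool) →
  (∀ i → P i ⇔ T (b i)) → # P? ≡ countFin b
#-Bool P? b h = trans (#-countFin P?) (countFin-cong (λ i → does-⇔ (h i) (P? i) (T? (b i))))

module _ {a} {A : Set a} where

  -- The entries before position j in reverse order, followed by p.
  before : ∀ {m} → List A → Vec A m → Fin m → List A
  before p (y ∷ v) zero    = p
  before p (y ∷ v) (suc j) = before (y ∷ p) v j

  after : ∀ {m} → Vec A m → Fin m → List A
  after (y ∷ v) zero    = toList v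
  after (y ∷ v) (suc j) = after v j

  before-first : ∀ {m} p (v : Vec A m) j → toℕ j ≡ 0 → before p v j ≡ p
  before-first p (y ∷ v) zero _ = refl

  before-next : ∀ {m} p (v : Vec A m) i j → i ⋖ j → before p v j ≡ lookup v i ∷ before p v i
  before-next p (y ∷ v) i zero ()
  before-next p (y ∷ z ∷ v) zero (suc zero) eq = refl
  before-next p (y ∷ v) zero (suc (suc j)) ()
  before-next p (y ∷ v) (suc i) (suc j) eq = before-next (y ∷ p) v i j (suc-injective eq)

predecessor : ∀ {m} (j : Fin m) → toℕ j ≡ 0 ⊎ ∃[ i ] i ⋖ j
predecessor zero          = inj₁ refl
predecessor (suc zero)    = inj₂ (zero , refl)
predecessor (suc (suc j)) with predecessor (suc j)
... | inj₂ (i , eq) = inj₂ (suc i , cong suc eq)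

letters : ∀ {n m} → Vec (Fin n) m → Vec ℕ m
letters = Vec.map (suc ∘ toℕ)

-- The word of a sequence of values.  The values of Fin n start at 0, but positive
-- letters are wanted.
wordOf : ∀ {n m} → Vec (Fin n) m → List ℕ
wordOf v = toList (letters v)

rminW-countFin : ∀ {n m} (v : Vec (Fin n) m) →
  rminW (wordOf v) ≡ countFin (λ j → allAbove (suc (toℕ (lookup v j))) (after (letters v) j))
rminW-countFin []      = refl
rminW-countFin (y ∷ v) = cong (ind (allAbove (suc (toℕ y)) (wordOf v)) ℕ.+_) (rminW-countFin v)

desW-countFin : ∀ {n m} p (v : Vec (Fin n) m) →
  desW p (wordOf v) ≡ countFin (λ j → lastAbove (before p (letters v) j) (suc (toℕ (lookup v j))))
desW-countFin p []      = refl
desW-countFin p (y ∷ v) = cong (ind _ ℕ.+_) (desW-countFin _ v)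

sillyW-countFin : ∀ {n m} p (v : Vec (Fin n) m) → sillyW p (wordOf v) ≡
  countFin (λ j → lastBelow (before p (letters v) j) (suc (toℕ (lookup v j)))
                ∧ mem (2 ℕ.+ toℕ (lookup v j)) (before p (letters v) j))
sillyW-countFin p []      = refl
sillyW-countFin p (y ∷ v) = cong (ind _ ℕ.+_) (sillyW-countFin _ v)

allAbove-after : ∀ {n m} y (v : Vec (Fin n) m) j →
  (∀ k → j Fin.< k → y ℕ.< toℕ (lookup v k)) ⇔ T (allAbove (suc y) (after (letters v) j))
allAbove-after y v j = mk⇔ (to v j) (from v j)
  where
  toAll : ∀ {n m} (v : Vec (Fin n) m) → (∀ k → y ℕ.< toℕ (lookup v k)) → T (allAbove (suc y) (wordOf v))
  toAll []      h = tt
  toAll (z ∷ v) h = Equivalence.from T-∧ (<⇒<ᵇ (h zero) , toAll v (h ∘ suc))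
  fromAll : ∀ {n m} (v : Vec (Fin n) m) → T (allAbove (suc y) (wordOf v)) → ∀ k → y ℕ.< toℕ (lookup v k)
  fromAll (z ∷ v) t zero    = <ᵇ⇒< _ _ (proj₁ (Equivalence.to T-∧ t))
  fromAll (z ∷ v) t (suc k) = fromAll v (proj₂ (Equivalence.to (T-∧ {y <ᵇ toℕ z}) t)) k
  to : ∀ {n m} (v : Vec (Fin n) m) j → (∀ k → j Fin.< k → y ℕ.< toℕ (lookup v k)) →
    T (allAbove (suc y) (after (letters v) j))
  to (z ∷ v) zero    h = toAll v (λ k → h (suc k) (s≤s z≤n))
  to (z ∷ v) (suc j) h = to v j (λ k lt → h (suc k) (s≤s lt))
  from : ∀ {n m} (v : Vec (Fin n) m) j → T (allAbove (suc y) (after (letters v) j)) →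
    ∀ k → j Fin.< k → y ℕ.< toℕ (lookup v k)
  from (z ∷ v) zero    t (suc k) lt       = fromAll v t k
  from (z ∷ v) (suc j) t (suc k) (s≤s lt) = from v j t k lt

mem-before : ∀ {n m} y p (v : Vec (Fin n) m) j →
  T (mem (suc y) (before p (letters v) j)) ⇔ (T (mem (suc y) p) ⊎ ∃[ k ] (k Fin.< j × toℕ (lookup v k) ≡ y))
mem-before y p v j = mk⇔ (to p v j) (from p v j)
  where
  to : ∀ {n m} p (v : Vec (Fin n) m) j → T (mem (suc y) (before p (letters v) j)) →
    T (mem (suc y) p) ⊎ ∃[ k ] (k Fin.< j × toℕ (lookup v k) ≡ y)
  to p (z ∷ v) zero    t = inj₁ t
  to p (z ∷ v) (suc j) t with to (suc (toℕ z) ∷ p) v j t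
  ... | inj₂ (k , lt , eq) = inj₂ (suc k , s≤s lt , eq)
  ... | inj₁ t with Equivalence.to (T-∨ {y ≡ᵇ toℕ z}) t
  ...   | inj₁ t = inj₂ (zero , s≤s z≤n , sym (≡ᵇ⇒≡ y (toℕ z) t))
  ...   | inj₂ t = inj₁ t
  from : ∀ {n m} p (v : Vec (Fin n) m) j →
    T (mem (suc y) p) ⊎ ∃[ k ] (k Fin.< j × toℕ (lookup v k) ≡ y) → T (mem (suc y) (before p (letters v) j))
  from p (z ∷ v) zero    (inj₁ t) = t
  from p (z ∷ v) (suc j) (inj₁ t) = from _ v j (inj₁ (Equivalence.from (T-∨ {y ≡ᵇ toℕ z}) (inj₂ t)))
  from p (z ∷ v) (suc j) (inj₂ (zero , _ , eq)) =
    from _ v j (inj₁ (Equivalence.from (T-∨ {y ≡ᵇ toℕ z}) (inj₁ (≡⇒≡ᵇ y (toℕ z) (sym eq)))))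
  from p (z ∷ v) (suc j) (inj₂ (suc k , s≤s lt , eq)) = from _ v j (inj₂ (k , lt , eq))

module _ {n} (π : Word n) where

  private
    π⟨_⟩ : Fin n → ℕ
    π⟨ j ⟩ = toℕ (lookup π j)

    before-π : ∀ i j → i ⋖ j → before [] (letters π) j ≡ suc π⟨ i ⟩ ∷ before [] (letters π) i
    before-π i j lt = trans (before-next [] (letters π) i j lt)
      (cong (_∷ before [] (letters π) i) (lookup-map i (suc ∘ toℕ) π))

  rmin-word : rmin π ≡ rminW (wordOf π)
  rmin-word = trans (#-Bool (isRLMin? π) _ (λ j → allAbove-after π⟨ j ⟩ π j)) (sym (rminW-countFin π))

  des-word : des π ≡ desW [] (wordOf π)
  des-word = trans (#-Bool (isDescent? π) _ (λ j → mk⇔ (to j) (from j))) (sym (desW-countFin [] π))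
    where
    to : ∀ j → IsDescent π j → T (lastAbove (before [] (letters π) j) (suc π⟨ j ⟩))
    to j (i , lt , gt) rewrite before-π i j lt = <⇒<ᵇ gt
    from : ∀ j → T (lastAbove (before [] (letters π) j) (suc π⟨ j ⟩)) → IsDescent π j
    from j t with predecessor j
    ... | inj₁ eq rewrite before-first [] (letters π) j eq = ⊥-elim t
    ... | inj₂ (i , lt) rewrite before-π i j lt = i , lt , <ᵇ⇒< _ _ t

  silly-word : pSilly π ≡ sillyW [] (wordOf π)
  silly-word = trans (#-Bool (isSilly? π) _ (λ j → mk⇔ (to j) (from j))) (sym (sillyW-countFin [] π))
    where
    to : ∀ j → IsSilly π j → T (lastBelow (before [] (letters π) j) (suc π⟨ j ⟩)
      ∧ mem (2 ℕ.+ π⟨ j ⟩) (before [] (letters π) j))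
    to j (st , _ , (k , lt , eq)) = Equivalence.from T-∧
      (below-to st , Equivalence.from (mem-before (suc π⟨ j ⟩) [] π j) (inj₂ (k , lt , eq)))
      where
      below-to : toℕ j ≡ 0 ⊎ ∃[ i ] (i ⋖ j × π⟨ i ⟩ ℕ.< π⟨ j ⟩) →
        T (lastBelow (before [] (letters π) j) (suc π⟨ j ⟩))
      below-to (inj₁ eq) rewrite before-first [] (letters π) j eq = tt
      below-to (inj₂ (i , lt , gt)) rewrite before-π i j lt = <⇒<ᵇ gt
    from : ∀ j → T (lastBelow (before [] (letters π) j) (suc π⟨ j ⟩)
      ∧ mem (2 ℕ.+ π⟨ j ⟩) (before [] (letters π) j)) → IsSilly π j
    from j t with Equivalence.to (T-∧ {lastBelow (before [] (letters π) j) (suc π⟨ j ⟩)}) t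
    ... | t₁ , t₂ with Equivalence.to (mem-before (suc π⟨ j ⟩) [] π j) t₂
    ... | inj₂ (k , lt , eq) = below-from (predecessor j) , subst (ℕ._< n) eq (toℕ<n (lookup π k)) , k , lt , eq
      where
      below-from : toℕ j ≡ 0 ⊎ ∃[ i ] i ⋖ j → toℕ j ≡ 0 ⊎ ∃[ i ] (i ⋖ j × π⟨ i ⟩ ℕ.< π⟨ j ⟩)
      below-from (inj₁ eq) = inj₁ eq
      below-from (inj₂ (i , lt)) = inj₂ (i , lt , <ᵇ⇒< _ _
        (subst (λ p → T (lastBelow p (suc π⟨ j ⟩))) (before-π i j lt) t₁))

wordOf-injective : ∀ {n m} (u v : Vec (Fin n) m) → wordOf u ≡ wordOf v → u ≡ v
wordOf-injective []      []      eq = refl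
wordOf-injective (y ∷ u) (z ∷ v) eq = cong₂ _∷_
  (toℕ-injective (suc-injective (∷-injectiveˡ eq))) (wordOf-injective u v (∷-injectiveʳ eq))

count-absent : ∀ {n m} y (v : Vec (Fin n) m) → (∀ j → toℕ (lookup v j) ≢ y) → count (suc y) (wordOf v) ≡ 0
count-absent y []      h = refl
count-absent y (z ∷ v) h with y ≡ᵇ toℕ z in eq
... | true  = ⊥-elim (h zero (sym (≡ᵇ⇒≡ y (toℕ z) (subst T (sym eq) tt))))
... | false = count-absent y v (h ∘ suc)

count-once : ∀ {n m} (v : Vec (Fin n) m) → (∀ i j → lookup v i ≡ lookup v j → i ≡ j) →
  ∀ j → count (suc (toℕ (lookup v j))) (wordOf v) ≡ 1
count-once (z ∷ v) inj zero = trans (count-head (toℕ z) (wordOf v)) (cong suc (count-absent (toℕ z) v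
  (λ k eq → zero≢suc (inj zero (suc k) (sym (toℕ-injective eq))))))
  where
  zero≢suc : ∀ {m} {k : Fin m} → Fin.zero ≢ Fin.suc k
  zero≢suc ()
count-once (z ∷ v) inj (suc j) with toℕ (lookup v j) ≡ᵇ toℕ z in eq
... | true with () ← inj zero (suc j)
      (sym (toℕ-injective (≡ᵇ⇒≡ (toℕ (lookup v j)) (toℕ z) (subst T (sym eq) tt))))
... | false = count-once v (λ i k e → Finₚ.suc-injective (inj (suc i) (suc k) e)) j

occurs : ∀ {n m} (v : Vec (Fin n) m) j → 1 ≤ count (suc (toℕ (lookup v j))) (wordOf v)
occurs (z ∷ v) zero    = subst (1 ≤_) (sym (count-head (toℕ z) (wordOf v))) (s≤s z≤n)
occurs (z ∷ v) (suc j) = ℕₚ.≤-trans (occurs v j) (ℕₚ.m≤n+m _ _)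

repeated : ∀ {n m} z (v : Vec (Fin n) m) j → count (suc (toℕ z)) (wordOf (z ∷ v)) ≤ 1 →
  z ≢ lookup v j
repeated z v j le refl = ℕₚ.<⇒≱ (s≤s (occurs v j)) (subst (_≤ 1) (count-head (toℕ z) (wordOf v)) le)

count-injective : ∀ {n m} (v : Vec (Fin n) m) → (∀ y → count (suc y) (wordOf v) ≤ 1) →
  ∀ i j → lookup v i ≡ lookup v j → i ≡ j
count-injective v h zero zero eq = refl
count-injective (z ∷ v) h zero (suc j) eq = ⊥-elim (repeated z v j (h (toℕ z)) eq)
count-injective (z ∷ v) h (suc i) zero eq = ⊥-elim (repeated z v i (h (toℕ z)) (sym eq))
count-injective (z ∷ v) h (suc i) (suc j) eq =
  cong suc (count-injective v (λ y → ℕₚ.≤-trans (ℕₚ.m≤n+m _ _) (h y)) i j eq)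

count-present : ∀ {n m} y (v : Vec (Fin n) m) → 1 ≤ count (suc y) (wordOf v) → ∃[ j ] toℕ (lookup v j) ≡ y
count-present y (z ∷ v) le with y ≡ᵇ toℕ z in eq
... | true  = zero , sym (≡ᵇ⇒≡ y (toℕ z) (subst T (sym eq) tt))
... | false with j , e ← count-present y v le = suc j , e

<ᵇ-≡true : ∀ {m n} → m ℕ.< n → (m <ᵇ n) ≡ true
<ᵇ-≡true {m} {n} lt with m <ᵇ n | <⇒<ᵇ lt
... | true | _ = refl

<ᵇ-≡false : ∀ {m n} → n ≤ m → (m <ᵇ n) ≡ false
<ᵇ-≡false {m} {n} le with m <ᵇ n in eq
... | true  = ⊥-elim (ℕₚ.<⇒≱ (<ᵇ⇒< m n (subst T (sym eq) tt)) le)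
... | false = refl

permutation-content : ∀ {n} (π : Word n) → IsPermutation π → Content n (wordOf π)
permutation-content {n} π (inj , surj) v with ℕₚ.<-≤-connex v n
... | inj₂ n≤v = trans (count-absent v π (λ j eq → ℕₚ.<⇒≱ (subst (ℕ._< n) eq (toℕ<n (lookup π j))) n≤v))
  (cong ind (sym (<ᵇ-≡false n≤v)))
... | inj₁ v<n with surj (fromℕ< v<n)
...   | j , eq = subst (λ y → count (suc y) (wordOf π) ≡ ind (v <ᵇ n))
  (trans (cong toℕ (eq refl)) (toℕ-fromℕ< v<n))
  (trans (count-once π (λ i k e → inj e) j) (cong ind (sym (<ᵇ-≡true v<n))))

content-permutation : ∀ {n} (π : Word n) → Content n (wordOf π) → IsPermutation π
content-permutation {n} π c =
  (λ {i} {j} → count-injective π (λ y → subst (_≤ 1) (sym (c y)) (ind≤1 (y <ᵇ n))) i j) ,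
  λ v → let j , eq = count-present (toℕ v) π (subst (1 ≤_)
                (sym (trans (c (toℕ v)) (cong ind (<ᵇ-≡true (toℕ<n v))))) (s≤s z≤n))
        in j , λ { refl → toℕ-injective eq }
  where
  ind≤1 : ∀ b → ind b ≤ 1
  ind≤1 true  = s≤s z≤n
  ind≤1 false = z≤n

Fits-letters : ∀ {n m} (v : Vec (Fin n) m) → Fits (dis ∷ []) (wordOf v)
Fits-letters []      = refl
Fits-letters (y ∷ v) = Fits-letters v

letters-of : ∀ {n} u → Fits (dis ∷ []) u → (∀ y → 1 ≤ count (suc y) u → y ℕ.< n) →
  ∀ m → length u ≡ m → ∃[ v ] wordOf {n} {m} v ≡ u
letters-of []          f h zero    refl = [] , refl
letters-of (zero ∷ u)  (_ , ()) h m eq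
letters-of (suc y ∷ u) f h (suc m) eq
  with v , e ← letters-of u f (λ z le → h z (ℕₚ.≤-trans le (ℕₚ.m≤n+m _ _))) m (suc-injective eq) =
  fromℕ< y<n ∷ v , cong₂ _∷_ (cong suc (toℕ-fromℕ< y<n)) e
  where
  y<n = h y (subst (1 ≤_) (sym (count-head y u)) (s≤s z≤n))

-- A permutation is a word with a single gap, whose label is the distinguished
-- one.
𝓢↭gapWords : ∀ n → List.map wordOf (𝓢 n) ↭ gapWords n (dis ∷ [])
𝓢↭gapWords n = bijection⇒↭ wordOf
  (Unique.filter⁺ isPermutation? (words-unique (Unique.allFin⁺ n) n))
  (gapWords-unique n (dis ∷ []))
  (λ {π} {π′} _ _ → wordOf-injective π π′)
  (λ {π} π∈ → gapWords-complete n (dis ∷ []) (Fits-letters π)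
    (permutation-content π (proj₂ (∈-filter⁻ isPermutation? {xs = words (allFin n) n} π∈))))
  onto
  where
  onto : ∀ {u} → u ∈ gapWords n (dis ∷ []) → ∃[ π ] (π ∈ 𝓢 n × wordOf π ≡ u)
  onto {u} u∈ with c ← gapWords-content n (dis ∷ []) u∈
    with letters-of u (gapWords-fits n (dis ∷ []) u∈) (λ y le → bounded y (subst (1 ≤_) (c y) le)) n
           (suc-injective (trans (gapWords-length n (dis ∷ []) u∈) (ℕₚ.+-comm n 1)))
    where
    bounded : ∀ y → 1 ≤ ind (y <ᵇ n) → y ℕ.< n
    bounded y le with y <ᵇ n in eq
    ... | true = <ᵇ⇒< y n (subst T (sym eq) tt)
  ... | π , refl = π , ∈-filter⁺ isPermutation? (∈-words ∈-allFin π) (content-permutation π c) , refl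

module PermutationSum {c ℓ} (R : CommutativeSemiring c ℓ) (s x w : CommutativeSemiring.Carrier R) where
  open CommutativeSemiring R hiding (zero; _+_) renaming (refl to ≈-refl; sym to ≈-sym; trans to ≈-trans)
  open Sums R
  open SumLemmas R
  open StatePolynomial R s x w
  open GapWordSum R s x w
  open import Relation.Binary.Reasoning.Setoid setoid

  permutation-sum : ∀ n →
    (∑[ π ∈ 𝓢 n ] (s ^ rmin π * x ^ pSilly π * w ^ des π)) ≈ F besideBar n [] (dis ∷ [])
  permutation-sum n = begin
    (∑[ π ∈ 𝓢 n ] (s ^ rmin π * x ^ pSilly π * w ^ des π))
      ≈⟨ sum-cong {xs = 𝓢 n} (λ {π} _ → ≈-trans (reflexive (cong₂ _*_ (cong₂ (λ a b → s ^ a * x ^ b)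
           (rmin-word π) (silly-word π)) (cong (w ^_) (des-word π)))) (≈-sym (*-identityˡ _))) ⟩
    sumOver (𝓢 n) (f ∘ wordOf)       ≈⟨ sum-map wordOf (𝓢 n) f ⟨
    sumOver (List.map wordOf (𝓢 n)) f ≈⟨ sum-↭ f (𝓢↭gapWords n) ⟩
    sumOver (gapWords n (dis ∷ [])) f        ≈⟨ gapWords-sum n [] (dis ∷ []) refl ⟩
    F besideBar n [] (dis ∷ []) ∎
    where
    f : List ℕ → Carrier
    f u = x ^ ind (left1 0 u) * weightW u

-- Codes of matchings

-- The choices of a history of the process for matchings: in each step the number of
-- the chosen label, counted from 0, and whether a bar follows.
Code : ℕ → Set
Code n = Vec (ℕ × Bool) n

module _ {n} (w : Code n) where

  label : Fin n → ℕ
  label i = proj₁ (lookup w i)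

  flag : Fin n → Bool
  flag i = proj₂ (lookup w i)

-- For matchings: a bar adds an obliged label at the end of the row.
topBar : Insertion
topBar α y β = (α ++ use y ∷ β) ++ [ obl ]

topBar-admissible : Admissible topBar
topBar-admissible α y β = ↭-sym (∷↭∷ʳ obl (α ++ use y ∷ β))

-- The codes of all histories of N steps from the row τ that leave no obligation.
codes : ∀ N → List Status → List (Code N)
-- The codes whose first step chooses y, without or with a bar.
extended : ∀ N → List Status → Status → List Status → List (Code (suc N))

codes zero    τ = if hasObl τ then [] else [ [] ]
codes (suc N) τ = pickConcat (extended N) τ

extended N α y β = List.map ((length α , false) ∷_) (codes N (α ++ use y ∷ β))
                ++ List.map ((length α , true) ∷_) (codes N (topBar α y β))

codes-unique : ∀ N τ → Unique (codes N τ)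
codes-unique zero τ with hasObl τ
... | true  = []
... | false = [] ∷ []
codes-unique (suc N) τ = Unique-pickConcat (λ w → label w zero) (extended N) τ
  (λ α y β _ → Unique.++⁺ (Unique.map⁺ Vecₚ.∷-injectiveʳ (codes-unique N _))
    (Unique.map⁺ Vecₚ.∷-injectiveʳ (codes-unique N _)) (λ (p , q) → disjoint α y β p q))
  0 (λ α y β _ → first α y β)
  where
  disjoint : ∀ α y β {w} → w ∈ List.map ((length α , false) ∷_) (codes N (α ++ use y ∷ β)) →
    w ∈ List.map ((length α , true) ∷_) (codes N (topBar α y β)) → ⊥
  disjoint α y β p q with ∈-map⁻ _ p | ∈-map⁻ _ q
  ... | _ , _ , refl | _ , _ , ()
  first : ∀ α y β {w} → w ∈ extended N α y β → label w zero ≡ length α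
  first α y β p with ∈-++⁻ (List.map ((length α , false) ∷_) (codes N (α ++ use y ∷ β))) p
  ... | inj₁ q with _ , _ , refl ← ∈-map⁻ _ q = refl
  ... | inj₂ q with _ , _ , refl ← ∈-map⁻ _ q = refl

-- The number of choices of the first label.
zeroLabels : ∀ {n} → Code n → ℕ
zeroLabels []            = 0
zeroLabels ((c , b) ∷ w) = ind (c ≡ᵇ 0) ℕ.+ zeroLabels w

-- The labels below the threshold of a step are those whose choice in the next
-- step gives a factor x.
threshold : ℕ × Bool → ℕ
threshold (c , b) = if b then 0 else c

-- The number of choices below the threshold, which is l at the beginning.
falls : ∀ {n} → ℕ → Code n → ℕ
falls l []            = 0
falls l ((c , b) ∷ w) = ind (c <ᵇ l) ℕ.+ falls (threshold (c , b)) w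

bars : ∀ {n} → Code n → ℕ
bars []            = 0
bars ((c , b) ∷ w) = ind b ℕ.+ bars w

-- The number of bars drawn before step i.
barsBefore : ∀ {n} → Code n → Fin n → ℕ
barsBefore ((c , b) ∷ w) zero    = 0
barsBefore ((c , b) ∷ w) (suc i) = ind b ℕ.+ barsBefore w i

-- The label with number l exists and is obliged.
OblAt : List Status → ℕ → Set
OblAt []      l       = ⊥
OblAt (t ∷ τ) zero    = t ≡ obl
OblAt (t ∷ τ) (suc l) = OblAt τ l

use-≢-obl : ∀ t → use t ≢ obl
use-≢-obl obl ()
use-≢-obl fre ()
use-≢-obl dis ()

OblAt-use : ∀ α y β l → OblAt (α ++ y ∷ β) l → l ≡ length α ⊎ OblAt (α ++ use y ∷ β) l
OblAt-use []      y β zero    o = inj₁ refl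
OblAt-use []      y β (suc l) o = inj₂ o
OblAt-use (a ∷ α) y β zero    o = inj₂ o
OblAt-use (a ∷ α) y β (suc l) o with OblAt-use α y β l o
... | inj₁ eq = inj₁ (cong suc eq)
... | inj₂ o′ = inj₂ o′

OblAt-unuse : ∀ α y β l → OblAt (α ++ use y ∷ β) l → OblAt (α ++ y ∷ β) l × l ≢ length α
OblAt-unuse []      y β zero    o = ⊥-elim (use-≢-obl y o)
OblAt-unuse []      y β (suc l) o = o , λ ()
OblAt-unuse (a ∷ α) y β zero    o = o , λ ()
OblAt-unuse (a ∷ α) y β (suc l) o with o′ , ne ← OblAt-unuse α y β l o = o′ , ne ∘ suc-injective

OblAt-snoc : ∀ τ l → OblAt (τ ++ [ obl ]) l → OblAt τ l ⊎ l ≡ length τ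
OblAt-snoc []      zero    o = inj₂ refl
OblAt-snoc (t ∷ τ) zero    o = inj₁ o
OblAt-snoc (t ∷ τ) (suc l) o with OblAt-snoc τ l o
... | inj₁ o′ = inj₁ o′
... | inj₂ eq = inj₂ (cong suc eq)

OblAt-++ : ∀ τ {σ} l → OblAt τ l → OblAt (τ ++ σ) l
OblAt-++ (t ∷ τ) zero    o = o
OblAt-++ (t ∷ τ) (suc l) o = OblAt-++ τ l o

OblAt-last : ∀ τ → OblAt (τ ++ [ obl ]) (length τ)
OblAt-last []      = refl
OblAt-last (t ∷ τ) = OblAt-last τ

OblAt-< : ∀ τ l → OblAt τ l → l < length τ
OblAt-< (t ∷ τ) zero    o = s≤s z≤n
OblAt-< (t ∷ τ) (suc l) o = s≤s (OblAt-< τ l o)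

hasObl-false : ∀ τ l → hasObl τ ≡ false → OblAt τ l → ⊥
hasObl-false (t ∷ τ)   zero    h refl with () ← h
hasObl-false (fre ∷ τ) (suc l) h o = hasObl-false τ l h o
hasObl-false (dis ∷ τ) (suc l) h o = hasObl-false τ l h o

hasObl-none : ∀ τ → (∀ l → OblAt τ l → ⊥) → hasObl τ ≡ false
hasObl-none []        h = refl
hasObl-none (obl ∷ τ) h = ⊥-elim (h 0 refl)
hasObl-none (fre ∷ τ) h = hasObl-none τ (h ∘ suc)
hasObl-none (dis ∷ τ) h = hasObl-none τ (h ∘ suc)

-- The code of a history from τ that leaves no obligation: every chosen label
-- exists at its time, and every label that is obliged, at the start or since its
-- creation, is chosen eventually.
record Valid {n} (τ : List Status) (w : Code n) : Set where
  field
    label-<    : ∀ i → label w i < length τ ℕ.+ barsBefore w i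
    obl-used   : ∀ l → OblAt τ l → ∃[ i ] label w i ≡ l
    fresh-used : ∀ l → length τ ≤ l → l < length τ ℕ.+ bars w → ∃[ i ] label w i ≡ l
open Valid public

length-use : ∀ α y β → length (α ++ use y ∷ β) ≡ length (α ++ y ∷ β)
length-use []      y β = refl
length-use (a ∷ α) y β = cong suc (length-use α y β)

length-topBar : ∀ α y β → length (topBar α y β) ≡ suc (length (α ++ y ∷ β))
length-topBar α y β = trans (length-++ (α ++ use y ∷ β))
  (trans (ℕₚ.+-comm _ 1) (cong suc (length-use α y β)))

length-mid : ∀ (α : List Status) y β → length α < length (α ++ y ∷ β)
length-mid []      y β = s≤s z≤n
length-mid (a ∷ α) y β = s≤s (length-mid α y β)

module _ {N} (w : Code N) (α : List Status) (y : Status) (β : List Status) where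

  private
    τ = α ++ y ∷ β
    used = α ++ use y ∷ β
    c = length α

  Valid-unbarred : Valid used w → Valid τ ((c , false) ∷ w)
  Valid-unbarred v .label-< zero = ℕₚ.≤-trans (length-mid α y β) (ℕₚ.m≤m+n _ 0)
  Valid-unbarred v .label-< (suc i) =
    subst (λ m → label w i < m ℕ.+ barsBefore w i) (length-use α y β) (label-< v i)
  Valid-unbarred v .obl-used l o with OblAt-use α y β l o
  ... | inj₁ eq = zero , sym eq
  ... | inj₂ o′ with i , eq ← obl-used v l o′ = suc i , eq
  Valid-unbarred v .fresh-used l ge lt
    with i , eq ← fresh-used v l (subst (_≤ l) (sym (length-use α y β)) ge)
                    (subst (λ m → l < m ℕ.+ bars w) (sym (length-use α y β)) lt) = suc i , eq

  Valid-barred : Valid (topBar α y β) w → Valid τ ((c , true) ∷ w)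
  Valid-barred v .label-< zero = ℕₚ.≤-trans (length-mid α y β) (ℕₚ.m≤m+n _ 0)
  Valid-barred v .label-< (suc i) = subst (label w i <_)
    (trans (cong (ℕ._+ barsBefore w i) (length-topBar α y β)) (sym (ℕₚ.+-suc _ _))) (label-< v i)
  Valid-barred v .obl-used l o with OblAt-use α y β l o
  ... | inj₁ eq = zero , sym eq
  ... | inj₂ o′ with i , eq ← obl-used v l (OblAt-++ used l o′) = suc i , eq
  Valid-barred v .fresh-used l ge lt with ℕₚ.m≤n⇒m<n∨m≡n ge
  ... | inj₂ refl with i , eq ← obl-used v l (subst (OblAt (topBar α y β)) (length-use α y β) (OblAt-last used)) =
    suc i , eq
  ... | inj₁ gt with i , eq ← fresh-used v l (subst (_≤ l) (sym (length-topBar α y β)) gt)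
                    (subst (l <_) (trans (ℕₚ.+-suc _ _) (cong (ℕ._+ bars w) (sym (length-topBar α y β)))) lt) =
    suc i , eq

  private
    tail : ∀ {b l} → l ≢ c → ∃[ i ] label ((c , b) ∷ w) i ≡ l → ∃[ i ] label w i ≡ l
    tail ne (zero  , eq) = ⊥-elim (ne (sym eq))
    tail ne (suc i , eq) = i , eq

    ≥⇒≢ : ∀ {l} → length τ ≤ l → l ≢ c
    ≥⇒≢ ge refl = ℕₚ.<⇒≱ (length-mid α y β) ge

  Valid-unbarred⁻ : Valid τ ((c , false) ∷ w) → Valid used w
  Valid-unbarred⁻ v .label-< i =
    subst (λ m → label w i < m ℕ.+ barsBefore w i) (sym (length-use α y β)) (label-< v (suc i))
  Valid-unbarred⁻ v .obl-used l o with o′ , ne ← OblAt-unuse α y β l o = tail ne (obl-used v l o′)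
  Valid-unbarred⁻ v .fresh-used l ge lt = tail (≥⇒≢ ge′)
    (fresh-used v l ge′ (subst (λ m → l < m ℕ.+ bars w) (length-use α y β) lt))
    where ge′ = subst (_≤ l) (length-use α y β) ge

  Valid-barred⁻ : Valid τ ((c , true) ∷ w) → Valid (topBar α y β) w
  Valid-barred⁻ v .label-< i = subst (label w i <_)
    (trans (ℕₚ.+-suc _ _) (cong (ℕ._+ barsBefore w i) (sym (length-topBar α y β)))) (label-< v (suc i))
  Valid-barred⁻ v .obl-used l o with OblAt-snoc used l o
  ... | inj₁ o′ with o″ , ne ← OblAt-unuse α y β l o′ = tail ne (obl-used v l o″)
  ... | inj₂ eq = tail (≥⇒≢ ge) (fresh-used v l ge
        (subst (_< length τ ℕ.+ suc (bars w)) (sym eq′) (ℕₚ.m<m+n (length τ) (s≤s z≤n))))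
    where
    eq′ = trans eq (length-use α y β)
    ge = ℕₚ.≤-reflexive (sym eq′)
  Valid-barred⁻ v .fresh-used l ge lt = tail (≥⇒≢ ge′)
    (fresh-used v l ge′ (subst (l <_) (trans (cong (ℕ._+ bars w) (length-topBar α y β)) (sym (ℕₚ.+-suc _ _))) lt))
    where ge′ = ℕₚ.≤-trans (ℕₚ.n≤1+n _) (subst (_≤ l) (length-topBar α y β) ge)

codes-valid : ∀ N τ {w} → w ∈ codes N τ → Valid τ w
codes-valid zero τ w∈ with hasObl τ in eq | w∈
... | false | here refl = λ where
  .label-< ()
  .obl-used l o → ⊥-elim (hasObl-false τ l eq o)
  .fresh-used l ge lt → ⊥-elim (ℕₚ.<⇒≱ lt (subst (_≤ l) (sym (ℕₚ.+-identityʳ _)) ge))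
codes-valid (suc N) τ w∈ with ∈-pickConcat⁻ (extended N) τ w∈
... | α , y , β , refl , w∈′ with ∈-++⁻ (List.map ((length α , false) ∷_) (codes N (α ++ use y ∷ β))) w∈′
... | inj₁ q with w , w∈ , refl ← ∈-map⁻ _ q = Valid-unbarred w α y β (codes-valid N _ w∈)
... | inj₂ q with w , w∈ , refl ← ∈-map⁻ _ q = Valid-barred w α y β (codes-valid N _ w∈)

split-at : ∀ (τ : List Status) c → c < length τ → ∃[ α ] ∃[ y ] ∃[ β ] (τ ≡ α ++ y ∷ β × length α ≡ c)
split-at (t ∷ τ) zero    lt = [] , t , τ , refl , refl
split-at (t ∷ τ) (suc c) (s≤s lt) with α , y , β , eq , eq′ ← split-at τ c lt =
  t ∷ α , y , β , cong (t ∷_) eq , cong suc eq′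

codes-complete : ∀ {N} τ (w : Code N) → Valid τ w → w ∈ codes N τ
codes-complete τ [] v with hasObl-none τ (λ l o → absent (obl-used v l o))
  where
  absent : ∀ {l} → ∃[ i ] label [] i ≡ l → ⊥
  absent (() , _)
... | eq rewrite eq = here refl
codes-complete τ ((c , b) ∷ w) v
  with split-at τ c (subst (c <_) (ℕₚ.+-identityʳ _) (label-< v zero))
... | α , y , β , refl , refl = ∈-pickConcat⁺ (extended _) α (go b v)
  where
  go : ∀ b → Valid (α ++ y ∷ β) ((c , b) ∷ w) → ((c , b) ∷ w) ∈ extended _ α y β
  go false v = ∈-++⁺ˡ (∈-map⁺ _ (codes-complete _ w (Valid-unbarred⁻ w α y β v)))
  go true  v = ∈-++⁺ʳ _ (∈-map⁺ _ (codes-complete _ w (Valid-barred⁻ w α y β v)))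

-- The first label, and no other, is distinguished.
DisFirst : List Status → Set
DisFirst []      = ⊥
DisFirst (t ∷ τ) = t ≡ dis × All (_≢ dis) τ

All-use : ∀ α y β → All (_≢ dis) (α ++ y ∷ β) → All (_≢ dis) (α ++ use y ∷ β)
All-use []      y β (h ∷ a) = use-≢ h ∷ a
All-use (_ ∷ α) y β (h ∷ a) = h ∷ All-use α y β a

DisFirst-use : ∀ α y β → DisFirst (α ++ y ∷ β) → DisFirst (α ++ use y ∷ β)
DisFirst-use []      y β (refl , a) = refl , a
DisFirst-use (_ ∷ α) y β (h , a) = h , All-use α y β a

DisFirst-snoc : ∀ τ → DisFirst τ → DisFirst (τ ++ [ obl ])
DisFirst-snoc (t ∷ τ) (h , a) = h , Allₚ.++⁺ a ((λ ()) ∷ [])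

module CodeSum {c ℓ} (R : CommutativeSemiring c ℓ) (s x w : CommutativeSemiring.Carrier R) where
  open CommutativeSemiring R hiding (zero) renaming (refl to ≈-refl; sym to ≈-sym; trans to ≈-trans)
  open Sums R
  open SumLemmas R
  open StatePolynomial R s x w
  open import Algebra.Properties.Semiring.Exp semiring using (^-homo-*)
  open import Algebra.Solver.Ring.NaturalCoefficients.Default R
    using (solve; _:=_; _:+_; _:*_)
  open import Relation.Binary.Reasoning.Setoid setoid

  -- The monomial of a code, for the initial threshold l.
  weightC : ∀ {n} → ℕ → Code n → Carrier
  weightC l v = s ^ zeroLabels v * x ^ falls l v * w ^ bars v

  wt-first : ∀ α y β → DisFirst (α ++ y ∷ β) → s ^ ind (length α ≡ᵇ 0) ≈ wt y
  wt-first []      .dis β (refl , _) = *-identityʳ s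
  wt-first (a ∷ α) y β (_ , h) = not-dis y (All.head (Allₚ.++⁻ʳ α h))
    where
    not-dis : ∀ y → y ≢ dis → 1# ≈ wt y
    not-dis obl _ = ≈-refl
    not-dis fre _ = ≈-refl
    not-dis dis h = ⊥-elim (h refl)

  codes-sum : ∀ N lo hi → DisFirst (lo ++ hi) →
    sumOver (codes N (lo ++ hi)) (weightC (length lo)) ≈ F topBar N lo hi

  extended-sum : ∀ N l α y β → DisFirst (α ++ y ∷ β) →
    sumOver (extended N α y β) (weightC l)
      ≈ x ^ ind (length α <ᵇ l) * Kernel topBar (F topBar N) α y β
  extended-sum N l α y β d = begin
    sumOver (extended N α y β) (weightC l)
      ≈⟨ sum-++ (List.map ((c′ , false) ∷_) X) (List.map ((c′ , true) ∷_) Y) (weightC l) ⟩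
    sumOver (List.map ((c′ , false) ∷_) X) (weightC l)
      + sumOver (List.map ((c′ , true) ∷_) Y) (weightC l)
      ≈⟨ +-cong (≈-trans (sum-map _ X _) (≈-trans (sum-cong {xs = X} (λ {v} _ → weigh false v)) (sum-* _ X (weightC c′))))
                (≈-trans (sum-map _ Y _) (≈-trans (sum-cong {xs = Y} (λ {v} _ → weigh true v)) (sum-* _ Y (weightC 0)))) ⟩
    a * w ^ 0 * sumOver X (weightC c′) + a * w ^ 1 * sumOver Y (weightC 0)
      ≈⟨ +-cong (*-congˡ (codes-sum N α (use y ∷ β) (DisFirst-use α y β d)))
                (*-congˡ (codes-sum N [] (topBar α y β) (DisFirst-snoc _ (DisFirst-use α y β d)))) ⟩
    a * w ^ 0 * F topBar N α (use y ∷ β) + a * w ^ 1 * F topBar N [] (topBar α y β)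
      ≈⟨ +-cong (*-congʳ (*-identityʳ a)) (*-congʳ (*-congˡ (*-identityʳ w))) ⟩
    a * F topBar N α (use y ∷ β) + a * w * F topBar N [] (topBar α y β)
      ≈⟨ solve 5 (λ e t w f g → (e :* t) :* f :+ (e :* t) :* w :* g := e :* (t :* (f :+ w :* g)))
           ≈-refl _ _ _ _ _ ⟩
    x ^ ind (c′ <ᵇ l) * Kernel topBar (F topBar N) α y β ∎
    where
    c′ = length α
    X = codes N (α ++ use y ∷ β)
    Y = codes N (topBar α y β)
    a = x ^ ind (c′ <ᵇ l) * wt y
    weigh : ∀ b (v : Code N) → weightC l ((c′ , b) ∷ v) ≈ a * w ^ ind b * weightC (threshold (c′ , b)) v
    weigh b v = begin
      s ^ (ind (c′ ≡ᵇ 0) ℕ.+ zeroLabels v) * x ^ (ind (c′ <ᵇ l) ℕ.+ falls t v) * w ^ (ind b ℕ.+ bars v)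
        ≈⟨ *-cong (*-cong (^-homo-* s (ind (c′ ≡ᵇ 0)) (zeroLabels v))
             (^-homo-* x (ind (c′ <ᵇ l)) (falls t v))) (^-homo-* w (ind b) (bars v)) ⟩
      (s ^ ind (c′ ≡ᵇ 0) * s ^ zeroLabels v) * (x ^ ind (c′ <ᵇ l) * x ^ falls t v) * (w ^ ind b * w ^ bars v)
        ≈⟨ solve 6 (λ s₁ s₂ x₁ x₂ w₁ w₂ → (s₁ :* s₂) :* (x₁ :* x₂) :* (w₁ :* w₂)
             := x₁ :* s₁ :* w₁ :* (s₂ :* x₂ :* w₂)) ≈-refl _ _ _ _ _ _ ⟩
      x ^ ind (c′ <ᵇ l) * s ^ ind (c′ ≡ᵇ 0) * w ^ ind b * weightC t v
        ≈⟨ *-congʳ (*-congʳ (*-congˡ (wt-first α y β d))) ⟩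
      a * w ^ ind b * weightC t v ∎
      where t = threshold (c′ , b)

  codes-sum zero lo hi d with hasObl (lo ++ hi)
  ... | true  = ≈-refl
  ... | false = ≈-trans (+-identityʳ _) (≈-trans (*-identityʳ _) (*-identityʳ _))
  codes-sum (suc N) lo hi d = begin
    sumOver (pickConcat (extended N) (lo ++ hi)) f
      ≈⟨ sum-pickConcat R s x w (extended N) (lo ++ hi) f ⟩
    pickSum (λ α y β → sumOver (extended N α y β) f) (lo ++ hi)
      ≈⟨ pickSum-++ _ lo hi ⟩
    pickSum (λ α y β → sumOver (extended N α y (β ++ hi)) f) lo
      + pickSum (λ α y β → sumOver (extended N (lo ++ α) y β) f) hi
      ≈⟨ +-cong
           (≈-trans (pickSum-cong-at lo λ { α y β refl → ≈-trans
               (extended-sum N l α y (β ++ hi) (subst DisFirst (++-assoc α (y ∷ β) hi) d))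
               (*-congʳ (≈-trans (reflexive (cong (λ b → x ^ ind b) (<ᵇ-true α y β)))
                 (*-identityʳ x))) })
             (pickSum-* x _ lo))
           (pickSum-cong-at hi λ { α y β refl → ≈-trans
               (extended-sum N l (lo ++ α) y β (subst DisFirst (sym (++-assoc lo α (y ∷ β))) d))
               (≈-trans (*-congʳ (reflexive (cong (λ b → x ^ ind b) (<ᵇ-false lo α))))
                 (*-identityˡ _)) }) ⟩
    step topBar (F topBar N) lo hi ∎
    where
    l = length lo
    f = weightC l

-- Layouts of openers and closers

countFin-⇔ : ∀ {n} {p q : Fin n → Bool} → (∀ i → T (p i) ⇔ T (q i)) → countFin p ≡ countFin q
countFin-⇔ {p = p} {q} h = countFin-cong (λ i → does-⇔ (h i) (T? (p i)) (T? (q i)))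

ind-mono : ∀ {b b′} → (T b → T b′) → ind b ≤ ind b′
ind-mono {false} h = z≤n
ind-mono {true} {true}  h = s≤s z≤n
ind-mono {true} {false} h = ⊥-elim (h tt)

countFin-≤ : ∀ {n} {p q : Fin n → Bool} → (∀ i → T (p i) → T (q i)) → countFin p ≤ countFin q
countFin-≤ {zero}  h = z≤n
countFin-≤ {suc n} h = ℕₚ.+-mono-≤ (ind-mono (h zero)) (countFin-≤ (h ∘ suc))

countFin-< : ∀ {n} {p q : Fin n → Bool} → (∀ i → T (p i) → T (q i)) →
  ∀ i → T (q i) → ¬ T (p i) → countFin p < countFin q
countFin-< {p = p} {q} h zero tq ¬tp with p zero | q zero
... | true  | _    = ⊥-elim (¬tp tt)
... | false | true = s≤s (countFin-≤ (h ∘ suc))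
countFin-< h (suc i) tq ¬tp = ℕₚ.+-mono-≤-< (ind-mono (h zero)) (countFin-< (h ∘ suc) i tq ¬tp)

countFin-≤n : ∀ {n} (p : Fin n → Bool) → countFin p ≤ n
countFin-≤n {zero}  p = z≤n
countFin-≤n {suc n} p = ℕₚ.+-mono-≤ (ind-mono {p zero} {true} (λ _ → tt)) (countFin-≤n (p ∘ suc))

countFin-<n : ∀ {n} (p : Fin n → Bool) i → ¬ T (p i) → countFin p < n
countFin-<n p i ¬t = ℕₚ.<-≤-trans (countFin-< {q = λ _ → true} (λ _ _ → tt) i tt ¬t) (countFin-≤n _)

countFin-+ : ∀ {n} {p q r : Fin n → Bool} → (∀ i → ind (p i) ℕ.+ ind (q i) ≡ ind (r i)) →
  countFin p ℕ.+ countFin q ≡ countFin r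
countFin-+ {zero}  h = refl
countFin-+ {suc n} {p} {q} {r} h =
  trans (interchange (ind (p zero)) _ (ind (q zero)) _) (cong₂ ℕ._+_ (h zero) (countFin-+ (h ∘ suc)))
  where
  interchange : ∀ a b c d → (a ℕ.+ b) ℕ.+ (c ℕ.+ d) ≡ (a ℕ.+ c) ℕ.+ (b ℕ.+ d)
  interchange a b c d = begin
    (a ℕ.+ b) ℕ.+ (c ℕ.+ d) ≡⟨ ℕₚ.+-assoc a b (c ℕ.+ d) ⟩
    a ℕ.+ (b ℕ.+ (c ℕ.+ d)) ≡⟨ cong (a ℕ.+_) (ℕₚ.+-assoc b c d) ⟨
    a ℕ.+ ((b ℕ.+ c) ℕ.+ d) ≡⟨ cong (λ m → a ℕ.+ (m ℕ.+ d)) (ℕₚ.+-comm b c) ⟩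
    a ℕ.+ ((c ℕ.+ b) ℕ.+ d) ≡⟨ cong (a ℕ.+_) (ℕₚ.+-assoc c b d) ⟩
    a ℕ.+ (c ℕ.+ (b ℕ.+ d)) ≡⟨ ℕₚ.+-assoc a c (b ℕ.+ d) ⟨
    (a ℕ.+ c) ℕ.+ (b ℕ.+ d) ∎
    where open ≡-Reasoning

countFin-none : ∀ n → countFin {n} (λ _ → false) ≡ 0
countFin-none zero    = refl
countFin-none (suc n) = countFin-none n

countFin-single : ∀ {n} (i : Fin n) → countFin (λ k → does (k ≟ᶠ i)) ≡ 1
countFin-single {suc n} zero = cong suc (countFin-none n)
countFin-single (suc i) = trans (countFin-cong (λ k → does-⇔ (mk⇔ Finₚ.suc-injective (cong suc)) (suc k ≟ᶠ suc i) (k ≟ᶠ i)))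
  (countFin-single i)

barsBefore-countFin : ∀ {n} (w : Code n) i →
  barsBefore w i ≡ countFin (λ k → flag w k ∧ (toℕ k <ᵇ toℕ i))
barsBefore-countFin {suc n} ((c , b) ∷ w) zero = sym (trans
  (countFin-cong {b′ = λ _ → false} (λ k → ∧-zero (flag ((c , b) ∷ w) k))) (countFin-none (suc n)))
  where
  ∧-zero : ∀ b → b ∧ false ≡ false
  ∧-zero true  = refl
  ∧-zero false = refl
barsBefore-countFin ((c , b) ∷ w) (suc i) = cong₂ (λ b m → ind b ℕ.+ m) (∧-one b) (barsBefore-countFin w i)
  where
  ∧-one : ∀ b → b ≡ b ∧ true
  ∧-one true  = refl
  ∧-one false = refl

barsBefore-next : ∀ {n} (w : Code n) i j → i ⋖ j → barsBefore w j ≡ ind (flag w i) ℕ.+ barsBefore w i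
barsBefore-next ((c , b) ∷ (c′ , b′) ∷ w) zero (suc zero) eq = refl
barsBefore-next ((c , b) ∷ w) zero (suc (suc j)) ()
barsBefore-next ((c , b) ∷ w) (suc i) (suc j) eq = begin
  ind b ℕ.+ barsBefore w j ≡⟨ cong (ind b ℕ.+_) (barsBefore-next w i j (suc-injective eq)) ⟩
  ind b ℕ.+ (ind (flag w i) ℕ.+ barsBefore w i) ≡⟨ ℕₚ.+-assoc (ind b) _ _ ⟨
  ind b ℕ.+ ind (flag w i) ℕ.+ barsBefore w i ≡⟨ cong (ℕ._+ barsBefore w i) (ℕₚ.+-comm (ind b) _) ⟩
  ind (flag w i) ℕ.+ ind b ℕ.+ barsBefore w i ≡⟨ ℕₚ.+-assoc (ind (flag w i)) _ _ ⟩
  ind (flag w i) ℕ.+ (ind b ℕ.+ barsBefore w i) ∎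
  where open ≡-Reasoning

barsBefore-mono : ∀ {n} (w : Code n) {i j} → toℕ i ≤ toℕ j → barsBefore w i ≤ barsBefore w j
barsBefore-mono (_ ∷ w) {zero}  {j} le = z≤n
barsBefore-mono ((_ , b) ∷ w) {suc i} {suc j} (s≤s le) = ℕₚ.+-monoʳ-≤ (ind b) (barsBefore-mono w le)

barsBefore-≤-bars : ∀ {n} (w : Code n) i → barsBefore w i ≤ bars w
barsBefore-≤-bars (_ ∷ w) zero = z≤n
barsBefore-≤-bars ((_ , b) ∷ w) (suc i) = ℕₚ.+-monoʳ-≤ (ind b) (barsBefore-≤-bars w i)

barsBefore-<-bars : ∀ {n} (w : Code n) i → T (flag w i) → barsBefore w i < bars w
barsBefore-<-bars ((_ , true) ∷ w) zero t = s≤s z≤n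
barsBefore-<-bars ((_ , b) ∷ w) (suc i) t = ℕₚ.+-monoʳ-< (ind b) (barsBefore-<-bars w i t)

bar-at : ∀ {n} (w : Code n) l → l < bars w → ∃[ k ] (T (flag w k) × barsBefore w k ≡ l)
bar-at ((_ , true)  ∷ w) zero    lt = zero , tt , refl
bar-at ((_ , true)  ∷ w) (suc l) (s≤s lt) with k , t , eq ← bar-at w l lt = suc k , t , cong suc eq
bar-at ((_ , false) ∷ w) l       lt with k , t , eq ← bar-at w l lt = suc k , t , eq

-- The numbers barsBefore at the bars are 0, 1, 2, ..., each attained once.
count-bars-below : ∀ {n} (w : Code n) l → l ≤ bars w →
  countFin (λ k → flag w k ∧ (barsBefore w k <ᵇ l)) ≡ l
count-bars-below []                l       le = sym (ℕₚ.n≤0⇒n≡0 le)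
count-bars-below ((_ , true)  ∷ w) zero    le = count-bars-below-zero w
  where
  count-bars-below-zero : ∀ {n} (w : Code n) → countFin (λ k → flag w k ∧ false) ≡ 0
  count-bars-below-zero []                = refl
  count-bars-below-zero ((_ , true)  ∷ w) = count-bars-below-zero w
  count-bars-below-zero ((_ , false) ∷ w) = count-bars-below-zero w
count-bars-below ((_ , true)  ∷ w) (suc l) (s≤s le) = cong suc (count-bars-below w l le)
count-bars-below ((_ , false) ∷ w) l       le = count-bars-below w l le

successor : ∀ {n} {i k : Fin n} → toℕ i < toℕ k → ∃[ j ] i ⋖ j
successor {i = i} {k} lt = fromℕ< lt′ , toℕ-fromℕ< lt′
  where lt′ = ℕₚ.≤-<-trans lt (toℕ<n k)

positive : ∀ {a b} → a < b → ∃[ x ] b ≡ suc x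
positive (s≤s {n = x} _) = x , refl

-- The openers o i and closers c i of the arcs of a matching of size n, with the
-- arcs numbered by increasing closer.
record Layout {n} (o c : Fin n → ℕ) : Set where
  field
    o<c    : ∀ i → o i < c i
    c-mono : ∀ {i j} → toℕ i < toℕ j → c i < c j
    o≢c    : ∀ i j → o i ≢ c j
    o-inj  : ∀ {i j} → o i ≡ o j → i ≡ j
    c<2n   : ∀ i → c i < 2 ℕ.* n
    cover  : ∀ x → x < 2 ℕ.* n → ∃[ i ] (x ≡ o i ⊎ x ≡ c i)

  c-mono⁻ : ∀ {i j} → c i < c j → toℕ i < toℕ j
  c-mono⁻ {i} {j} lt with <ᶠ-cmp i j
  ... | tri< i<j _ _ = i<j
  ... | tri≈ _ refl _ = ⊥-elim (ℕₚ.<-irrefl refl lt)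
  ... | tri> _ _ j<i = ⊥-elim (ℕₚ.<-asym lt (c-mono j<i))

  c-inj : ∀ {i j} → c i ≡ c j → i ≡ j
  c-inj {i} {j} eq with <ᶠ-cmp i j
  ... | tri< i<j _ _ = ⊥-elim (ℕₚ.<-irrefl eq (c-mono i<j))
  ... | tri≈ _ e _ = e
  ... | tri> _ _ j<i = ⊥-elim (ℕₚ.<-irrefl (sym eq) (c-mono j<i))

  oc-total : ∀ i j → o i < c j ⊎ c j < o i
  oc-total i j with <-cmp (o i) (c j)
  ... | tri< lt _ _ = inj₁ lt
  ... | tri≈ _ eq _ = ⊥-elim (o≢c i j eq)
  ... | tri> _ _ gt = inj₂ gt

-- The order of the openers and closers is the one prescribed by the code: the run
-- of openers with number l comes after exactly l runs of closers, and openers in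
-- one run are ordered as their closers.  Closers need no condition, since they
-- increase in any layout.
record Agrees {n} (o c : Fin n → ℕ) (w : Code n) : Set where
  field
    o<c⇒ : ∀ {i j} → o i < c j → label w i ≤ barsBefore w j
    c<o⇒ : ∀ {i j} → c j < o i → barsBefore w j < label w i
    o<o⇒ : ∀ {i j} → o i < o j → label w i < label w j ⊎ (label w i ≡ label w j × toℕ i < toℕ j)

-- The closer of arc i is followed by an opener.
Break : ∀ {n} → (Fin n → ℕ) → Fin n → Set
Break c i = ∃[ j ] (i ⋖ j × c j ≢ suc (c i))

break? : ∀ {n} (c : Fin n → ℕ) i → Dec (Break c i)
break? c i = any? λ j → (i ⋖? j) ×-dec ¬? (c j ℕₚ.≟ suc (c i))

-- The code w records the breaks, and for each opener the number of breaks before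
-- it.
record Encodes {n} (o c : Fin n → ℕ) (w : Code n) : Set where
  field
    flag-break  : ∀ i → T (flag w i) ⇔ Break c i
    label-count : ∀ i → label w i ≡ countFin (λ k → flag w k ∧ (c k <ᵇ o i))

-- Of two neighbouring openers, the right one is not nested within the left one.
NoLeftNesting : ∀ {n} → (o c : Fin n → ℕ) → Set
NoLeftNesting o c = ∀ {i j} → o i ≡ suc (o j) → ¬ (c i < c j)

-- The only code that the layout encodes.
encode : ∀ {n} → (o c : Fin n → ℕ) → Code n
encode o c = Vec.tabulate (λ i → countFin (λ k → does (break? c k) ∧ (c k <ᵇ o i)) , does (break? c i))

T-does : ∀ {P : Set} (P? : Dec P) → T (does P?) ⇔ P
T-does (yes p) = mk⇔ (λ _ → p) (λ _ → tt)
T-does (no ¬p) = mk⇔ ⊥-elim ¬p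

encode-encodes : ∀ {n} (o c : Fin n → ℕ) → Encodes o c (encode o c)
encode-encodes o c = record
  { flag-break  = λ i → subst (λ b → T b ⇔ Break c i) (sym (flag≡ i)) (T-does (break? c i))
  ; label-count = λ i → trans (cong proj₁ (lookup∘tabulate g i))
      (countFin-cong (λ k → cong (_∧ (c k <ᵇ o i)) (sym (flag≡ k)))) }
  where
  g = λ i → countFin (λ k → does (break? c k) ∧ (c k <ᵇ o i)) , does (break? c i)
  flag≡ : ∀ i → flag (encode o c) i ≡ does (break? c i)
  flag≡ i = cong proj₂ (lookup∘tabulate g i)

encodes-unique : ∀ {n} {o c : Fin n → ℕ} {w} → Encodes o c w → encode o c ≡ w
encodes-unique {o = o} {c} {w} e = trans (tabulate-cong (λ i → cong₂ _,_
    (trans (countFin-cong (λ k → cong (_∧ (c k <ᵇ o i)) (flag≡ k))) (sym (label-count i))) (flag≡ i)))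
  (tabulate∘lookup w)
  where
  open Encodes e
  flag≡ : ∀ i → does (break? c i) ≡ flag w i
  flag≡ i = does-⇔ (mk⇔ (Equivalence.from (flag-break i)) (Equivalence.to (flag-break i)))
    (break? c i) (T? (flag w i))

ind-<suc : ∀ m x → ind (m <ᵇ x) ℕ.+ ind (m ≡ᵇ x) ≡ ind (m <ᵇ suc x)
ind-<suc zero    zero    = refl
ind-<suc zero    (suc x) = refl
ind-<suc (suc m) zero    = refl
ind-<suc (suc m) (suc x) = ind-<suc m x

≡ᵇ-true : ∀ {m n} → m ≡ n → (m ≡ᵇ n) ≡ true
≡ᵇ-true {zero}  refl = refl
≡ᵇ-true {suc m} refl = ≡ᵇ-true {m} refl

≡ᵇ-false : ∀ {m n} → m ≢ n → (m ≡ᵇ n) ≡ false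
≡ᵇ-false {m} {n} ne with m ≡ᵇ n in eq
... | true  = ⊥-elim (ne (≡ᵇ⇒≡ m n (subst T (sym eq) tt)))
... | false = refl

module _ {n} {o c : Fin n → ℕ} (L : Layout o c) where
  open Layout L

  point-at : ∀ {i x} → x ≡ o i ⊎ x ≡ c i → ∀ k →
    ind (o k ≡ᵇ x) ℕ.+ ind (c k ≡ᵇ x) ≡ ind (does (k ≟ᶠ i))
  point-at {i} eq k with k ≟ᶠ i | eq
  ... | yes refl | inj₁ refl = cong₂ (λ a b → ind a ℕ.+ ind b) (≡ᵇ-true {o k} refl) (≡ᵇ-false (o≢c k k ∘ sym))
  ... | yes refl | inj₂ refl = cong₂ (λ a b → ind a ℕ.+ ind b) (≡ᵇ-false (o≢c k k)) (≡ᵇ-true {c k} refl)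
  ... | no k≢i   | inj₁ refl = cong₂ (λ a b → ind a ℕ.+ ind b) (≡ᵇ-false (k≢i ∘ o-inj)) (≡ᵇ-false (o≢c i k ∘ sym))
  ... | no k≢i   | inj₂ refl = cong₂ (λ a b → ind a ℕ.+ ind b) (≡ᵇ-false (o≢c k i)) (≡ᵇ-false (k≢i ∘ c-inj))

  one-at : ∀ x → x < 2 ℕ.* n → countFin (λ k → o k ≡ᵇ x) ℕ.+ countFin (λ k → c k ≡ᵇ x) ≡ 1
  one-at x lt with i , eq ← cover x lt = trans (countFin-+ (point-at eq)) (countFin-single i)

  -- Each x is the number of openers and closers below x.
  rank : ∀ x → x ≤ 2 ℕ.* n → countFin (λ k → o k <ᵇ x) ℕ.+ countFin (λ k → c k <ᵇ x) ≡ x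
  rank zero    le = cong₂ ℕ._+_ (countFin-none n) (countFin-none n)
  rank (suc x) le = begin
    countFin (λ k → o k <ᵇ suc x) ℕ.+ countFin (λ k → c k <ᵇ suc x)
      ≡⟨ cong₂ ℕ._+_ (countFin-+ (λ k → ind-<suc (o k) x)) (countFin-+ (λ k → ind-<suc (c k) x)) ⟨
    (O< ℕ.+ O≡) ℕ.+ (C< ℕ.+ C≡) ≡⟨ ℕₚ.+-assoc O< O≡ _ ⟩
    O< ℕ.+ (O≡ ℕ.+ (C< ℕ.+ C≡)) ≡⟨ cong (O< ℕ.+_) (ℕₚ.+-assoc O≡ C< C≡) ⟨
    O< ℕ.+ ((O≡ ℕ.+ C<) ℕ.+ C≡) ≡⟨ cong (λ m → O< ℕ.+ (m ℕ.+ C≡)) (ℕₚ.+-comm O≡ C<) ⟩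
    O< ℕ.+ ((C< ℕ.+ O≡) ℕ.+ C≡) ≡⟨ cong (O< ℕ.+_) (ℕₚ.+-assoc C< O≡ C≡) ⟩
    O< ℕ.+ (C< ℕ.+ (O≡ ℕ.+ C≡)) ≡⟨ ℕₚ.+-assoc O< C< _ ⟨
    (O< ℕ.+ C<) ℕ.+ (O≡ ℕ.+ C≡) ≡⟨ cong₂ ℕ._+_ (rank x (ℕₚ.<⇒≤ le)) (one-at x le) ⟩
    x ℕ.+ 1 ≡⟨ ℕₚ.+-comm x 1 ⟩
    suc x ∎
    where
    open ≡-Reasoning
    O< O≡ C< C≡ : ℕ
    O< = countFin (λ k → o k <ᵇ x)
    O≡ = countFin (λ k → o k ≡ᵇ x)
    C< = countFin (λ k → c k <ᵇ x)
    C≡ = countFin (λ k → c k ≡ᵇ x)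

  module _ {w : Code n} (A : Agrees o c w) where
    open Agrees A

    ⇒o<c : ∀ {i j} → label w i ≤ barsBefore w j → o i < c j
    ⇒o<c {i} {j} le with oc-total i j
    ... | inj₁ lt = lt
    ... | inj₂ gt = ⊥-elim (ℕₚ.<⇒≱ (c<o⇒ gt) le)

    ⇒c<o : ∀ {i j} → barsBefore w j < label w i → c j < o i
    ⇒c<o {i} {j} lt with oc-total i j
    ... | inj₁ o<c = ⊥-elim (ℕₚ.<⇒≱ lt (o<c⇒ o<c))
    ... | inj₂ gt = gt

    ⇒o<o : ∀ {i j} → label w i < label w j ⊎ (label w i ≡ label w j × toℕ i < toℕ j) → o i < o j
    ⇒o<o {i} {j} lex with <-cmp (o i) (o j)
    ... | tri< lt _ _ = lt
    ... | tri≈ _ eq _ with refl ← o-inj eq = ⊥-elim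
      ([ ℕₚ.<-irrefl refl , (λ (_ , lt) → ℕₚ.<-irrefl refl lt) ]′ lex)
    ... | tri> _ _ gt with lex | o<o⇒ gt
    ...   | inj₁ a        | inj₁ b        = ⊥-elim (ℕₚ.<-asym a b)
    ...   | inj₁ a        | inj₂ (b , _)  = ⊥-elim (ℕₚ.<-irrefl (sym b) a)
    ...   | inj₂ (a , _)  | inj₁ b        = ⊥-elim (ℕₚ.<-irrefl (sym a) b)
    ...   | inj₂ (_ , a)  | inj₂ (_ , b)  = ⊥-elim (ℕₚ.<-asym a b)

<ᵇ-⇔ : ∀ {a b a′ b′} → (a < b → a′ < b′) → (a′ < b′ → a < b) → T (a <ᵇ b) ⇔ T (a′ <ᵇ b′)
<ᵇ-⇔ {a} {b} {a′} {b′} f g = mk⇔ (<⇒<ᵇ ∘ f ∘ <ᵇ⇒< a b) (<⇒<ᵇ ∘ g ∘ <ᵇ⇒< a′ b′)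

module _ {n} {o c o′ c′ : Fin n → ℕ} {w : Code n} (L : Layout o c) (L′ : Layout o′ c′)
  (A : Agrees o c w) (A′ : Agrees o′ c′ w) where

  private
    module L = Layout L
    module L′ = Layout L′
    module A = Agrees A
    module A′ = Agrees A′

  -- Positions are ranks, and ranks depend on the order only.
  layout-determined : ∀ i → o i ≡ o′ i × c i ≡ c′ i
  layout-determined i =
      trans (sym (rank L (o i) (ℕₚ.<⇒≤ (ℕₚ.<-trans (L.o<c i) (L.c<2n i)))))
        (trans (cong₂ ℕ._+_
            (countFin-⇔ {n} λ k → <ᵇ-⇔ (⇒o<o L′ A′ {k} {i} ∘ A.o<o⇒) (⇒o<o L A {k} {i} ∘ A′.o<o⇒))
            (countFin-⇔ {n} λ k → <ᵇ-⇔ (⇒c<o L′ A′ {i} {k} ∘ A.c<o⇒) (⇒c<o L A {i} {k} ∘ A′.c<o⇒)))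
          (rank L′ (o′ i) (ℕₚ.<⇒≤ (ℕₚ.<-trans (L′.o<c i) (L′.c<2n i)))))
    , trans (sym (rank L (c i) (ℕₚ.<⇒≤ (L.c<2n i))))
        (trans (cong₂ ℕ._+_
            (countFin-⇔ {n} λ k → <ᵇ-⇔ (⇒o<c L′ A′ {k} {i} ∘ A.o<c⇒) (⇒o<c L A {k} {i} ∘ A′.o<c⇒))
            (countFin-⇔ {n} λ k → <ᵇ-⇔ (L′.c-mono {k} {i} ∘ L.c-mono⁻) (L.c-mono {k} {i} ∘ L′.c-mono⁻)))
          (rank L′ (c′ i) (ℕₚ.<⇒≤ (L′.c<2n i))))

Layout-resp : ∀ {n} {o c o′ c′ : Fin n → ℕ} → (∀ i → o i ≡ o′ i) → (∀ i → c i ≡ c′ i) →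
  Layout o c → Layout o′ c′
Layout-resp {n} {o} {c} {o′} {c′} o≡ c≡ L = record
  { o<c    = λ i → subst₂ _<_ (o≡ i) (c≡ i) (o<c i)
  ; c-mono = λ {i} {j} lt → subst₂ _<_ (c≡ i) (c≡ j) (c-mono lt)
  ; o≢c    = λ i j eq → o≢c i j (trans (o≡ i) (trans eq (sym (c≡ j))))
  ; o-inj  = λ {i} {j} eq → o-inj (trans (o≡ i) (trans eq (sym (o≡ j))))
  ; c<2n   = λ i → subst (_< 2 ℕ.* n) (c≡ i) (c<2n i)
  ; cover  = λ x lt → let i , eq = cover x lt in i , Sum.map (λ e → trans e (o≡ i)) (λ e → trans e (c≡ i)) eq
  }
  where open Layout L

Agrees-resp : ∀ {n} {o c o′ c′ : Fin n → ℕ} {w} → (∀ i → o i ≡ o′ i) → (∀ i → c i ≡ c′ i) →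
  Agrees o c w → Agrees o′ c′ w
Agrees-resp o≡ c≡ A = record
  { o<c⇒ = λ {i} {j} lt → o<c⇒ (subst₂ _<_ (sym (o≡ i)) (sym (c≡ j)) lt)
  ; c<o⇒ = λ {i} {j} lt → c<o⇒ (subst₂ _<_ (sym (c≡ j)) (sym (o≡ i)) lt)
  ; o<o⇒ = λ {i} {j} lt → o<o⇒ (subst₂ _<_ (sym (o≡ i)) (sym (o≡ j)) lt)
  }
  where open Agrees A

module _ {n} {o c : Fin n → ℕ} (L : Layout o c) (noLN : NoLeftNesting o c)
  {w : Code n} (E : Encodes o c w) where
  open Layout L
  open Encodes E

  private
    T-counted : ∀ {b m x} → T b → m < x → T (b ∧ (m <ᵇ x))
    T-counted t lt = Equivalence.from T-∧ (t , <⇒<ᵇ lt)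

    counted⁻ : ∀ {b m x} → T (b ∧ (m <ᵇ x)) → T b × m < x
    counted⁻ {b} {m} {x} t with t₁ , t₂ ← Equivalence.to (T-∧ {b}) t = t₁ , <ᵇ⇒< m x t₂

  -- Between an earlier closer and an opener there is a break: the last closer before
  -- the opener will do.  The bound d on the distance from j to i makes the recursion
  -- structural.
  break-before : ∀ {i j} → c j < o i → ∃[ k ] (toℕ j ≤ toℕ k × T (flag w k) × c k < o i)
  break-before {i} {j} lt = go (toℕ i) j (ℕₚ.m≤m+n (toℕ i) (toℕ j)) lt
    where
    go : ∀ d j → toℕ i ≤ d ℕ.+ toℕ j → c j < o i → ∃[ k ] (toℕ j ≤ toℕ k × T (flag w k) × c k < o i)
    go d j le lt with successor (c-mono⁻ {j} {i} (ℕₚ.<-trans lt (o<c i)))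
    ... | j′ , eq with oc-total i j′
    ...   | inj₁ o<c′ = j , ℕₚ.≤-refl , Equivalence.from (flag-break j)
              (j′ , eq , λ e → ℕₚ.<⇒≱ lt (ℕ.s≤s⁻¹ (subst (o i <_) e o<c′))) , lt
    go zero    j le lt | j′ , eq | inj₂ gt = ⊥-elim (ℕₚ.<⇒≱ (c-mono⁻ (ℕₚ.<-trans lt (o<c i))) le)
    go (suc d) j le lt | j′ , eq | inj₂ gt
      with k , le′ , t , lt′ ← go d j′ (subst (toℕ i ≤_) (trans (sym (ℕₚ.+-suc d (toℕ j))) (cong (d ℕ.+_) (sym eq))) le) gt =
      k , ℕₚ.≤-trans (ℕₚ.≤-trans (ℕₚ.n≤1+n _) (ℕₚ.≤-reflexive (sym eq))) le′ , t , lt′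

  label-mono : ∀ {i j} → o i < o j → label w i ≤ label w j
  label-mono {i} {j} lt = subst₂ _≤_ (sym (label-count i)) (sym (label-count j))
    (countFin-≤ {n} λ k t → let t₁ , lt′ = counted⁻ t in T-counted t₁ (ℕₚ.<-trans lt′ lt))

  -- Openers separated by a closer belong to different runs.
  label-strict : ∀ {i j k} → o i < c k → c k < o j → label w i < label w j
  label-strict {i} {j} {k} lt lt′ with k′ , le , t , lt″ ← break-before lt′ =
    subst₂ _<_ (sym (label-count i)) (sym (label-count j))
      (countFin-< {n} (λ m t → let t₁ , l = counted⁻ t in T-counted t₁ (ℕₚ.<-trans l (ℕₚ.<-trans lt lt′)))
        k′ (T-counted t lt″) (λ t → ℕₚ.<-asym (proj₂ (counted⁻ t)) (ℕₚ.<-≤-trans lt (c-mono-≤ le))))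
    where
    c-mono-≤ : ∀ {i j} → toℕ i ≤ toℕ j → c i ≤ c j
    c-mono-≤ le with ℕₚ.m≤n⇒m<n∨m≡n le
    ... | inj₁ i<j = ℕₚ.<⇒≤ (c-mono i<j)
    ... | inj₂ i≡j = ℕₚ.≤-reflexive (cong c (toℕ-injective i≡j))

  adjacent-increase : ∀ {i j} → o j ≡ suc (o i) → c i < c j
  adjacent-increase {i} {j} eq with <-cmp (c i) (c j)
  ... | tri< lt _ _ = lt
  ... | tri≈ _ e _ with refl ← c-inj e = ⊥-elim (ℕₚ.<-irrefl eq ℕₚ.≤-refl)
  ... | tri> _ _ gt = ⊥-elim (noLN eq gt)

  -- Within a run, closers increase with openers: the points between two openers of a
  -- run are openers, and without left nestings the closers of neighbours increase.
  run-increase : ∀ {i j} → o i < o j → label w i ≡ label w j → c i < c j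
  run-increase {i} {j} lt = go (o j) j ℕₚ.≤-refl lt
    where
    go : ∀ d j → o j ≤ d → o i < o j → label w i ≡ label w j → c i < c j
    go zero j le lt eq = ⊥-elim (ℕₚ.<⇒≱ lt (ℕₚ.≤-trans le z≤n))
    go (suc d) j le lt eq with x , e ← positive lt
      with ℕ.s≤s⁻¹ (ℕₚ.≤-trans lt (ℕₚ.≤-reflexive e))
         | cover x (ℕₚ.<-trans (ℕₚ.≤-reflexive (sym e)) (ℕₚ.<-trans (o<c j) (c<2n j)))
    ... | le′ | k , inj₂ refl = ⊥-elim (ℕₚ.<-irrefl eq
            (label-strict {k = k} (ℕₚ.≤∧≢⇒< le′ (o≢c i k)) (ℕₚ.≤-reflexive (sym e))))
    ... | le′ | k , inj₁ refl with ℕₚ.m≤n⇒m<n∨m≡n le′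
    ...   | inj₂ oi≡ok with refl ← o-inj oi≡ok = adjacent-increase e
    ...   | inj₁ oi<ok = ℕₚ.<-trans
              (go d k (ℕ.s≤s⁻¹ (ℕₚ.≤-trans (ℕₚ.≤-reflexive (sym e)) le)) oi<ok
                (ℕₚ.≤-antisym (label-mono oi<ok)
                  (ℕₚ.≤-trans (label-mono (ℕₚ.≤-reflexive (sym e))) (ℕₚ.≤-reflexive (sym eq)))))
              (adjacent-increase e)

  encodes-agrees : Agrees o c w
  encodes-agrees = record
    { o<c⇒ = λ {i} {j} lt → subst₂ _≤_ (sym (label-count i)) (sym (barsBefore-countFin w j))
        (countFin-≤ {n} λ k t → let t₁ , lt′ = counted⁻ t in T-counted t₁ (c-mono⁻ (ℕₚ.<-trans lt′ lt)))
    ; c<o⇒ = λ {i} {j} lt → let k , le , t , lt′ = break-before lt in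
        subst₂ _<_ (sym (barsBefore-countFin w j)) (sym (label-count i))
        (countFin-< {n} (λ m t → let t₁ , l = counted⁻ t in T-counted t₁ (ℕₚ.<-trans (c-mono l) lt))
          k (T-counted t lt′) (λ t → ℕₚ.<⇒≱ (proj₂ (counted⁻ t)) le))
    ; o<o⇒ = λ {i} {j} lt → lex lt (ℕₚ.m≤n⇒m<n∨m≡n (label-mono lt))
    }
    where
    lex : ∀ {i j} → o i < o j → label w i < label w j ⊎ label w i ≡ label w j →
      label w i < label w j ⊎ (label w i ≡ label w j × toℕ i < toℕ j)
    lex lt (inj₁ l) = inj₁ l
    lex lt (inj₂ e) = inj₂ (e , c-mono⁻ (run-increase lt e))

  -- The opener that follows a break is the first of the run numbered by that
  -- break.
  encodes-valid : Valid (dis ∷ []) w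
  encodes-valid = record
    { label-<    = λ i → s≤s (A.o<c⇒ (o<c i))
    ; obl-used   = λ { zero () ; (suc l) () }
    ; fresh-used = λ { (suc l) ge (s≤s lt) → fresh (bar-at w l lt) }
    }
    where
    module A = Agrees encodes-agrees
    fresh : ∀ {l} → ∃[ k ] (T (flag w k) × barsBefore w k ≡ l) → ∃[ i ] label w i ≡ suc l
    fresh (k , t , refl) with Equivalence.to (flag-break k) t
    ... | j , eq , ne with cover (suc (c k)) (ℕₚ.≤-<-trans ck<cj (c<2n j))
      where ck<cj = c-mono {k} {j} (ℕₚ.≤-reflexive (sym eq))
    ...   | i , inj₁ e = i , ℕₚ.≤-antisym
              (ℕₚ.≤-trans (A.o<c⇒ {i} {j} (ℕₚ.≤∧≢⇒< (ℕₚ.≤-trans (ℕₚ.≤-reflexive (sym e))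
                  (c-mono {k} {j} (ℕₚ.≤-reflexive (sym eq)))) (o≢c i j)))
                (ℕₚ.≤-trans (ℕₚ.≤-reflexive (barsBefore-next w k j eq))
                  (ℕₚ.+-monoˡ-≤ _ (ind-mono {flag w k} {true} (λ _ → tt)))))
              (A.c<o⇒ {i} {k} (ℕₚ.≤-reflexive e))
    ...   | i , inj₂ e = ⊥-elim (ne (trans (cong c (toℕ-injective (trans eq k+1≡i))) (sym e)))
      where
      k<i : toℕ k < toℕ i
      k<i = c-mono⁻ (ℕₚ.≤-reflexive e)
      ck<cj = c-mono {k} {j} (ℕₚ.≤-reflexive (sym eq))
      k+1≡i : suc (toℕ k) ≡ toℕ i
      k+1≡i with ℕₚ.m≤n⇒m<n∨m≡n k<i
      ... | inj₂ e′ = e′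
      ... | inj₁ lt = ⊥-elim (ℕₚ.<⇒≱ (c-mono {j} {i} (subst (_< toℕ i) (sym eq) lt))
              (ℕₚ.≤-trans (ℕₚ.≤-reflexive (sym e)) ck<cj))

module _ {n} {o c : Fin n → ℕ} (L : Layout o c) {w : Code n} (A : Agrees o c w)
  (V : Valid (dis ∷ []) w) where
  open Layout L
  open Agrees A

  private
    label≤ : ∀ i → label w i ≤ barsBefore w i
    label≤ i = ℕ.s≤s⁻¹ (label-< V i)

  -- If the outer opener of a nested pair is to the left of the inner one, then its
  -- run is an earlier one, and a closer separates the two.
  agrees-noLeftNesting : NoLeftNesting o c
  agrees-noLeftNesting {i} {j} eq lt with o<o⇒ {j} {i} (ℕₚ.≤-reflexive (sym eq))
  ... | inj₂ (_ , j<i) = ℕₚ.<-asym lt (c-mono j<i)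
  ... | inj₁ l with bar-at w (label w j) (ℕₚ.<-≤-trans l (ℕₚ.≤-trans (label≤ i) (barsBefore-≤-bars w i)))
  ...   | k , t , e = ℕₚ.<⇒≱ (⇒o<c L A {j} {k} (ℕₚ.≤-reflexive (sym e)))
            (ℕ.s≤s⁻¹ (ℕₚ.≤-trans (⇒c<o L A {i} {k} (subst (_< label w i) (sym e) l)) (ℕₚ.≤-reflexive eq)))

  agrees-encodes : Encodes o c w
  agrees-encodes = record
    { flag-break  = λ i → mk⇔ (to i) (from i)
    ; label-count = λ i → sym (trans (countFin-⇔ {n} (λ k → ∧-⇔ (flag w k) (<ᵇ-⇔ c<o⇒ (⇒c<o L A))))
        (count-bars-below w (label w i) (ℕₚ.≤-trans (label≤ i) (barsBefore-≤-bars w i)))) }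
    where
    ∧-⇔ : ∀ a {b b′} → T b ⇔ T b′ → T (a ∧ b) ⇔ T (a ∧ b′)
    ∧-⇔ true  h = h
    ∧-⇔ false h = mk⇔ (λ ()) (λ ())
    to : ∀ i → T (flag w i) → Break c i
    to i t with fresh-used V (suc (barsBefore w i)) (s≤s z≤n) (s≤s (barsBefore-<-bars w i t))
    ... | k , e with successor {i = i} {k} i<k
      where
      i<k : toℕ i < toℕ k
      i<k = ℕₚ.≰⇒> λ k≤i → ℕₚ.<⇒≱ (ℕₚ.≤-trans (ℕₚ.≤-reflexive (sym e)) (label≤ k)) (barsBefore-mono w k≤i)
    ...   | j , eq = j , eq , λ cj → ℕₚ.<⇒≱ (⇒c<o L A {k} {i} (ℕₚ.≤-reflexive (sym e)))
              (ℕ.s≤s⁻¹ (subst (o k <_) cj (⇒o<c L A {k} {j} (ℕₚ.≤-reflexive (trans e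
                (sym (trans (barsBefore-next w i j eq) (cong (λ b → ind b ℕ.+ barsBefore w i) (T⇒≡ t)))))))))
      where
      T⇒≡ : ∀ {b} → T b → b ≡ true
      T⇒≡ {true} _ = refl
    from : ∀ i → Break c i → T (flag w i)
    from i (j , eq , ne) with flag w i in fl
    ... | true  = tt
    ... | false with cover (suc (c i)) (ℕₚ.≤-<-trans ci<cj (c<2n j))
      where ci<cj = c-mono {i} {j} (ℕₚ.≤-reflexive (sym eq))
    ...   | k , inj₁ e = ℕₚ.<⇒≱ (c<o⇒ {k} {i} (ℕₚ.≤-reflexive e))
              (ℕₚ.≤-trans (o<c⇒ {k} {j} (subst (_< c j) e sci<cj))
                (ℕₚ.≤-reflexive (trans (barsBefore-next w i j eq) (cong (λ b → ind b ℕ.+ barsBefore w i) fl))))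
      where sci<cj = ℕₚ.≤∧≢⇒< (c-mono {i} {j} (ℕₚ.≤-reflexive (sym eq))) (ne ∘ sym)
    ...   | k , inj₂ e = ℕₚ.<⇒≱ (c-mono⁻ {i} {k} (ℕₚ.≤-reflexive e))
              (ℕ.s≤s⁻¹ (subst (toℕ k <_) eq (c-mono⁻ {k} {j} (subst (_< c j) e sci<cj))))
      where sci<cj = ℕₚ.≤∧≢⇒< (c-mono {i} {j} (ℕₚ.≤-reflexive (sym eq))) (ne ∘ sym)

-- An injective map from a finite set to itself is surjective.
injective⇒hits : ∀ {N} (f : Fin N → Fin N) → Injective _≡_ _≡_ f → ∀ y → ∃[ x ] f x ≡ y
injective⇒hits {suc N} f inj y with any? (λ x → f x ≟ᶠ y)
... | yes hit = hit
... | no miss = ⊥-elim (ℕₚ.<⇒≱ ℕₚ.≤-refl (injective⇒≤ {f = λ x → punchOut (avoids x)}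
        (λ {x} {x′} eq → inj (punchOut-injective (avoids x) (avoids x′) eq))))
  where
  avoids : ∀ x → y ≢ f x
  avoids x eq = miss (x , sym eq)

module _ {n} {w : Code n} (V : Valid (dis ∷ []) w) where

  private
    label≤ : ∀ i → label w i ≤ barsBefore w i
    label≤ i = ℕ.s≤s⁻¹ (label-< V i)

    i<2n : ∀ (i : Fin n) → toℕ i < 2 ℕ.* n
    i<2n i = ℕₚ.<-≤-trans (toℕ<n i) (ℕₚ.m≤m+n n _)

    n+i<2n : ∀ (i : Fin n) → n ℕ.+ toℕ i < 2 ℕ.* n
    n+i<2n i = ℕₚ.+-monoʳ-< n (ℕₚ.<-≤-trans (toℕ<n i) (ℕₚ.≤-reflexive (sym (ℕₚ.+-identityʳ n))))

    digits-< : ∀ {a b r} r′ → a < b → r < 2 ℕ.* n → a ℕ.* (2 ℕ.* n) ℕ.+ r < b ℕ.* (2 ℕ.* n) ℕ.+ r′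
    digits-< {a} {b} {r} r′ lt r< = begin-strict
      a ℕ.* (2 ℕ.* n) ℕ.+ r         <⟨ ℕₚ.+-monoʳ-< (a ℕ.* (2 ℕ.* n)) r< ⟩
      a ℕ.* (2 ℕ.* n) ℕ.+ 2 ℕ.* n     ≡⟨ ℕₚ.+-comm (a ℕ.* (2 ℕ.* n)) (2 ℕ.* n) ⟩
      suc a ℕ.* (2 ℕ.* n)         ≤⟨ ℕₚ.*-monoˡ-≤ (2 ℕ.* n) lt ⟩
      b ℕ.* (2 ℕ.* n)             ≤⟨ ℕₚ.m≤m+n (b ℕ.* (2 ℕ.* n)) r′ ⟩
      b ℕ.* (2 ℕ.* n) ℕ.+ r′        ∎
      where open ℕₚ.≤-Reasoning

    digits-≤ : ∀ {a b r r′} → a ≤ b → r < r′ → r < 2 ℕ.* n → a ℕ.* (2 ℕ.* n) ℕ.+ r < b ℕ.* (2 ℕ.* n) ℕ.+ r′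
    digits-≤ {a} {b} {r} {r′} le lt r< with ℕₚ.m≤n⇒m<n∨m≡n le
    ... | inj₁ a<b  = digits-< r′ a<b r<
    ... | inj₂ refl = ℕₚ.+-monoʳ-< (a ℕ.* (2 ℕ.* n)) lt

  -- Numbers to the base 2n that compare as the code prescribes: the leading digit is
  -- the run, and the last digit puts openers before closers of the same number.
  openerKey closerKey : Fin n → ℕ
  openerKey i = label w i ℕ.* (2 ℕ.* n) ℕ.+ toℕ i
  closerKey i = barsBefore w i ℕ.* (2 ℕ.* n) ℕ.+ (n ℕ.+ toℕ i)

  -- The rank of a key among all openers and closers.
  position : ℕ → ℕ
  position κ = countFin (λ k → openerKey k <ᵇ κ) ℕ.+ countFin (λ k → closerKey k <ᵇ κ)

  -- The layout with the given code.
  opener closer : Fin n → ℕ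
  opener i = position (openerKey i)
  closer i = position (closerKey i)

  private
    <ᵇ-mono : ∀ {κ κ′} → κ < κ′ → ∀ m → T (m <ᵇ κ) → T (m <ᵇ κ′)
    <ᵇ-mono lt m t = <⇒<ᵇ (ℕₚ.<-trans (<ᵇ⇒< m _ t) lt)

    ¬self : ∀ κ → ¬ T (κ <ᵇ κ)
    ¬self κ t = ℕₚ.<-irrefl refl (<ᵇ⇒< κ κ t)

    from-opener : ∀ {i κ} → openerKey i < κ → opener i < position κ
    from-opener {i} {κ} lt = ℕₚ.+-mono-<-≤
      (countFin-< {n} (λ k → <ᵇ-mono lt (openerKey k)) i (<⇒<ᵇ lt) (¬self (openerKey i)))
      (countFin-≤ {n} (λ k → <ᵇ-mono lt (closerKey k)))

    from-closer : ∀ {i κ} → closerKey i < κ → closer i < position κ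
    from-closer {i} {κ} lt = ℕₚ.+-mono-≤-<
      (countFin-≤ {n} (λ k → <ᵇ-mono lt (openerKey k)))
      (countFin-< {n} (λ k → <ᵇ-mono lt (closerKey k)) i (<⇒<ᵇ lt) (¬self (closerKey i)))

    o<c⇐ : ∀ {i j} → label w i ≤ barsBefore w j → opener i < closer j
    o<c⇐ {i} {j} le = from-opener (digits-≤ le (ℕₚ.<-≤-trans (toℕ<n i) (ℕₚ.m≤m+n n _)) (i<2n i))

    c<o⇐ : ∀ {i j} → barsBefore w j < label w i → closer j < opener i
    c<o⇐ {i} {j} lt = from-closer (digits-< (toℕ i) lt (n+i<2n j))

    o<o⇐ : ∀ {i j} → label w i < label w j ⊎ (label w i ≡ label w j × toℕ i < toℕ j) → opener i < opener j
    o<o⇐ {i} {j} (inj₁ lt)        = from-opener (digits-< (toℕ j) lt (i<2n i))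
    o<o⇐ {i} {j} (inj₂ (eq , lt)) = from-opener (digits-≤ (ℕₚ.≤-reflexive eq) lt (i<2n i))

    c<c⇐ : ∀ {i j} → toℕ i < toℕ j → closer i < closer j
    c<c⇐ {i} {j} lt = from-closer (digits-≤ (barsBefore-mono w (ℕₚ.<⇒≤ lt)) (ℕₚ.+-monoʳ-< n lt) (n+i<2n i))

    lex-total : ∀ i j → i ≡ j ⊎ opener i < opener j ⊎ opener j < opener i
    lex-total i j with <-cmp (label w i) (label w j)
    ... | tri< lt _ _ = inj₂ (inj₁ (o<o⇐ {i} {j} (inj₁ lt)))
    ... | tri> _ _ gt = inj₂ (inj₂ (o<o⇐ {j} {i} (inj₁ gt)))
    ... | tri≈ _ eq _ with <ᶠ-cmp i j
    ...   | tri< lt _ _ = inj₂ (inj₁ (o<o⇐ {i} {j} (inj₂ (eq , lt))))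
    ...   | tri≈ _ e _  = inj₁ e
    ...   | tri> _ _ gt = inj₂ (inj₂ (o<o⇐ {j} {i} (inj₂ (sym eq , gt))))

    opener≢closer : ∀ i j → opener i ≢ closer j
    opener≢closer i j eq with ℕₚ.≤-<-connex (label w i) (barsBefore w j)
    ... | inj₁ le = ℕₚ.<-irrefl eq (o<c⇐ le)
    ... | inj₂ gt = ℕₚ.<-irrefl (sym eq) (c<o⇐ gt)

    opener-inj : ∀ {i j} → opener i ≡ opener j → i ≡ j
    opener-inj {i} {j} eq with lex-total i j
    ... | inj₁ e = e
    ... | inj₂ (inj₁ lt) = ⊥-elim (ℕₚ.<-irrefl eq lt)
    ... | inj₂ (inj₂ gt) = ⊥-elim (ℕₚ.<-irrefl (sym eq) gt)

    closer-inj : ∀ {i j} → closer i ≡ closer j → i ≡ j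
    closer-inj {i} {j} eq with <ᶠ-cmp i j
    ... | tri< lt _ _ = ⊥-elim (ℕₚ.<-irrefl eq (c<c⇐ lt))
    ... | tri≈ _ e _  = e
    ... | tri> _ _ gt = ⊥-elim (ℕₚ.<-irrefl (sym eq) (c<c⇐ gt))

    closer<2n : ∀ i → closer i < 2 ℕ.* n
    closer<2n i = ℕₚ.<-≤-trans
      (ℕₚ.+-mono-≤-< (countFin-≤n _) (countFin-<n _ i (¬self (closerKey i))))
      (ℕₚ.≤-reflexive (cong (n ℕ.+_) (sym (ℕₚ.+-identityʳ n))))

    opener<2n : ∀ i → opener i < 2 ℕ.* n
    opener<2n i = ℕₚ.<-trans (o<c⇐ (label≤ i)) (closer<2n i)

    -- Openers and closers together, as one family of 2n points; the summand 0 comes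
    -- from the definition of 2 * n.
    coordinate : Fin n ⊎ Fin (n ℕ.+ 0) → ℕ
    coordinate (inj₁ i) = opener i
    coordinate (inj₂ i) = closer (cast (ℕₚ.+-identityʳ n) i)

    coordinate<2n : ∀ p → coordinate p < 2 ℕ.* n
    coordinate<2n (inj₁ i) = opener<2n i
    coordinate<2n (inj₂ i) = closer<2n _

    coordinate-inj : ∀ p q → coordinate p ≡ coordinate q → p ≡ q
    coordinate-inj (inj₁ i) (inj₁ j) eq = cong inj₁ (opener-inj eq)
    coordinate-inj (inj₁ i) (inj₂ j) eq = ⊥-elim (opener≢closer _ _ eq)
    coordinate-inj (inj₂ i) (inj₁ j) eq = ⊥-elim (opener≢closer _ _ (sym eq))
    coordinate-inj (inj₂ i) (inj₂ j) eq = cong inj₂ (toℕ-injective (trans (sym (toℕ-cast _ i))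
      (trans (cong toℕ (closer-inj eq)) (toℕ-cast _ j))))

    point : Fin (2 ℕ.* n) → Fin (2 ℕ.* n)
    point y = fromℕ< (coordinate<2n (splitAt n y))

    toℕ-point : ∀ y → toℕ (point y) ≡ coordinate (splitAt n y)
    toℕ-point y = toℕ-fromℕ< (coordinate<2n (splitAt n y))

    splitAt-inj : ∀ m {k} {i j : Fin (m ℕ.+ k)} → splitAt m i ≡ splitAt m j → i ≡ j
    splitAt-inj m {k} {i} {j} eq = trans (sym (Finₚ.join-splitAt m k i))
      (trans (cong (Fin.join m k) eq) (Finₚ.join-splitAt m k j))

    covered : ∀ x → x < 2 ℕ.* n → ∃[ i ] (x ≡ opener i ⊎ x ≡ closer i)
    covered x lt with injective⇒hits point
      (λ {y} {z} eq → splitAt-inj n (coordinate-inj (splitAt n y) (splitAt n z)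
        (trans (sym (toℕ-point y)) (trans (cong toℕ eq) (toℕ-point z))))) (fromℕ< lt)
    ... | y , eq with splitAt n y | trans (sym (toℕ-fromℕ< lt)) (trans (sym (cong toℕ eq)) (toℕ-point y))
    ...   | inj₁ i | x≡ = i , inj₁ x≡
    ...   | inj₂ i | x≡ = cast (ℕₚ.+-identityʳ n) i , inj₂ x≡

  decoded-layout : Layout opener closer
  decoded-layout = record
    { o<c    = λ i → o<c⇐ (label≤ i)
    ; c-mono = c<c⇐
    ; o≢c    = opener≢closer
    ; o-inj  = opener-inj
    ; c<2n   = closer<2n
    ; cover  = covered
    }

  decoded-agrees : Agrees opener closer w
  decoded-agrees = record
    { o<c⇒ = λ {i} {j} lt → ℕₚ.≮⇒≥ (λ gt → ℕₚ.<-asym lt (c<o⇐ {i} {j} gt))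
    ; c<o⇒ = λ {i} {j} lt → ℕₚ.≰⇒> (λ le → ℕₚ.<-asym lt (o<c⇐ {i} {j} le))
    ; o<o⇒ = λ {i} {j} → lex i j
    }
    where
    lex : ∀ i j → opener i < opener j → label w i < label w j ⊎ (label w i ≡ label w j × toℕ i < toℕ j)
    lex i j lt with <-cmp (label w i) (label w j)
    ... | tri< l _ _ = inj₁ l
    ... | tri> _ _ g = ⊥-elim (ℕₚ.<-asym lt (o<o⇐ {j} {i} (inj₁ g)))
    ... | tri≈ _ e _ with <ᶠ-cmp i j
    ...   | tri< l _ _ = inj₂ (e , l)
    ...   | tri≈ _ refl _ = ⊥-elim (ℕₚ.<-irrefl refl lt)
    ...   | tri> _ _ g = ⊥-elim (ℕₚ.<-asym lt (o<o⇐ {j} {i} (inj₂ (sym e , g))))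

-- Matchings and their codes

-- The layout of a list of arcs.
opener-of closer-of : ∀ {n} → Arcs n → Fin n → ℕ
opener-of M i = toℕ (op (lookup M i))
closer-of M i = toℕ (cl (lookup M i))

matching-layout : ∀ {n} (M : Arcs n) → IsMatching M → Layout (opener-of M) (closer-of M)
matching-layout {n} M (o<c , cover , c-mono) = record
  { o<c    = o<c
  ; c-mono = λ {i} {j} → c-mono i j
  ; o≢c    = λ i j eq → ℕₚ.<-irrefl eq
      (subst (λ k → opener-of M i ℕ.< closer-of M k)
        (same {i} {j} {op (lookup M i)} (inj₁ refl) (inj₂ (toℕ-injective eq))) (o<c i))
  ; o-inj  = λ {i} {j} eq → same {i} {j} {op (lookup M i)} (inj₁ refl) (inj₁ (toℕ-injective eq))
  ; c<2n   = λ i → toℕ<n (cl (lookup M i))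
  ; cover  = covered
  }
  where
  same : ∀ {i j x} → x ≡ op (lookup M i) ⊎ x ≡ cl (lookup M i) →
    x ≡ op (lookup M j) ⊎ x ≡ cl (lookup M j) → i ≡ j
  same {x = x} p q with _ , _ , unique ← cover x = trans (sym (unique p)) (unique q)
  covered : ∀ x → x ℕ.< 2 ℕ.* n → ∃[ i ] (x ≡ opener-of M i ⊎ x ≡ closer-of M i)
  covered x lt with cover (fromℕ< lt)
  ... | i , inj₁ eq , _ = i , inj₁ (trans (sym (toℕ-fromℕ< lt)) (cong toℕ eq))
  ... | i , inj₂ eq , _ = i , inj₂ (trans (sym (toℕ-fromℕ< lt)) (cong toℕ eq))

layout-matching : ∀ {n} (M : Arcs n) → Layout (opener-of M) (closer-of M) → IsMatching M
layout-matching {n} M L = o<c , covered , λ i j → c-mono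
  where
  open Layout L
  covered : ∀ x → ∃! _≡_ λ i → x ≡ op (lookup M i) ⊎ x ≡ cl (lookup M i)
  covered x with cover (toℕ x) (toℕ<n x)
  ... | i , inj₁ eq = i , inj₁ (toℕ-injective eq) , λ where
    (inj₁ refl) → o-inj (sym eq)
    (inj₂ refl) → ⊥-elim (o≢c _ _ (sym eq))
  ... | i , inj₂ eq = i , inj₂ (toℕ-injective eq) , λ where
    (inj₁ refl) → ⊥-elim (o≢c _ _ eq)
    (inj₂ refl) → c-inj (sym eq)

IsLeftNestingFree : ∀ {n} → Arcs n → Set
IsLeftNestingFree M = IsMatching M × ¬ HasLeftNesting M

isLeftNestingFree? : ∀ {n} → Decidable (IsLeftNestingFree {n})
isLeftNestingFree? M = isMatching? M ×-dec ¬? (hasLeftNesting? M)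

∈𝓝⇒leftNestingFree : ∀ {n M} → M ∈ 𝓝 n → IsLeftNestingFree M
∈𝓝⇒leftNestingFree {n} M∈ = proj₂ (∈-filter⁻ isLeftNestingFree?
  {xs = words (cartesianProduct (allFin (2 ℕ.* n)) (allFin (2 ℕ.* n))) n} M∈)

noLeftNesting : ∀ {n} (M : Arcs n) → IsLeftNestingFree M → NoLeftNesting (opener-of M) (closer-of M)
noLeftNesting M ((o<c , _) , free) {i} {j} eq lt =
  free (i , j , ℕₚ.≤-reflexive (sym eq) , o<c i , lt , eq)

code : ∀ {n} → Arcs n → Code n
code M = encode (opener-of M) (closer-of M)

code-injective : ∀ {n} (M M′ : Arcs n) → IsLeftNestingFree M → IsLeftNestingFree M′ →
  code M ≡ code M′ → M ≡ M′
code-injective {n} M M′ p p′ eq = trans (sym (tabulate∘lookup M)) (trans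
  (tabulate-cong (λ i → let e , e′ = layout-determined L L′ A A′ i in
    cong₂ _,_ (toℕ-injective e) (toℕ-injective e′))) (tabulate∘lookup M′))
  where
  L = matching-layout M (proj₁ p)
  L′ = matching-layout M′ (proj₁ p′)
  A : Agrees (opener-of M) (closer-of M) (code M)
  A = encodes-agrees L (noLeftNesting M p) (encode-encodes _ _)
  A′ : Agrees (opener-of M′) (closer-of M′) (code M)
  A′ = subst (Agrees _ _) (sym eq) (encodes-agrees L′ (noLeftNesting M′ p′) (encode-encodes _ _))

module _ {n} {w : Code n} (V : Valid (dis ∷ []) w) where

  private
    L = decoded-layout V
    open Layout L using () renaming (o<c to o<c; c<2n to c<2n)

    o<2n : ∀ i → opener V i ℕ.< 2 ℕ.* n
    o<2n i = ℕₚ.<-trans (o<c i) (c<2n i)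

  -- The matching with a given code.
  decode : Arcs n
  decode = Vec.tabulate (λ i → fromℕ< (o<2n i) , fromℕ< (c<2n i))

  private
    opener≡ : ∀ i → opener V i ≡ opener-of decode i
    opener≡ i = sym (trans (cong (toℕ ∘ op) (lookup∘tabulate _ i)) (toℕ-fromℕ< (o<2n i)))

    closer≡ : ∀ i → closer V i ≡ closer-of decode i
    closer≡ i = sym (trans (cong (toℕ ∘ cl) (lookup∘tabulate _ i)) (toℕ-fromℕ< (c<2n i)))

  decode-layout : Layout (opener-of decode) (closer-of decode)
  decode-layout = Layout-resp opener≡ closer≡ L

  decode-agrees : Agrees (opener-of decode) (closer-of decode) w
  decode-agrees = Agrees-resp opener≡ closer≡ (decoded-agrees V)

  decode-leftNestingFree : IsLeftNestingFree decode
  decode-leftNestingFree = layout-matching decode decode-layout ,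
    λ (i , j , _ , _ , lt , eq) → agrees-noLeftNesting decode-layout decode-agrees V eq lt

  code-decode : code decode ≡ w
  code-decode = encodes-unique (agrees-encodes decode-layout decode-agrees V)

𝓝↭codes : ∀ n → List.map code (𝓝 n) ↭ codes n (dis ∷ [])
𝓝↭codes n = bijection⇒↭ code
  (Unique.filter⁺ isLeftNestingFree? (words-unique (Unique.cartesianProduct⁺ (Unique.allFin⁺ _) (Unique.allFin⁺ _)) n))
  (codes-unique n (dis ∷ []))
  (λ {M} {M′} M∈ M′∈ → code-injective M M′ (∈𝓝⇒leftNestingFree M∈) (∈𝓝⇒leftNestingFree M′∈))
  (λ {M} M∈ → codes-complete (dis ∷ []) (code M) (encodes-valid (matching-layout M (proj₁ (∈𝓝⇒leftNestingFree M∈)))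
    (noLeftNesting M (∈𝓝⇒leftNestingFree M∈)) (encode-encodes _ _)))
  (λ w∈ → let V = codes-valid n (dis ∷ []) w∈ in
    decode V , ∈-filter⁺ isLeftNestingFree? (∈-words (λ (i , j) → ∈-cartesianProduct⁺ (∈-allFin i) (∈-allFin j)) (decode V))
      (decode-leftNestingFree V) , code-decode V)

barsBefore-zero : ∀ {n} (w : Code (suc n)) → barsBefore w zero ≡ 0
barsBefore-zero (_ ∷ _) = refl

module _ {a} {A : Set a} where

  -- The entry before position i, or p if there is none.
  prev : ∀ {m} → A → Vec A m → Fin m → A
  prev p (y ∷ v) zero    = p
  prev p (y ∷ v) (suc i) = prev y v i

  prev-first : ∀ {m} p (v : Vec A m) i → toℕ i ≡ 0 → prev p v i ≡ p
  prev-first p (y ∷ v) zero _ = refl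

  prev-next : ∀ {m} p (v : Vec A m) h i → h ⋖ i → prev p v i ≡ lookup v h
  prev-next p (y ∷ z ∷ v) zero (suc zero) eq = refl
  prev-next p (y ∷ v) zero (suc (suc i)) ()
  prev-next p (y ∷ v) (suc h) (suc i) eq = prev-next y v h i (suc-injective eq)

zeroLabels-countFin : ∀ {n} (w : Code n) → zeroLabels w ≡ countFin (λ i → label w i ≡ᵇ 0)
zeroLabels-countFin []            = refl
zeroLabels-countFin ((c , b) ∷ w) = cong (ind (c ≡ᵇ 0) ℕ.+_) (zeroLabels-countFin w)

falls-countFin : ∀ {n} p (w : Code n) →
  falls (threshold p) w ≡ countFin (λ i → label w i <ᵇ threshold (prev p w i))
falls-countFin p []            = refl
falls-countFin p ((c , b) ∷ w) = cong (ind (c <ᵇ threshold p) ℕ.+_) (falls-countFin (c , b) w)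

-- Every step but the last either draws a bar or makes the next step come after no
-- bar.
bars-countFin : ∀ {m} p (w : Code (suc m)) → (∀ i → T (flag w i) → suc (toℕ i) ℕ.< suc m) →
  countFin (λ i → not (proj₂ (prev p w i))) ℕ.+ bars w ≡ ind (not (proj₂ p)) ℕ.+ m
bars-countFin p ((c , true) ∷ []) inner with s≤s () ← inner zero tt
bars-countFin p ((c , false) ∷ []) inner = ℕₚ.+-identityʳ _
bars-countFin {suc m} p ((c , b) ∷ w) inner = begin
  ind (not (proj₂ p)) ℕ.+ k ℕ.+ (ind b ℕ.+ bars w)
    ≡⟨ ℕₚ.+-assoc (ind (not (proj₂ p))) k _ ⟩
  ind (not (proj₂ p)) ℕ.+ (k ℕ.+ (ind b ℕ.+ bars w))
    ≡⟨ cong (ind (not (proj₂ p)) ℕ.+_) (begin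
         k ℕ.+ (ind b ℕ.+ bars w)       ≡⟨ cong (k ℕ.+_) (ℕₚ.+-comm (ind b) (bars w)) ⟩
         k ℕ.+ (bars w ℕ.+ ind b)       ≡⟨ ℕₚ.+-assoc k (bars w) (ind b) ⟨
         k ℕ.+ bars w ℕ.+ ind b         ≡⟨ cong (ℕ._+ ind b) (bars-countFin (c , b) w (λ i t → ℕ.s≤s⁻¹ (inner (suc i) t))) ⟩
         ind (not b) ℕ.+ m ℕ.+ ind b    ≡⟨ complement b ⟩
         suc m                      ∎) ⟩
  ind (not (proj₂ p)) ℕ.+ suc m ∎
  where
  open ≡-Reasoning
  k : ℕ
  k = countFin (λ i → not (proj₂ (prev (c , b) w i)))
  complement : ∀ b → ind (not b) ℕ.+ m ℕ.+ ind b ≡ suc m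
  complement true  = ℕₚ.+-comm m 1
  complement false = ℕₚ.+-identityʳ _

module _ {m} (M : Arcs (suc m)) (free : IsLeftNestingFree M)
  {w : Code (suc m)} (E : Encodes (opener-of M) (closer-of M) w) where

  private
    L = matching-layout M (proj₁ free)
    A = encodes-agrees L (noLeftNesting M free) E
    open Layout L
    open Encodes E
    open Agrees A
    -- The entry assumed before the first step: with a bar, so that there is nothing
    -- to compare with.
    start : ℕ × Bool
    start = 0 , true

    unbroken : ∀ {h i} → h ⋖ i → flag w h ≡ false → cl (lookup M h) ⋖ cl (lookup M i)
    unbroken {h} {i} h⋖i fl with closer-of M i ℕₚ.≟ suc (closer-of M h)
    ... | yes eq = eq
    ... | no ne  = ⊥-elim (subst T fl (Equivalence.from (flag-break h) (i , h⋖i , ne)))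

    broken : ∀ {h i} → h ⋖ i → cl (lookup M h) ⋖ cl (lookup M i) → ¬ T (flag w h)
    broken {h} {i} h⋖i cl⋖ t with Equivalence.to (flag-break h) t
    ... | j , h⋖j , ne with refl ← toℕ-injective {i = i} {j} (trans h⋖i (sym h⋖j)) = ne cl⋖

  min-code : min M ≡ zeroLabels w
  min-code = trans (#-Bool (λ i → op (lookup M i) Finₚ.<? cl (head M)) _
    (λ i → mk⇔ (to i) (from i))) (sym (zeroLabels-countFin w))
    where
    head≡ : ∀ (M : Arcs (suc m)) → head M ≡ lookup M zero
    head≡ (_ ∷ _) = refl
    to : ∀ i → op (lookup M i) Fin.< cl (head M) → T (label w i ≡ᵇ 0)
    to i lt = ≡⇒≡ᵇ (label w i) 0 (ℕₚ.n≤0⇒n≡0 (subst (label w i ℕ.≤_) (barsBefore-zero w)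
      (o<c⇒ {i} {zero} (subst (λ a → op (lookup M i) Fin.< cl a) (head≡ M) lt))))
    from : ∀ i → T (label w i ≡ᵇ 0) → op (lookup M i) Fin.< cl (head M)
    from i t = subst (λ a → op (lookup M i) Fin.< cl a) (sym (head≡ M))
      (⇒o<c L A {i} {zero} (ℕₚ.≤-reflexive (trans (≡ᵇ⇒≡ (label w i) 0 t) (sym (barsBefore-zero w)))))

  rne-code : rne M ≡ falls 0 w
  rne-code = trans (#-Bool (isRightNesting? M) _ (λ i → mk⇔ (to i) (from i))) (sym (falls-countFin start w))
    where
    to : ∀ i → IsRightNesting M i → T (label w i <ᵇ threshold (prev start w i))
    to i (h , h⋖i , o<o , _ , cl⋖) rewrite prev-next start w h i h⋖i with flag w h | broken h⋖i cl⋖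
    ... | true  | ¬t = ⊥-elim (¬t tt)
    ... | false | _ with o<o⇒ {i} {h} o<o
    ...   | inj₁ lt = <⇒<ᵇ lt
    ...   | inj₂ (_ , i<h) = ⊥-elim (ℕₚ.<-asym i<h (ℕₚ.≤-reflexive (sym h⋖i)))
    from : ∀ i → T (label w i <ᵇ threshold (prev start w i)) → IsRightNesting M i
    from i t with predecessor i
    ... | inj₁ eq rewrite prev-first start w i eq = ⊥-elim t
    ... | inj₂ (h , h⋖i) rewrite prev-next start w h i h⋖i with flag w h in fl
    ...   | true  = ⊥-elim t
    ...   | false = h , h⋖i , ⇒o<o L A {i} {h} (inj₁ (<ᵇ⇒< _ _ t)) , o<c h , unbroken h⋖i fl

  int-code : int M ∸ 1 ≡ bars w
  int-code = begin
    suc m ∸ # (isCloserAfterCloser? M) ∸ 1 ≡⟨ cong (λ k → suc m ∸ k ∸ 1) #≡ ⟩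
    suc m ∸ k ∸ 1        ≡⟨ cong (λ m → suc m ∸ k ∸ 1) k+bars ⟨
    suc (k ℕ.+ bars w) ∸ k ∸ 1 ≡⟨ cong (λ m → m ∸ k ∸ 1) (ℕₚ.+-suc k (bars w)) ⟨
    (k ℕ.+ suc (bars w)) ∸ k ∸ 1 ≡⟨ cong (_∸ 1) (ℕₚ.m+n∸m≡n k (suc (bars w))) ⟩
    bars w ∎
    where
    open ≡-Reasoning
    k : ℕ
    k = countFin (λ i → not (proj₂ (prev start w i)))
    to : ∀ i → IsCloserAfterCloser M i → T (not (proj₂ (prev start w i)))
    to i (h , h⋖i , cl⋖) rewrite prev-next start w h i h⋖i with flag w h | broken h⋖i cl⋖
    ... | true  | ¬t = ⊥-elim (¬t tt)
    ... | false | _  = tt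
    from : ∀ i → T (not (proj₂ (prev start w i))) → IsCloserAfterCloser M i
    from i t with predecessor i
    ... | inj₁ eq rewrite prev-first start w i eq = ⊥-elim t
    ... | inj₂ (h , h⋖i) rewrite prev-next start w h i h⋖i with flag w h in fl
    ...   | true  = ⊥-elim t
    ...   | false = h , h⋖i , unbroken h⋖i fl
    #≡ : # (isCloserAfterCloser? M) ≡ k
    #≡ = #-Bool (isCloserAfterCloser? M) _ (λ i → mk⇔ (to i) (from i))
    k+bars : k ℕ.+ bars w ≡ m
    k+bars = bars-countFin start w λ i t → let j , i⋖j , _ = Equivalence.to (flag-break i) t in
      subst (ℕ._< suc m) i⋖j (toℕ<n j)

module MatchingSum {c ℓ} (R : CommutativeSemiring c ℓ) (s x w : CommutativeSemiring.Carrier R) where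
  open CommutativeSemiring R hiding (zero; _+_) renaming (refl to ≈-refl; sym to ≈-sym; trans to ≈-trans)
  open Sums R
  open SumLemmas R
  open StatePolynomial R s x w
  open CodeSum R s x w
  open import Relation.Binary.Reasoning.Setoid setoid

  matching-sum : ∀ n .{{_ : NonZero n}} →
    (∑[ M ∈ 𝓝 n ] (s ^ min M * x ^ rne M * w ^ (int M ∸ 1))) ≈ F topBar n [] (dis ∷ [])
  matching-sum n@(suc _) = begin
    (∑[ M ∈ 𝓝 n ] (s ^ min M * x ^ rne M * w ^ (int M ∸ 1)))
      ≈⟨ sum-cong {xs = 𝓝 n} (λ {M} M∈ → let free = ∈𝓝⇒leftNestingFree M∈ in
           reflexive (cong₂ _*_ (cong₂ (λ a b → s ^ a * x ^ b) (min-code M free (E M)) (rne-code M free (E M)))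
             (cong (w ^_) (int-code M free (E M))))) ⟩
    sumOver (𝓝 n) (weightC 0 ∘ code)         ≈⟨ sum-map code (𝓝 n) (weightC 0) ⟨
    sumOver (List.map code (𝓝 n)) (weightC 0) ≈⟨ sum-↭ (weightC 0) (𝓝↭codes n) ⟩
    sumOver (codes n (dis ∷ [])) (weightC 0)       ≈⟨ codes-sum n [] (dis ∷ []) (refl , []) ⟩
    F topBar n [] (dis ∷ []) ∎
    where
    E : ∀ M → Encodes (opener-of M) (closer-of M) (code M)
    E M = encode-encodes (opener-of M) (closer-of M)

theorem8p3 : ∀ {c ℓ} (R : CommutativeSemiring c ℓ) →
    let open CommutativeSemiring R
        open Sums R
    in (n : ℕ) .{{_ : NonZero n}} (s x w : Carrier) →
       (∑[ π ∈ 𝓢 n ] (s ^ rmin π * x ^ pSilly π * w ^ des π))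
       ≈ (∑[ M ∈ 𝓝 n ] (s ^ min M * x ^ rne M * w ^ (int M ∸ 1)))
theorem8p3 R n s x w = begin
  (∑[ π ∈ 𝓢 n ] (s ^ rmin π * x ^ pSilly π * w ^ des π))
    ≈⟨ PermutationSum.permutation-sum R s x w n ⟩
  F besideBar n [] (dis ∷ [])
    ≈⟨ F-insertion besideBar-admissible topBar-admissible n [] (dis ∷ []) ⟩
  F topBar n [] (dis ∷ [])
    ≈⟨ MatchingSum.matching-sum R s x w n ⟨
  (∑[ M ∈ 𝓝 n ] (s ^ min M * x ^ rne M * w ^ (int M ∸ 1))) ∎
  where
  open CommutativeSemiring R using (_*_; setoid)
  open Sums R
  open StatePolynomial R s x w
  open import Relation.Binary.Reasoning.Setoid setoid
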